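{- Every language $A\in\mathrm{P}$ whose census function is computable in polynomial time is rankable if and only if $\mathrm{P}=\mathrm{PP}$.
   Context: Strings are over $\Sigma=\{0,1\}$, with $\le$ the standard lexicographic order on $\Sigma^*$. The census function of $A$ is $\mathrm{census}_A(1^n)=|\{x\in A:|x|=n\}|$. The ranking function of $A$ maps $x$ to $|\{y\le x: y\in A\}|$; $A$ is rankable if its ranking function is polynomial-time computable. PP is probabilistic polynomial time (languages $L$ with $A\in\mathrm{P}$, polynomial $p$ such that $x\in L\iff|\{y:|y|=p(|x|),\langle x,y\rangle\in A\}|\ge 2^{p(|x|)-1}$). -}

module Defs where

open import Data.Nat using (ℕ; zero; suc; _+_; _*_; _∸_; _^_; _≤_; _<ᵇ_; _≡ᵇ_)
open import Data.Bool using (Bool; true; false; if_then_else_; _∧_; _∨_; not)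
open import Data.List using (List; []; _∷_; _++_; length; replicate; concatMap; map; filter; foldr; foldl; concat; upTo)
open import Data.Maybe using (Maybe; just; nothing)
open import Data.Fin using (Fin)
open import Data.Product using (Σ; _×_; _,_; ∃)
open import Relation.Binary.PropositionalEquality using (_≡_)

-- Strings over Σ = {0,1}: 0 = false, 1 = true.

Str : Set
Str = List Bool

Lang : Set
Lang = Str → Bool

-- Machine model: deterministic single-tape Turing machine with a
-- two-way infinite tape over symbols {0,1,blank} (blank = nothing).

Sym : Set
Sym = Maybe Bool

data Move : Set where
  mL mR mS : Move

record TM : Set where
  field
    nQ : ℕ                      -- states are Fin (suc nQ); start state is zero
    δ  : Fin (suc nQ) → Sym → Maybe (Fin (suc nQ) × Sym × Move)
                                -- nothing = halt

record Config (M : TM) : Set where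
  constructor cfg
  field
    state : Fin (suc (TM.nQ M))
    left  : List Sym            -- cells left of the head, nearest first
    head  : Sym
    right : List Sym            -- cells right of the head, nearest first

initConfig : (M : TM) → Str → Config M
initConfig M []      = cfg Fin.zero [] nothing []
initConfig M (b ∷ x) = cfg Fin.zero [] (just b) (map just x)

private
  move : ∀ {M} → Fin (suc (TM.nQ M)) → List Sym → Sym → List Sym → Move → Config M
  move q l       h r       mS = cfg q l h r
  move q []      h r       mL = cfg q [] nothing (h ∷ r)
  move q (a ∷ l) h r       mL = cfg q l a (h ∷ r)
  move q l       h []      mR = cfg q (h ∷ l) nothing []
  move q l       h (a ∷ r) mR = cfg q (h ∷ l) a r

run : (M : TM) → ℕ → Config M → Maybe (Config M)
run M t (cfg q l h r) with TM.δ M q h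
... | nothing = just (cfg q l h r)
run M zero    (cfg q l h r) | just _ = nothing
run M (suc t) (cfg q l h r) | just (q' , w , d) = run M t (move {M} q' l w r d)

readWord : List Sym → Str
readWord []             = []
readWord (nothing ∷ _)  = []
readWord (just b ∷ s)   = b ∷ readWord s

output : ∀ {M} → Config M → Str
output (cfg _ _ h r) = readWord (h ∷ r)

HaltsWith : TM → Str → ℕ → Str → Set
HaltsWith M x t y = Σ (Config M) λ c → (run M t (initConfig M x) ≡ just c) × (output c ≡ y)

-- Value of a binary string, most significant bit first.
binVal : Str → ℕ
binVal = foldl (λ acc b → 2 * acc + (if b then 1 else 0)) 0

-- Polynomial time. A time bound (n + c)^c dominates every polynomial.

InP : Lang → Set
InP A = Σ TM λ M → Σ ℕ λ c → ∀ x → HaltsWith M x ((length x + c) ^ c) (A x ∷ [])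

PolyComputable : (Str → ℕ) → Set
PolyComputable f = Σ TM λ M → Σ ℕ λ c → ∀ x →
  Σ Str λ y → HaltsWith M x ((length x + c) ^ c) y × (binVal y ≡ f x)

strings : ℕ → List Str
strings zero    = [] ∷ []
strings (suc n) = concatMap (λ s → (false ∷ s) ∷ (true ∷ s) ∷ []) (strings n)

count : (Str → Bool) → List Str → ℕ
count P = foldr (λ s acc → (if P s then 1 else 0) + acc) 0

census : Lang → ℕ → ℕ
census A n = count A (strings n)

lexLeq : Str → Str → Bool
lexLeq []      _       = true
lexLeq (_ ∷ _) []      = false
lexLeq (a ∷ x) (b ∷ y) = if a ≡ᵇ' b then lexLeq x y else (not a ∧ b)
  where
    _≡ᵇ'_ : Bool → Bool → Bool
    true  ≡ᵇ' true  = true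
    false ≡ᵇ' false = true
    _     ≡ᵇ' _     = false

stdLeq : Str → Str → Bool
stdLeq y x = (length y <ᵇ length x) ∨ ((length y ≡ᵇ length x) ∧ lexLeq y x)

stringsUpTo : ℕ → List Str
stringsUpTo n = concat (map strings (upTo (suc n)))

rank : Lang → Str → ℕ
rank A x = count (λ y → stdLeq y x ∧ A y) (stringsUpTo (length x))

Rankable : Lang → Set
Rankable A = PolyComputable (rank A)

CensusPolyTime : Lang → Set
CensusPolyTime A = Σ TM λ M → Σ ℕ λ c → ∀ n →
  Σ Str λ y → HaltsWith M (replicate n true) ((n + c) ^ c) y × (binVal y ≡ census A n)

pair : Str → Str → Str
pair x y = concatMap (λ b → b ∷ b ∷ []) x ++ (false ∷ true ∷ y)

-- polynomials with natural coefficients (constant term first)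
Poly : Set
Poly = List ℕ

evalPoly : Poly → ℕ → ℕ
evalPoly cs n = foldr (λ a acc → a + n * acc) 0 cs

InPP : Lang → Set
InPP L = Σ Lang λ A → InP A × Σ Poly λ p → ∀ x →
  let m = evalPoly p (length x)
      k = count (λ y → A (pair x y)) (strings m)
  in (L x ≡ true → 2 ^ (m ∸ 1) ≤ k) × (2 ^ (m ∸ 1) ≤ k → L x ≡ true)

PeqPP : Set
PeqPP = ∀ L → (InP L → InPP L) × (InPP L → InP L)

{-# OPTIONS --safe #-}
-- Let A ∈ P be the verifier of L ∈ PP. Inserting a bit b after the separator of ⟨x,y⟩, and flipping the
-- membership in A if b = 1, gives a language B ∈ P (balanced A) that contains exactly half of the strings of
-- each positive length, so that its census is trivial. The strings with given x and b = 0 form an interval,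
-- hence the number of witnesses of x is a difference of two ranks in B.
--
-- Conversely, rank(x) ≥ k is a PP question: of the 2ʰ⁺¹ choices, those starting with 0 accept rank(x)·2ᵈ
-- times and those starting with 1 accept 2ʰ − k·2ᵈ times, so that half of all choices accept iff
-- rank(x) ≥ k. If P = PP, the rank is therefore found by binary search.
--
-- Machines are programmed on finitely many stacks and then compiled to a single tape with polynomial
-- overhead; a Turing machine is itself simulated by such a program, so that it can be called as a subroutine.
module Submission where

open import Defs
open import Data.Bool using (Bool; true; false; if_then_else_; not; _∧_; _xor_; T)
open import Data.Empty using (⊥)
open import Data.Fin using (Fin; zero; suc; toℕ; inject₁)
open import Data.Fin.Properties using (toℕ-inject₁)
import Data.List as List
open import Data.List using (List; []; _∷_; _++_; _∷ʳ_; _ʳ++_; map; length; lookup; concat; concatMap; foldr; foldl;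
    upTo; allFin)
open import Data.List.Properties
  using (ʳ++-ʳ++; ʳ++-defn; ++-identityʳ; length-++; length-ʳ++; length-map; length-replicate; map-++; concat-++;
      upTo-∷ʳ)
open import Data.List.Membership.Propositional using (_∈_)
open import Data.List.Membership.Propositional.Properties using (∈-map⁺; ∈-++⁺ˡ; ∈-++⁺ʳ; ∈-concatMap⁺; ∈-allFin)
open import Data.List.Relation.Unary.All as All using (All; []; _∷_)
open import Data.List.Relation.Unary.Any as Any using (here; there; index)
open import Data.List.Relation.Unary.Any.Properties using (lookup-index)
import Data.Maybe as Maybe
open import Data.Maybe using (Maybe; just; nothing)
open import Data.Nat using (ℕ; zero; suc; _+_; _*_; _∸_; _^_; _⊔_; _≤_; _<_; _≤ᵇ_; _<ᵇ_; _≡ᵇ_; z≤n; s≤s; NonZero)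
open import Data.Nat.Properties
open import Data.Nat.Tactic.RingSolver using (solve-∀)
open import Data.Product using (Σ; _×_; _,_; proj₁; proj₂; ∃-syntax)
open import Data.Sum using (_⊎_; inj₁; inj₂; map₁)
open import Data.Unit using (⊤; tt)
open import Data.Vec using (Vec; []; _∷_; replicate; tail; _[_]≔_) renaming (lookup to _!_)
open import Function using (_∘_; id)
open import Relation.Binary.PropositionalEquality

-- The hypothesis on ranking applies only to languages with an easy census, and the census of a
-- verifier may be as hard to compute as the acceptance counts in question. Balancing removes this
-- obstacle: every nonempty string, whether it codes a pair or not, has a well-defined position at
-- which flipping the bit flips membership. In the other direction, PP can only compare an
-- acceptance count with one half of all choices. Two devices turn this into a comparison of the
-- rank with k. A string z of length |x| - j is coded as 0ʲ1z, where the zeros make up for the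
-- missing bits; so strings of all lengths up to |x| are followed by equally many bits of padding
-- and have equal weight. And k is only asked about in the form r·2ⁱ, with r the leading bits under
-- test, so that a lexicographic comparison of the choice with r accepts 2ʰ - k·2ᵈ times without any
-- arithmetic. The padding needs no tuning: a choice is as long as the question.

-- Finite types, used for states of machines

record Finite (A : Set) : Set where
  field
    enum     : List A
    complete : ∀ a → a ∈ enum

open Finite

⊎-finite : ∀ {A B} → Finite A → Finite B → Finite (A ⊎ B)
⊎-finite FA FB .enum = map inj₁ (enum FA) ++ map inj₂ (enum FB)
⊎-finite FA FB .complete (inj₁ a) = ∈-++⁺ˡ (∈-map⁺ inj₁ (complete FA a))
⊎-finite FA FB .complete (inj₂ b) = ∈-++⁺ʳ (map inj₁ (enum FA)) (∈-map⁺ inj₂ (complete FB b))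

Σ-finite : ∀ {A} {B : A → Set} → Finite A → (∀ a → Finite (B a)) → Finite (Σ A B)
Σ-finite FA FB .enum = concatMap (λ a → map (a ,_) (enum (FB a))) (enum FA)
Σ-finite FA FB .complete (a , b) =
  ∈-concatMap⁺ _ (Any.map (λ { refl → ∈-map⁺ (a ,_) (complete (FB a) b) }) (complete FA a))

Fin-finite : ∀ n → Finite (Fin n)
Fin-finite n .enum     = allFin n
Fin-finite n .complete = ∈-allFin

⊥-finite : Finite ⊥
⊥-finite .enum = []
⊥-finite .complete ()

⊤-finite : Finite ⊤
⊤-finite .enum       = tt ∷ []
⊤-finite .complete _ = here refl

Bool-finite : Finite Bool
Bool-finite .enum = true ∷ false ∷ []
Bool-finite .complete true  = here refl
Bool-finite .complete false = there (here refl)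

Maybe-finite : ∀ {A} → Finite A → Finite (Maybe A)
Maybe-finite FA .enum = nothing ∷ map just (enum FA)
Maybe-finite FA .complete nothing  = here refl
Maybe-finite FA .complete (just a) = there (∈-map⁺ just (complete FA a))

Sym-finite : Finite Sym
Sym-finite = Maybe-finite Bool-finite

image-finite : ∀ {A B} → Finite A → (f : A → B) → (∀ b → ∃[ a ] f a ≡ b) → Finite B
image-finite FA f onto .enum = map f (enum FA)
image-finite FA f onto .complete b with onto b
... | a , refl = ∈-map⁺ f (complete FA a)

-- Half-tapes are finite lists continued by blanks, hence compared through get.

hd : List Sym → Sym
hd []      = nothing
hd (a ∷ _) = a

tl : ∀ {A : Set} → List A → List A
tl []      = []
tl (_ ∷ l) = l

get : List Sym → ℕ → Sym
get l zero    = hd l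
get l (suc n) = get (tl l) n

infix 4 _≋_
_≋_ : List Sym → List Sym → Set
l ≋ l′ = ∀ n → get l n ≡ get l′ n

∷-≋ : ∀ {l l′} a → l ≋ l′ → a ∷ l ≋ a ∷ l′
∷-≋ a e zero    = refl
∷-≋ a e (suc n) = e n

tl-≋ : ∀ {l l′} → l ≋ l′ → tl l ≋ tl l′
tl-≋ e n = e (suc n)

η-≋ : ∀ {l l′} → l ≋ l′ → hd l ∷ tl l ≋ l′
η-≋ e zero    = e zero
η-≋ e (suc n) = e (suc n)

readWord-≋ : ∀ l l′ → l ≋ l′ → readWord l ≡ readWord l′
readWord-≋ []             []              e = refl
readWord-≋ []             (nothing ∷ _)   e = refl
readWord-≋ []             (just _ ∷ _)    e with () ← e 0
readWord-≋ (nothing ∷ _)  []              e = refl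
readWord-≋ (just _ ∷ _)   []              e with () ← e 0
readWord-≋ (nothing ∷ _)  (nothing ∷ _)   e = refl
readWord-≋ (nothing ∷ _)  (just _ ∷ _)    e with () ← e 0
readWord-≋ (just _ ∷ _)   (nothing ∷ _)   e with () ← e 0
readWord-≋ (just a ∷ l)   (just b ∷ l′)   e with refl ← e 0 = cong (a ∷_) (readWord-≋ l l′ (tl-≋ e))

-- The move of the machine model with its end-of-tape cases merged: `hd` supplies the blank and `tl`
-- the empty rest.
mv : ∀ {M} → Fin (suc (TM.nQ M)) → List Sym → Sym → List Sym → Move → Config M
mv q l h r mS = cfg q l h r
mv q l h r mL = cfg q (tl l) (hd l) (h ∷ r)
mv q l h r mR = cfg q (h ∷ l) (hd r) (tl r)

run-step : ∀ M q l h r {q′ w d} t → TM.δ M q h ≡ just (q′ , w , d) →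
           run M (suc t) (cfg q l h r) ≡ run M t (mv q′ l w r d)
run-step M q l       h r       {d = mS} t e rewrite e = refl
run-step M q []      h r       {d = mL} t e rewrite e = refl
run-step M q (_ ∷ _) h r       {d = mL} t e rewrite e = refl
run-step M q l       h []      {d = mR} t e rewrite e = refl
run-step M q l       h (_ ∷ _) {d = mR} t e rewrite e = refl

run-halt : ∀ M q l h r t → TM.δ M q h ≡ nothing → run M t (cfg q l h r) ≡ just (cfg q l h r)
run-halt M q l h r zero    e rewrite e = refl
run-halt M q l h r (suc t) e rewrite e = refl

run-timeout : ∀ M q l h r {v} → TM.δ M q h ≡ just v → run M 0 (cfg q l h r) ≡ nothing
run-timeout M q l h r e rewrite e = refl

-- Turing machines with an arbitrary finite type of states

module Realise {S : Set} (fin : Finite S) (s₀ : S) (δ : S → Sym → Maybe (S × Sym × Move)) where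

  -- The scanned cell is the first cell of the right half, so that a whole layout of stacks can
  -- serve as the right half.
  Conf : Set
  Conf = S × List Sym × List Sym

  moved : S → List Sym → Sym → List Sym → Move → Conf
  moved q l w r mS = q , l , w ∷ r
  moved q l w r mL = q , tl l , hd l ∷ w ∷ r
  moved q l w r mR = q , w ∷ l , r

  infix 4 _⟶[_]_
  data _⟶[_]_ : Conf → ℕ → Conf → Set where
    done : ∀ {c} → c ⟶[ 0 ] c
    step : ∀ {q l r q′ w d n c} → δ q (hd r) ≡ just (q′ , w , d) →
           moved q′ l w (tl r) d ⟶[ n ] c → (q , l , r) ⟶[ suc n ] c

  infixr 5 _⊙_
  _⊙_ : ∀ {a b c m n} → a ⟶[ m ] b → b ⟶[ n ] c → a ⟶[ m + n ] c
  done     ⊙ q = q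
  step e p ⊙ q = step e (p ⊙ q)

  -- A machine starts in state `zero`, so this index is reserved for `s₀`, which thereby has two
  -- indices. For this reason `rel` compares states through `from`.
  from : Fin (suc (length (enum fin))) → S
  from zero    = s₀
  from (suc i) = lookup (enum fin) i

  to : S → Fin (suc (length (enum fin)))
  to s = suc (index (complete fin s))

  from-to : ∀ s → from (to s) ≡ s
  from-to s = sym (lookup-index (complete fin s))

  tm : TM
  tm = record { nQ = length (enum fin)
              ; δ  = λ i a → Maybe.map (λ (s , w , d) → to s , w , d) (δ (from i) a) }

  infix 4 _~_
  data _~_ : Conf → Config tm → Set where
    rel : ∀ {s l r i l′ h r′} → from i ≡ s → l ≋ l′ → r ≋ h ∷ r′ → (s , l , r) ~ cfg i l′ h r′

  ~-step : ∀ {q l r q′ w d c} → δ q (hd r) ≡ just (q′ , w , d) → (q , l , r) ~ c →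
           ∃[ c′ ] moved q′ l w (tl r) d ~ c′ × (∀ t → run tm (suc t) c ≡ run tm t c′)
  ~-step {q} {l} {r} {q′} {w} {d} {cfg i l′ h r′} e (rel refl el er) =
      mv (to q′) l′ w r′ d , related d , λ t → run-step tm i l′ h r′ t eq
    where
    eq : TM.δ tm i h ≡ just (to q′ , w , d)
    eq rewrite sym (er 0) | e = refl
    related : ∀ d → moved q′ l w (tl r) d ~ mv (to q′) l′ w r′ d
    related mS = rel (from-to q′) el (∷-≋ w (tl-≋ er))
    related mL = rel (from-to q′) (tl-≋ el) λ { zero → el 0 ; (suc n) → ∷-≋ w (tl-≋ er) n }
    related mR = rel (from-to q′) (∷-≋ w el) λ n → trans (er (suc n)) (sym (η-≋ {r′} (λ _ → refl) n))

  ~-run : ∀ {a b n c} → a ⟶[ n ] b → a ~ c → ∃[ d ] b ~ d × (∀ t → run tm (n + t) c ≡ run tm t d)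
  ~-run done       r = _ , r , λ _ → refl
  ~-run (step e p) r with ~-step e r
  ... | c′ , r′ , f with ~-run p r′
  ...   | d , r″ , g = d , r″ , λ t → trans (f _) (g t)

-- Stack machines

Env : ℕ → Set
Env k = Vec Str k

pop₁ : Str → Sym
pop₁ []      = nothing
pop₁ (b ∷ _) = just b

-- A whole tree is executed in one superstep. Counting supersteps thus hides a constant factor
-- depending on the program, which compilation pays as `D`.
data Tree (k : ℕ) (X : Set) : Set where
  ret  : X → Tree k X
  push : Fin k → Bool → Tree k X → Tree k X
  pop  : Fin k → (Sym → Tree k X) → Tree k X

exec : ∀ {k X} → Tree k X → Env k → X × Env k
exec (ret x)      σ = x , σ
exec (push i b t) σ = exec t (σ [ i ]≔ (b ∷ (σ ! i)))
exec (pop i f)    σ = exec (f (pop₁ (σ ! i))) (σ [ i ]≔ tl (σ ! i))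

depth : ∀ {k X} → Tree k X → ℕ
depth (ret x)      = 0
depth (push i b t) = suc (depth t)
depth (pop i f)    = suc (depth (f nothing) ⊔ (depth (f (just true)) ⊔ depth (f (just false))))

depth-pop : ∀ {k X} (f : Sym → Tree k X) s → 
            depth (f s) ≤ depth (f nothing) ⊔ (depth (f (just true)) ⊔ depth (f (just false)))
depth-pop f nothing      = m≤m⊔n _ _
depth-pop f (just true)  = ≤-trans (m≤m⊔n _ _) (m≤n⊔m (depth (f nothing)) _)
depth-pop f (just false) = ≤-trans (m≤n⊔m (depth (f (just true))) _) (m≤n⊔m (depth (f nothing)) _)

-- The symbol of an exit is a result: `bind` chooses the continuation by it, and `loop` repeats on
-- `nothing`.
record SM (k : ℕ) : Set₁ where
  no-eta-equality
  field
    Q      : Set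
    finite : Finite Q
    start  : Q
    body   : Q → Tree k (Q ⊎ Sym)

module _ {k : ℕ} (p : SM k) where
  open SM p

  superstep : (Q ⊎ Sym) × Env k → (Q ⊎ Sym) × Env k
  superstep (inj₁ q , σ) = exec (body q) σ
  superstep (inj₂ e , σ) = inj₂ e , σ

  supersteps : ℕ → (Q ⊎ Sym) × Env k → (Q ⊎ Sym) × Env k
  supersteps zero    c = c
  supersteps (suc n) c = supersteps n (superstep c)

-- The stacks s₀, s₁, … are laid out on the tape as s₀ ␣ s₁ ␣ …, tops to the left.

enc : ∀ {k} → Env k → List Sym
enc []      = []
enc (s ∷ σ) = map just s ++ nothing ∷ enc σ

before after : ∀ {k} → Env k → Fin k → List Sym
before (s ∷ σ) zero    = []
before (s ∷ σ) (suc i) = map just s ++ nothing ∷ before σ i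
after (s ∷ σ) zero    = nothing ∷ enc σ
after (s ∷ σ) (suc i) = after σ i

++-assoc-∷ : ∀ {A : Set} (xs : List A) {y ys zs} → (xs ++ y ∷ ys) ++ zs ≡ xs ++ y ∷ (ys ++ zs)
++-assoc-∷ []       = refl
++-assoc-∷ (x ∷ xs) = cong (x ∷_) (++-assoc-∷ xs)

enc-split : ∀ {k} (σ : Env k) i → enc σ ≡ before σ i ++ map just (σ ! i) ++ after σ i
enc-split (s ∷ σ) zero    = refl
enc-split (s ∷ σ) (suc i) rewrite ++-assoc-∷ (map just s) {nothing} {before σ i} {map just (σ ! i) ++ after σ i} =
  cong (λ u → map just s ++ nothing ∷ u) (enc-split σ i)

enc-update : ∀ {k} (σ : Env k) i s → enc (σ [ i ]≔ s) ≡ before σ i ++ map just s ++ after σ i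
enc-update (s′ ∷ σ) zero    s = refl
enc-update (s′ ∷ σ) (suc i) s rewrite ++-assoc-∷ (map just s′) {nothing} {before σ i} {map just s ++ after σ i} =
  cong (λ u → map just s′ ++ nothing ∷ u) (enc-update σ i s)

after-nonempty : ∀ {k} (σ : Env k) i → ∃[ r ] after σ i ≡ nothing ∷ r
after-nonempty (s ∷ σ) zero    = _ , refl
after-nonempty (s ∷ σ) (suc i) = after-nonempty σ i

-- Counts the separators that the head has to cross on its way back to the left end.
data Blanks : ℕ → List Sym → Set where
  none  : Blanks 0 []
  bit   : ∀ {n b l} → Blanks n l → Blanks n (just b ∷ l)
  blank : ∀ {n l} → Blanks n l → Blanks (suc n) (nothing ∷ l)

-- Prefix n l: l ends with its n-th blank.
data Prefix : ℕ → List Sym → Set where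
  none  : Prefix 0 []
  bit   : ∀ {n b l} → Prefix (suc n) l → Prefix (suc n) (just b ∷ l)
  blank : ∀ {n l} → Prefix n l → Prefix (suc n) (nothing ∷ l)

before-prefix : ∀ {k} (σ : Env k) i → Prefix (toℕ i) (before σ i)
before-prefix (s ∷ σ) zero    = none
before-prefix (s ∷ σ) (suc i) = go s
  where
  go : ∀ s → Prefix _ (map just s ++ nothing ∷ before σ i)
  go []      = blank (before-prefix σ i)
  go (_ ∷ s) = bit (go s)

reverse-blanks : ∀ {n m l l′} → Prefix n l → Blanks m l′ → Blanks (n + m) (l ʳ++ l′)
reverse-blanks none      q = q
reverse-blanks (bit p)   q = reverse-blanks p (bit q)
reverse-blanks {suc n} {m} {_ ∷ l} {l′} (blank p) q =
  subst (λ j → Blanks j (l ʳ++ nothing ∷ l′)) (+-suc n m) (reverse-blanks p (blank q))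

-- Compilation of stack machines to a single tape

module Compile {K : ℕ} (p : SM (suc K)) where
  open SM p

  private k = suc K

  -- Program points of a tree: `nothing` is its root, `just` a point of a subtree. Leaves are no
  -- points, since control passes on at once.
  Node : ∀ {X} → Tree k X → Set
  Node (ret _)      = ⊥
  Node (push _ _ t) = Maybe (Node t)
  Node (pop _ f)    = Maybe (Σ Sym (λ s → Node (f s)))

  Node-finite : ∀ {X} (t : Tree k X) → Finite (Node t)
  Node-finite (ret _)      = ⊥-finite
  Node-finite (push _ _ t) = Maybe-finite (Node-finite t)
  Node-finite (pop _ f)    = Maybe-finite (Σ-finite Sym-finite λ s → Node-finite (f s))

  data Instr (X : Set) : Set where
    nop  : X → Instr X
    push : Fin k → Bool → X → Instr X
    pop  : Fin k → (Sym → X) → Instr X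

  mapI : ∀ {X Y} → (X → Y) → Instr X → Instr Y
  mapI g (nop x)      = nop (g x)
  mapI g (push i b x) = push i b (g x)
  mapI g (pop i f)    = pop i (g ∘ f)

  mapI-∘ : ∀ {X Y Z} (g : Y → Z) (h : X → Y) c → mapI g (mapI h c) ≡ mapI (g ∘ h) c
  mapI-∘ g h (nop x)      = refl
  mapI-∘ g h (push i b x) = refl
  mapI-∘ g h (pop i f)    = refl

  enter : ∀ {X} (t : Tree k X) → Node t ⊎ X
  enter (ret x)      = inj₂ x
  enter (push _ _ _) = inj₁ nothing
  enter (pop _ _)    = inj₁ nothing

  -- The index `zero` is a placeholder: the points of a `pop` do not depend on its stack.
  branch : ∀ {X} {f : Sym → Tree k X} s → Node (f s) ⊎ X → Node (pop zero f) ⊎ X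
  branch s = map₁ λ n → just (s , n)

  code : ∀ {X} (t : Tree k X) → Node t → Instr (Node t ⊎ X)
  code (push i b t) nothing        = push i b (map₁ just (enter t))
  code (push i b t) (just n)       = mapI (map₁ just) (code t n)
  code (pop i f)    nothing        = pop i λ s → branch {f = f} s (enter (f s))
  code (pop i f)    (just (s , n)) = mapI (branch {f = f} s) (code (f s) n)

  P : Set
  P = Q ⊎ Σ Q (λ q → Node (body q))

  resolve : ∀ q → Node (body q) ⊎ (Q ⊎ Sym) → P ⊎ Sym
  resolve q (inj₁ n)         = inj₁ (inj₂ (q , n))
  resolve q (inj₂ (inj₁ q′)) = inj₁ (inj₁ q′)
  resolve q (inj₂ (inj₂ e))  = inj₂ e

  instr : P → Instr (P ⊎ Sym)
  instr (inj₁ q)       = nop (resolve q (enter (body q)))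
  instr (inj₂ (q , n)) = mapI (resolve q) (code (body q) n)

  -- carry c: insert c by a sweep to the left;  look, fill, hole: delete a cell by moving its left
  -- neighbours one cell to the right;  back: return to the left end.
  data Phase : Set where
    carry fill          : Sym → Phase
    back look hole erase : Phase

  -- The element of `Fin k` counts the separators still to be crossed. This is how the machine tells
  -- a separator from the blank beyond the left end.
  data S : Set where
    at    : P ⊎ Sym → S
    right : P → Fin k → S
    left  : Phase → Fin k → P ⊎ Sym → S

  arrive : Instr (P ⊎ Sym) → Sym → S × Sym × Move
  arrive (nop x)      s        = at x , s , mS
  arrive (push i b x) s        = left (carry (just b)) i x , s , mL
  arrive (pop i f)    nothing  = left back i (f nothing) , nothing , mL
  arrive (pop i f)    (just b) = left look i (f (just b)) , just b , mL

  target : Instr (P ⊎ Sym) → Fin k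
  target (nop _)      = zero
  target (push i _ _) = i
  target (pop i _)    = i

  -- Only cells between the left end and the top of the target stack are shifted, and the head has
  -- to cross these anyway. The layout grows and shrinks at its left end, which the two-way infinite
  -- tape permits.
  δ : S → Sym → Maybe (S × Sym × Move)
  δ (at (inj₂ e))            s        = nothing
  δ (at (inj₁ u))            s        = just (right u (target (instr u)) , s , mS)
  δ (right u zero)           s        = just (arrive (instr u) s)
  δ (right u (suc j))        nothing  = just (right u (inject₁ j) , nothing , mR)
  δ (right u (suc j))        (just b) = just (right u (suc j) , just b , mR)
  δ (left (carry c) j x)     (just a) = just (left (carry (just a)) j x , c , mL)
  δ (left (carry c) zero x)  nothing  = just (at x , c , mS)
  δ (left (carry c) (suc j) x) nothing = just (left (carry nothing) (inject₁ j) x , c , mL)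
  δ (left back j x)          (just a) = just (left back j x , just a , mL)
  δ (left back zero x)       nothing  = just (at x , nothing , mR)
  δ (left back (suc j) x)    nothing  = just (left back (inject₁ j) x , nothing , mL)
  δ (left look j x)          (just a) = just (left (fill (just a)) j x , just a , mR)
  δ (left look zero x)       nothing  = just (left erase zero x , nothing , mR)
  δ (left look (suc j) x)    nothing  = just (left (fill nothing) (inject₁ j) x , nothing , mR)
  δ (left (fill c) j x)      _        = just (left hole j x , c , mL)
  δ (left hole j x)          s        = just (left look j x , s , mL)
  δ (left erase j x)         _        = just (at x , nothing , mR)

  P-finite : Finite P
  P-finite = ⊎-finite finite (Σ-finite finite λ q → Node-finite (body q))

  Phase-finite : Finite Phase
  Phase-finite = image-finite (⊎-finite (Σ-finite Bool-finite λ _ → Sym-finite) (Fin-finite 4)) f onto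
    where
    f : (Bool × Sym) ⊎ Fin 4 → Phase
    f (inj₁ (true , c))               = carry c
    f (inj₁ (false , c))              = fill c
    f (inj₂ zero)                     = back
    f (inj₂ (suc zero))               = look
    f (inj₂ (suc (suc zero)))         = hole
    f (inj₂ (suc (suc (suc zero))))   = erase
    onto : ∀ b → ∃[ a ] f a ≡ b
    onto (carry c) = inj₁ (true , c) , refl
    onto (fill c)  = inj₁ (false , c) , refl
    onto back      = inj₂ zero , refl
    onto look      = inj₂ (suc zero) , refl
    onto hole      = inj₂ (suc (suc zero)) , refl
    onto erase     = inj₂ (suc (suc (suc zero))) , refl

  abstract
    S-finite : Finite S
    S-finite = image-finite
        (⊎-finite PE (⊎-finite (Σ-finite P-finite λ _ → Fin-finite k)
                               (Σ-finite Phase-finite λ _ → Σ-finite (Fin-finite k) λ _ → PE)))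
        f onto
      where
      PE : Finite (P ⊎ Sym)
      PE = ⊎-finite P-finite Sym-finite
      f : (P ⊎ Sym) ⊎ (P × Fin k) ⊎ (Phase × Fin k × (P ⊎ Sym)) → S
      f (inj₁ x)                      = at x
      f (inj₂ (inj₁ (u , j)))         = right u j
      f (inj₂ (inj₂ (ph , j , x)))    = left ph j x
      onto : ∀ b → ∃[ a ] f a ≡ b
      onto (at x)        = inj₁ x , refl
      onto (right u j)   = inj₂ (inj₁ (u , j)) , refl
      onto (left ph j x) = inj₂ (inj₂ (ph , j , x)) , refl

  open Realise S-finite (at (inj₁ (inj₁ start))) δ public

  right-run : ∀ {n pre} u (j : Fin k) l r → Prefix n pre → toℕ j ≡ n →
              (right u j , l , pre ++ r) ⟶[ length pre ] (right u zero , pre ʳ++ l , r)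
  right-run u zero    l r none      e = done
  right-run u (suc j) l r (bit q)   e = step refl (right-run u (suc j) _ r q e)
  right-run u (suc j) l r (blank q) e = step refl
      (right-run u (inject₁ j) _ r q (trans (toℕ-inject₁ j) (suc-injective e)))

  -- The sweep visits each cell of `l` and finally the blank beyond the left end, which receives the
  -- last symbol carried.
  carry-run : ∀ {n l} c (j : Fin k) x r → Blanks n l → toℕ j ≡ n →
              (left (carry c) j x , tl l , hd l ∷ r) ⟶[ suc (length l) ] (at x , [] , l ʳ++ c ∷ r)
  carry-run c zero    x r none      e = step refl done
  carry-run c j       x r (bit q)   e = step refl (carry-run _ j x _ q e)
  carry-run c (suc j) x r (blank q) e =
    step refl (carry-run _ (inject₁ j) x _ q (trans (toℕ-inject₁ j) (suc-injective e)))

  back-run : ∀ {n l} (j : Fin k) x r → Blanks n l → toℕ j ≡ n →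
             (left back j x , tl l , hd l ∷ r) ⟶[ suc (length l) ] (at x , nothing ∷ [] , l ʳ++ r)
  back-run zero    x r none      e = step refl done
  back-run j       x r (bit q)   e with j
  ... | zero  = step refl (back-run zero x _ q e)
  ... | suc j = step refl (back-run (suc j) x _ q e)
  back-run (suc j) x r (blank q) e =
    step refl (back-run (inject₁ j) x _ q (trans (toℕ-inject₁ j) (suc-injective e)))

  -- Three moves per cell: read the left neighbour, write it into the hole `g`, step over the new
  -- hole. The last two moves turn round at the left end and erase the cell that has become vacant
  -- there.
  delete-run : ∀ {n l} (j : Fin k) x g r → Blanks n l → toℕ j ≡ n →
               (left look j x , tl l , hd l ∷ g ∷ r) ⟶[ length l * 3 + 2 ] (at x , nothing ∷ nothing ∷ [] , l ʳ++ r)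
  delete-run zero    x g r none      e = step refl (step refl done)
  delete-run j       x g r (bit q)   e with j
  ... | zero  = step refl (step refl (step refl (delete-run zero x _ _ q e)))
  ... | suc j = step refl (step refl (step refl (delete-run (suc j) x _ _ q e)))
  delete-run (suc j) x g r (blank q) e =
    step refl (step refl (step refl (delete-run (inject₁ j) x _ _ q (trans (toℕ-inject₁ j) (suc-injective e)))))

  η : ∀ {r : List Sym} → ∃[ a ] ∃[ r′ ] r ≡ a ∷ r′ → hd r ∷ tl r ≡ r
  η (_ , _ , refl) = refl

  enc-nonempty : ∀ (σ : Env k) → ∃[ a ] ∃[ r ] enc σ ≡ a ∷ r
  enc-nonempty ([] ∷ σ)      = _ , _ , refl
  enc-nonempty ((_ ∷ _) ∷ σ) = _ , _ , refl

  rest : Env k → Fin k → List Sym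
  rest σ i = map just (σ ! i) ++ after σ i

  rest-nonempty : ∀ σ i → ∃[ a ] ∃[ r ] rest σ i ≡ a ∷ r
  rest-nonempty σ i with σ ! i
  ... | []    = _ , after-nonempty σ i
  ... | _ ∷ _ = _ , _ , refl

  unreverse : ∀ (xs : List Sym) {ys} → (xs ʳ++ []) ʳ++ ys ≡ xs ++ ys
  unreverse xs = ʳ++-ʳ++ xs

  outward : ∀ u σ → let i = target (instr u) in
            (at (inj₁ u) , [] , enc σ) ⟶[ suc (length (before σ i)) ] (right u zero , before σ i ʳ++ [] , rest σ i)
  outward u σ = step refl (subst (λ r → (right u i , [] , r) ⟶[ length (before σ i) ]
      (right u zero , before σ i ʳ++ [] , rest σ i))
      (trans (sym (enc-split σ i)) (sym (η (enc-nonempty σ))))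
      (right-run u i [] (rest σ i) (before-prefix σ i) refl))
    where i = target (instr u)

  apply : ∀ {X} → Instr X → Env k → X × Env k
  apply (nop x)      σ = x , σ
  apply (push i b x) σ = x , σ [ i ]≔ (b ∷ (σ ! i))
  apply (pop i f)    σ = f (pop₁ (σ ! i)) , σ [ i ]≔ tl (σ ! i)

  -- One move per cell outward and at most three on the way back, the worst case being a deletion;
  -- the constant pays for the turns.
  cost : ℕ → ℕ
  cost z = z * 4 + 4

  Sim : P ⊎ Sym → Env k → ℕ → (P ⊎ Sym) × Env k → Set
  Sim c σ m (c′ , σ′) = ∀ d → (at c , [] , enc σ) ~ d →
    ∃[ d′ ] (at c′ , [] , enc σ′) ~ d′ × (∀ t → run tm (m + t) d ≡ run tm t d′)

  Sim-refl : ∀ {c σ} → Sim c σ 0 (c , σ)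
  Sim-refl d r = d , r , λ _ → refl

  Sim-trans : ∀ {c σ m c₁ σ₁ n c₂} → Sim c σ m (c₁ , σ₁) → Sim c₁ σ₁ n c₂ → Sim c σ (m + n) c₂
  Sim-trans {m = m} {n = n} f g d r with f d r
  ... | d₁ , r₁ , e₁ with g d₁ r₁
  ...   | d₂ , r₂ , e₂ = d₂ , r₂ , λ t → trans (cong (λ i → run tm i d) (+-assoc m n t)) (trans (e₁ (n + t)) (e₂ t))

  -- Whatever an instruction leaves to the left of the layout is blank, hence equivalent to the
  -- empty half; so every instruction starts from the same normal form.
  run⇒Sim : ∀ {c σ m x l σ′} → (at c , [] , enc σ) ⟶[ m ] (at x , l , enc σ′) → l ≋ [] → Sim c σ m (x , σ′)
  run⇒Sim q e d r with ~-run q r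
  ... | d′ , rel e₁ e₂ e₃ , f = d′ , rel e₁ (λ n → trans (sym (e n)) (e₂ n)) e₃ , f

  behind-length : ∀ (σ : Env k) i → length (before σ i ʳ++ []) ≡ length (before σ i)
  behind-length σ i = trans (length-ʳ++ (before σ i)) (+-identityʳ _)

  behind-blanks : ∀ (σ : Env k) i → Blanks (toℕ i) (before σ i ʳ++ [])
  behind-blanks σ i = subst (λ j → Blanks j (before σ i ʳ++ [])) (+-identityʳ _)
      (reverse-blanks (before-prefix σ i) none)

  arrive-step : ∀ {u I} l r {m c} → instr u ≡ I → 
                (let (q , w , d) = arrive I (hd r) in moved q l w (tl r) d ⟶[ m ] c) → (right u zero , l , r) ⟶[ suc m
                    ] c
  arrive-step l r refl q = step refl q

  turn : ∀ u σ I → instr u ≡ I → let i = target I ; (x , σ′) = apply I σ in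
         ∃[ m ] ∃[ l ] m ≤ length (before σ i) * 3 + 3 × l ≋ [] ×
         (right u zero , before σ i ʳ++ [] , rest σ i) ⟶[ m ] (at x , l , enc σ′)
  turn u (s ∷ σ) (nop x) e = 1 , [] , m≤n+m 1 2 , (λ _ → refl) ,
    subst (λ r → (right u zero , [] , enc (s ∷ σ)) ⟶[ 1 ] (at x , [] , r)) (η (enc-nonempty (s ∷ σ)))
        (arrive-step [] (enc (s ∷ σ)) e done)
  turn u σ (push i b x) e = _ , [] , bound , (λ _ → refl) ,
      subst (λ r → (right u zero , l , rest σ i) ⟶[ 2 + length l ] (at x , [] , r)) eq
        (arrive-step l (rest σ i) e (carry-run (just b) i x _ (behind-blanks σ i) refl))
    where
    l = before σ i ʳ++ []
    eq : l ʳ++ just b ∷ hd (rest σ i) ∷ tl (rest σ i) ≡ enc (σ [ i ]≔ (b ∷ (σ ! i)))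
    eq rewrite η (rest-nonempty σ i) = trans (unreverse (before σ i)) (sym (enc-update σ i (b ∷ (σ ! i))))
    bound : 2 + length l ≤ length (before σ i) * 3 + 3
    bound rewrite behind-length σ i = ≤-trans (m≤m+n _ (length (before σ i) * 2 + 1))
        (≤-reflexive (lemma (length (before σ i))))
      where
      lemma : ∀ n → 2 + n + (n * 2 + 1) ≡ n * 3 + 3
      lemma = solve-∀
  turn u σ (pop i f) e with σ ! i in eq
  ... | [] = _ , _ , bound , (λ { zero → refl ; (suc n) → refl }) ,
      subst₂ (λ a r → (right u zero , l , a) ⟶[ 2 + length l ] (at (f nothing) , nothing ∷ [] , r)) (sym ra)
        (trans (unreverse (before σ i)) (trans (cong (before σ i ++_) (sym ra)) (sym (enc-update σ i []))))
        (arrive-step l (nothing ∷ proj₁ (after-nonempty σ i)) e (back-run i (f nothing) _ (behind-blanks σ i) refl))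
    where
    l = before σ i ʳ++ []
    ra = proj₂ (after-nonempty σ i)
    bound : 2 + length l ≤ length (before σ i) * 3 + 3
    bound rewrite behind-length σ i = ≤-trans (m≤m+n _ (length (before σ i) * 2 + 1))
        (≤-reflexive (lemma (length (before σ i))))
      where
      lemma : ∀ n → 2 + n + (n * 2 + 1) ≡ n * 3 + 3
      lemma = solve-∀
  ... | b ∷ s = _ , _ , bound , (λ { zero → refl ; (suc zero) → refl ; (suc (suc n)) → refl }) ,
      subst (λ r → (right u zero , l , map just (b ∷ s) ++ after σ i) ⟶[ 1 + (length l * 3 + 2) ]
          (at (f (just b)) , nothing ∷ nothing ∷ [] , r))
        (trans (unreverse (before σ i)) (sym (enc-update σ i s)))
        (arrive-step l (just b ∷ map just s ++ after σ i) e (delete-run i (f (just b)) (just b) _ (behind-blanks σ i)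
            refl))
    where
    l = before σ i ʳ++ []
    bound : 1 + (length l * 3 + 2) ≤ length (before σ i) * 3 + 3
    bound rewrite behind-length σ i = ≤-reflexive (sym (+-suc (length (before σ i) * 3) 2))

  before-length : ∀ {k} (σ : Env k) i → length (before σ i) ≤ length (enc σ)
  before-length σ i rewrite enc-split σ i | length-++ (before σ i) {map just (σ ! i) ++ after σ i} = m≤m+n _ _

  instr-sim : ∀ u σ → ∃[ m ] m ≤ cost (length (enc σ)) × Sim (inj₁ u) σ m (apply (instr u) σ)
  instr-sim u σ with turn u σ (instr u) refl
  ... | m , l , m≤ , e , q = _ , bound , run⇒Sim {σ = σ} {σ′ = proj₂ (apply (instr u) σ)} (outward u σ ⊙ q) e
    where
    n = length (before σ (target (instr u)))
    lemma : ∀ n → suc n + (n * 3 + 3) ≡ n * 4 + 4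
    lemma = solve-∀
    bound : suc n + m ≤ cost (length (enc σ))
    bound = ≤-trans (+-monoʳ-≤ (suc n) m≤)
        (≤-trans (≤-reflexive (lemma n)) (+-monoˡ-≤ 4 (*-monoˡ-≤ 4 (before-length σ _))))

  size : Env k → ℕ
  size σ = length (enc σ)

  update-size : ∀ (σ : Env k) i s → length s ≤ suc (length (σ ! i)) → size (σ [ i ]≔ s) ≤ suc (size σ)
  update-size σ i s s≤ = begin
    length (enc (σ [ i ]≔ s))                                             ≡⟨ cong length (enc-update σ i s) ⟩
    length (before σ i ++ map just s ++ after σ i)                        ≡⟨ lengths s ⟩
    length (before σ i) + (length s + length (after σ i))                 ≤⟨ +-monoʳ-≤ (length (before σ i))
        (+-monoˡ-≤ _ s≤) ⟩
    length (before σ i) + suc (length (σ ! i) + length (after σ i))       ≡⟨ +-suc (length (before σ i)) _ ⟩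
    suc (length (before σ i) + (length (σ ! i) + length (after σ i)))     ≡⟨ cong suc (lengths (σ ! i)) ⟨
    suc (length (before σ i ++ map just (σ ! i) ++ after σ i))            ≡⟨ cong (suc ∘ length) (enc-split σ i) ⟨
    suc (size σ)                                                          ∎
    where
    open ≤-Reasoning
    lengths : ∀ s → length (before σ i ++ map just s ++ after σ i) ≡ length (before σ i) +
        (length s + length (after σ i))
    lengths s rewrite length-++ (before σ i) {map just s ++ after σ i} | length-++ (map just s) {after σ i} |
        length-map just s = refl

  tl-length : ∀ (s : Str) → length (tl s) ≤ suc (length s)
  tl-length []      = z≤n
  tl-length (_ ∷ s) = m≤n+m _ 2

  apply-size : ∀ {X} (I : Instr X) σ → size (proj₂ (apply I σ)) ≤ suc (size σ)
  apply-size (nop x)      σ = n≤1+n _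
  apply-size (push i b x) σ = update-size σ i _ ≤-refl
  apply-size (pop i f)    σ = update-size σ i _ (tl-length (σ ! i))

  cost-mono : ∀ {y z} → y ≤ z → cost y ≤ cost z
  cost-mono y≤z = +-monoˡ-≤ 4 (*-monoˡ-≤ 4 y≤z)

  -- Every intermediate size is at most z.
  record Sim≤ (z n : ℕ) (c : P ⊎ Sym) (σ : Env k) (c′ : (P ⊎ Sym) × Env k) : Set where
    constructor sim
    field
      steps  : ℕ
      steps≤ : steps ≤ n * cost z
      size≤  : size (proj₂ c′) ≤ size σ + n
      run-to : Sim c σ steps c′

  Sim≤-refl : ∀ {z n c σ} → Sim≤ z n c σ (c , σ)
  Sim≤-refl {c = c} {σ} = sim 0 z≤n (m≤m+n _ _) (Sim-refl {c} {σ})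

  Sim≤-trans : ∀ {z n n′ c σ c₁ σ₁ c₂} → Sim≤ z n c σ (c₁ , σ₁) → Sim≤ z n′ c₁ σ₁ c₂ → Sim≤ z (n + n′) c σ c₂
  Sim≤-trans {z} {n} {n′} {c} {σ} {c₁} {σ₁} {c₂} (sim m m≤ s≤ p) (sim m′ m′≤ s′≤ p′) = sim (m + m′)
    (≤-trans (+-mono-≤ m≤ m′≤) (≤-reflexive (sym (*-distribʳ-+ (cost z) n n′))))
    (≤-trans s′≤ (≤-trans (+-monoˡ-≤ n′ s≤) (≤-reflexive (+-assoc (size σ) n n′))))
    (Sim-trans {c} {σ} {_} {c₁} {σ₁} {_} {c₂} p p′)

  Sim≤-mono : ∀ {z n n′ c σ c′} → n ≤ n′ → Sim≤ z n c σ c′ → Sim≤ z n′ c σ c′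
  Sim≤-mono n≤ (sim m m≤ s≤ p) = sim m (≤-trans m≤ (*-monoˡ-≤ _ n≤)) (≤-trans s≤ (+-monoʳ-≤ _ n≤)) p

  instr-sim≤ : ∀ {z} u σ → size σ ≤ z → Sim≤ z 1 (inj₁ u) σ (apply (instr u) σ)
  instr-sim≤ {z} u σ σ≤ with instr-sim u σ
  ... | m , m≤ , p = sim m (≤-trans m≤ (≤-trans (cost-mono σ≤) (≤-reflexive (sym (+-identityʳ _)))))
    (≤-trans (apply-size (instr u) σ) (≤-reflexive (+-comm 1 _))) p

  -- Induction over subtrees: `g` and `u` locate the points of the current subtree within the whole
  -- machine, and the two hypotheses say that the instructions found there are those of the subtree.
  tree-sim : ∀ {X z} (t : Tree k X) (g : Node t ⊎ X → P ⊎ Sym) (u : Node t → P) →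
             (∀ n → g (inj₁ n) ≡ inj₁ (u n)) → (∀ n → instr (u n) ≡ mapI g (code t n)) →
             ∀ σ → size σ + depth t ≤ z → Sim≤ z (depth t) (g (enter t)) σ
                 (g (inj₂ (proj₁ (exec t σ))) , proj₂ (exec t σ))
  tree-sim (ret x) g u gu iu σ σ≤ = Sim≤-refl
  tree-sim {z = z} (push i b t) g u gu iu σ σ≤ =
      Sim≤-trans {n = 1} first (tree-sim t (g ∘ map₁ just) (u ∘ just) (gu ∘ just)
        (λ n → trans (iu (just n)) (mapI-∘ g (map₁ just) (code t n))) _
        (≤-trans (+-monoˡ-≤ (depth t) (update-size σ i _ ≤-refl)) (≤-trans (≤-reflexive (sym (+-suc _ (depth t))))
            σ≤)))
    where
    first : Sim≤ z 1 (g (inj₁ nothing)) σ (g (map₁ just (enter t)) , σ [ i ]≔ (b ∷ (σ ! i)))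
    first = subst₂ (λ c I → Sim≤ z 1 c σ (apply I σ)) (sym (gu nothing)) (iu nothing)
        (instr-sim≤ (u nothing) σ (m+n≤o⇒m≤o _ σ≤))
  tree-sim {z = z} (pop i f) g u gu iu σ σ≤ =
      Sim≤-mono (s≤s (depth-pop f s))
          (Sim≤-trans {n = 1} first (tree-sim (f s) (g ∘ branch {f = f} s) (λ n → u (just (s , n)))
          (λ n → gu (just (s , n)))
        (λ n → trans (iu (just (s , n))) (mapI-∘ g (branch {f = f} s) (code (f s) n))) _
        (≤-trans (+-mono-≤ (update-size σ i _ (tl-length (σ ! i))) (depth-pop f s))
            (≤-trans (≤-reflexive (sym (+-suc _ _))) σ≤))))
    where
    s = pop₁ (σ ! i)
    first : Sim≤ z 1 (g (inj₁ nothing)) σ (g (branch {f = f} s (enter (f s))) , σ [ i ]≔ tl (σ ! i))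
    first = subst₂ (λ c I → Sim≤ z 1 c σ (apply I σ)) (sym (gu nothing)) (iu nothing)
        (instr-sim≤ (u nothing) σ (m+n≤o⇒m≤o _ σ≤))

  embed : Q ⊎ Sym → P ⊎ Sym
  embed = map₁ inj₁

  resolve-embed : ∀ q c → resolve q (inj₂ c) ≡ embed c
  resolve-embed q (inj₁ q′) = refl
  resolve-embed q (inj₂ e)  = refl

  -- The successor accounts for the `nop` that enters a body.
  maxDepth : List Q → ℕ
  maxDepth = foldr (λ q d → suc (depth (body q)) ⊔ d) 0

  ≤-maxDepth : ∀ {q qs} → q ∈ qs → suc (depth (body q)) ≤ maxDepth qs
  ≤-maxDepth {q} {_ ∷ qs} (here refl) = m≤m⊔n (suc (depth (body q))) (maxDepth qs)
  ≤-maxDepth {qs = q ∷ _} (there q∈) = ≤-trans (≤-maxDepth q∈) (m≤n⊔m (suc (depth (body q))) _)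

  D : ℕ
  D = maxDepth (enum finite)

  superstep-sim : ∀ {z} c σ → size σ + D ≤ z → let (c′ , σ′) = superstep p (c , σ) in Sim≤ z D (embed c) σ
      (embed c′ , σ′)
  superstep-sim (inj₂ e) σ σ≤ = Sim≤-refl
  superstep-sim {z} (inj₁ q) σ σ≤ =
    Sim≤-mono d≤ (Sim≤-trans {n = 1} (instr-sim≤ (inj₁ q) σ (m+n≤o⇒m≤o _ σ≤))
      (subst (λ c′ → Sim≤ z (depth (body q)) (resolve q (enter (body q))) σ (c′ , proj₂ (exec (body q) σ)))
          (resolve-embed q _)
        (tree-sim (body q) (resolve q) (λ n → inj₂ (q , n)) (λ _ → refl) (λ _ → refl) σ
          (≤-trans (+-monoʳ-≤ (size σ) (≤-trans (n≤1+n _) d≤)) σ≤))))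
    where
    d≤ : suc (depth (body q)) ≤ D
    d≤ = ≤-maxDepth (complete finite q)

  supersteps-sim : ∀ {z} n c σ → size σ + n * D ≤ z →
                   let (c′ , σ′) = supersteps p n (c , σ) in Sim≤ z (n * D) (embed c) σ (embed c′ , σ′)
  supersteps-sim zero    c σ σ≤ = Sim≤-refl
  supersteps-sim (suc n) c σ σ≤ =
    Sim≤-trans first (supersteps-sim n _ _ (≤-trans (+-monoˡ-≤ (n * D) (Sim≤.size≤ first))
        (≤-trans (≤-reflexive (+-assoc (size σ) D (n * D))) σ≤)))
    where
    first = superstep-sim c σ (≤-trans (+-monoʳ-≤ (size σ) (m≤m+n D (n * D))) σ≤)

  input : Str → Env k
  input x = x ∷ replicate K []

  blanks-size : ∀ n → length (enc (replicate n [])) ≡ n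
  blanks-size zero    = refl
  blanks-size (suc n) = cong suc (blanks-size n)

  input-size : ∀ x → size (input x) ≡ length x + k
  input-size x rewrite length-++ (map just x) {nothing ∷ enc (replicate K [])} | length-map just x | blanks-size K =
      refl

  blanks-≋ : ∀ n → enc (replicate n []) ≋ []
  blanks-≋ zero    i       = refl
  blanks-≋ (suc n) zero    = refl
  blanks-≋ (suc n) (suc i) = blanks-≋ n i

  input-≋ : ∀ x → enc (input x) ≋ map just x
  input-≋ []      zero    = refl
  input-≋ []      (suc i) = blanks-≋ K i
  input-≋ (b ∷ x) zero    = refl
  input-≋ (b ∷ x) (suc i) = input-≋ x i

  init-~ : ∀ x → (at (inj₁ (inj₁ start)) , [] , enc (input x)) ~ initConfig tm x
  init-~ []      = rel refl (λ _ → refl) λ n → trans (input-≋ [] n) (sym (η-≋ {[]} (λ _ → refl) n))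
  init-~ (b ∷ x) = rel refl (λ _ → refl) (input-≋ (b ∷ x))

  readWord-enc : ∀ y (σ : Env K) → readWord (enc (y ∷ σ)) ≡ y
  readWord-enc []      σ = refl
  readWord-enc (b ∷ y) σ = cong (b ∷_) (readWord-enc y σ)

  -- At most `t * D` instructions, each charged at the largest size that the layout can reach:
  -- `n + k` cells at the start and one more per instruction.
  time : ℕ → ℕ → ℕ
  time n t = t * D * cost (n + k + t * D)

  halts : ∀ x n {e y σ} → supersteps p n (inj₁ start , input x) ≡ (inj₂ e , y ∷ σ) →
          ∀ t → time (length x) n ≤ t → HaltsWith tm x t y
  halts x n {e} {y} {σ} eq t t≥ with supersteps-sim n (inj₁ start) (input x) ≤-refl
  ... | sim m m≤ _ s with s (initConfig tm x) (init-~ x)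
  ...   | d , r , f rewrite eq with d | r
  ...     | cfg i l h w | rel e₁ e₂ e₃ = cfg i l h w ,
              trans (cong (λ t → run tm t (initConfig tm x)) (sym (m+[n∸m]≡n m≤t)))
                    (trans (f (t ∸ m)) (run-halt tm i l h w (t ∸ m) halted)) ,
              trans (sym (readWord-≋ (enc (y ∷ σ)) (h ∷ w) e₃)) (readWord-enc y σ)
    where
    m≤t : m ≤ t
    m≤t = ≤-trans m≤ (subst (λ s → n * D * cost (s + n * D) ≤ t) (sym (input-size x)) t≥)
    halted : TM.δ tm i h ≡ nothing
    halted rewrite e₁ = refl

-- Polynomial bounds

-- The instances and their size are abstract, because bounds are needed for inputs, for unary
-- lengths and for single rounds of a search.
PolyBounded : {I : Set} → (I → ℕ) → (I → ℕ) → Set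
PolyBounded sz f = ∃[ c ] (∀ i → f i ≤ (sz i + c) ^ c)

module _ {I : Set} {sz : I → ℕ} where

  private
    PB : (I → ℕ) → Set
    PB = PolyBounded sz

  PB-≤ : ∀ {f g} → (∀ i → f i ≤ g i) → PB g → PB f
  PB-≤ f≤g (c , h) = c , λ i → ≤-trans (f≤g i) (h i)

  PB-const : ∀ n → PB (λ _ → n)
  PB-const n = suc n , λ i → ≤-trans (≤-trans (n≤1+n n) (m≤n+m (suc n) (sz i)))
    (≤-trans (≤-reflexive (sym (^-identityʳ _))) (^-monoʳ-≤ _ ⦃ nz i ⦄ {1} {suc n} (s≤s z≤n)))
    where
    nz : ∀ i → Data.Nat.NonZero (sz i + suc n)
    nz i rewrite +-suc (sz i) n = _

  PB-size : PB sz
  PB-size = 1 , λ i → ≤-trans (m≤m+n (sz i) 1) (≤-reflexive (sym (^-identityʳ _)))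

  private
    widen : ∀ z c d e → c + d ≤ e → ∀ f g → f ≤ (z + c) ^ c → g ≤ (z + d) ^ d →
            f ≤ suc (z + e) ^ c × g ≤ suc (z + e) ^ d
    widen z c d e c+d≤e f g f≤ g≤ =
      ≤-trans f≤ (^-monoˡ-≤ c (m≤n⇒m≤1+n (+-monoʳ-≤ z (m+n≤o⇒m≤o c c+d≤e)))) ,
      ≤-trans g≤ (^-monoˡ-≤ d (m≤n⇒m≤1+n (+-monoʳ-≤ z (m+n≤o⇒n≤o c c+d≤e))))

  PB-* : ∀ {f g} → PB f → PB g → PB (λ i → f i * g i)
  PB-* {f} {g} (c , h) (d , k) = suc (c + d) , λ i →
    let (f≤ , g≤) = widen (sz i) c d (c + d) ≤-refl (f i) (g i) (h i) (k i) in begin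
    f i * g i                                            ≤⟨ *-mono-≤ f≤ g≤ ⟩
    suc (sz i + (c + d)) ^ c * suc (sz i + (c + d)) ^ d  ≡⟨ ^-distribˡ-+-* (suc (sz i + (c + d))) c d ⟨
    suc (sz i + (c + d)) ^ (c + d)                       ≤⟨ ^-monoʳ-≤ (suc (sz i + (c + d))) (n≤1+n (c + d)) ⟩
    suc (sz i + (c + d)) ^ suc (c + d)                   ≡⟨ cong (_^ suc (c + d)) (+-suc (sz i) (c + d)) ⟨
    (sz i + suc (c + d)) ^ suc (c + d)                   ∎
    where open ≤-Reasoning

  PB-+ : ∀ {f g} → PB f → PB g → PB (λ i → f i + g i)
  PB-+ {f} {g} (c , h) (d , k) = suc (suc (c + d)) , λ i →
    let (f≤ , g≤) = widen (sz i) c d (suc (c + d)) (n≤1+n _) (f i) (g i) (h i) (k i)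
        z = suc (sz i + suc (c + d)) in begin
    f i + g i                  ≤⟨ +-mono-≤ (≤-trans f≤ (^-monoʳ-≤ z (m≤m+n c d)))
        (≤-trans g≤ (^-monoʳ-≤ z (m≤n+m d c))) ⟩
    z ^ (c + d) + z ^ (c + d)  ≡⟨ cong (z ^ (c + d) +_) (+-identityʳ _) ⟨
    -- The doubling is absorbed by one further power of the base, which is at least 2.
    2 * z ^ (c + d)            ≤⟨ *-monoˡ-≤ (z ^ (c + d)) (s≤s (≤-trans (s≤s z≤n) (m≤n+m (suc (c + d)) (sz i)))) ⟩
    z ^ suc (c + d)            ≤⟨ ^-monoʳ-≤ z (n≤1+n (suc (c + d))) ⟩
    z ^ suc (suc (c + d))      ≡⟨ cong (_^ suc (suc (c + d))) (+-suc (sz i) (suc (c + d))) ⟨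
    (sz i + suc (suc (c + d))) ^ suc (suc (c + d)) ∎
    where open ≤-Reasoning

  PB-suc : ∀ {f} → PB f → PB (λ i → suc (f i))
  PB-suc = PB-+ (PB-const 1)

  PB-^ : ∀ {f} c → PB f → PB (λ i → f i ^ c)
  PB-^ zero    pf = PB-const 1
  PB-^ (suc c) pf = PB-* pf (PB-^ c pf)

-- Composition of stack machines

mapT : ∀ {k X Y} → (X → Y) → Tree k X → Tree k Y
mapT g (ret x)      = ret (g x)
mapT g (push i b t) = push i b (mapT g t)
mapT g (pop i f)    = pop i λ s → mapT g (f s)

exec-mapT : ∀ {k X Y} (g : X → Y) (t : Tree k X) σ → exec (mapT g t) σ ≡ (g (proj₁ (exec t σ)) , proj₂ (exec t σ))
exec-mapT g (ret x)      σ = refl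
exec-mapT g (push i b t) σ = exec-mapT g t _
exec-mapT g (pop i f)    σ = exec-mapT g (f _) _

module _ {k : ℕ} (p : SM k) where

  supersteps-exit : ∀ n {e σ} → supersteps p n (inj₂ e , σ) ≡ (inj₂ e , σ)
  supersteps-exit zero    = refl
  supersteps-exit (suc n) = supersteps-exit n

  supersteps-+ : ∀ m {n c} → supersteps p (m + n) c ≡ supersteps p n (supersteps p m c)
  supersteps-+ zero    = refl
  supersteps-+ (suc m) = supersteps-+ m

  supersteps-mono : ∀ {m n} c {e σ} → m ≤ n → supersteps p m c ≡ (inj₂ e , σ) → supersteps p n c ≡ (inj₂ e , σ)
  supersteps-mono {m} {n} c m≤n eq = begin
    supersteps p n c                          ≡⟨ cong (λ i → supersteps p i c) (m+[n∸m]≡n m≤n) ⟨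
    supersteps p (m + (n ∸ m)) c              ≡⟨ supersteps-+ m ⟩
    supersteps p (n ∸ m) (supersteps p m c)   ≡⟨ cong (supersteps p (n ∸ m)) eq ⟩
    supersteps p (n ∸ m) (inj₂ _ , _)         ≡⟨ supersteps-exit (n ∸ m) ⟩
    (inj₂ _ , _)                              ∎
    where open ≡-Reasoning

record Exits {k : ℕ} (p : SM k) (n : ℕ) (σ : Env k) (e : Sym) (σ′ : Env k) : Set where
  constructor exits
  field
    reaches : supersteps p n (inj₁ (SM.start p) , σ) ≡ (inj₂ e , σ′)

Exits-mono : ∀ {k} {p : SM k} {m n σ e σ′} → m ≤ n → Exits p m σ e σ′ → Exits p n σ e σ′
Exits-mono {p = p} m≤n (exits r) = exits (supersteps-mono p _ m≤n r)

module _ {k : ℕ} (p : SM k) (f : Sym → SM k) where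
  private
    module p = SM p
    module f s = SM (f s)

    leave₁ : p.Q ⊎ Sym → (p.Q ⊎ Σ Sym f.Q) ⊎ Sym
    leave₁ (inj₁ q) = inj₁ (inj₁ q)
    leave₁ (inj₂ s) = inj₁ (inj₂ (s , f.start s))

    leave₂ : ∀ s → f.Q s ⊎ Sym → (p.Q ⊎ Σ Sym f.Q) ⊎ Sym
    leave₂ s = map₁ λ q → inj₂ (s , q)

  bind : SM k
  bind .SM.Q = p.Q ⊎ Σ Sym f.Q
  bind .SM.finite = ⊎-finite p.finite (Σ-finite Sym-finite f.finite)
  bind .SM.start = inj₁ p.start
  bind .SM.body (inj₁ q)       = mapT leave₁ (p.body q)
  bind .SM.body (inj₂ (s , q)) = mapT (leave₂ s) (f.body s q)

  private
    second : ∀ s n c {σ e σ′} → supersteps (f s) n (c , σ) ≡ (inj₂ e , σ′) →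
             supersteps bind n (leave₂ s c , σ) ≡ (inj₂ e , σ′)
    second s zero    (inj₂ e) refl = refl
    second s (suc n) (inj₂ e) eq   = second s n (inj₂ e) eq
    second s (suc n) (inj₁ q) {σ} eq rewrite exec-mapT (leave₂ s) (f.body s q) σ = second s n _ eq

    first : ∀ n q {σ s σ₁ m e σ₂} → supersteps p n (inj₁ q , σ) ≡ (inj₂ s , σ₁) → supersteps (f s) m
        (inj₁ (f.start s) , σ₁) ≡ (inj₂ e , σ₂) →
            supersteps bind (n + m) (inj₁ (inj₁ q) , σ) ≡ (inj₂ e , σ₂)
    first (suc n) q {σ} eq eq₂ rewrite exec-mapT leave₁ (p.body q) σ with exec (p.body q) σ
    first (suc n) q eq eq₂ | inj₁ q′ , σ′ = first n q′ eq eq₂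
    first (suc n) q {m = m} eq eq₂ | inj₂ s , σ′ with refl ← trans (sym (supersteps-exit p n)) eq =
      -- `p` may leave before its `n` supersteps are over; the surplus is idled away after the final
      -- exit.
      supersteps-mono bind _ (m≤n+m m n) (second s m (inj₁ (f.start s)) eq₂)

  bind-exits : ∀ {n σ s σ₁ m e σ₂} → Exits p n σ s σ₁ → Exits (f s) m σ₁ e σ₂ → Exits bind (n + m) σ e σ₂
  bind-exits {n} (exits r) (exits r′) = exits (first n p.start r r′)

Exits-cong : ∀ {k} {p : SM k} {n σ e σ′ σ″} → σ′ ≡ σ″ → Exits p n σ e σ′ → Exits p n σ e σ″
Exits-cong refl r = r

infixr 5 _⨾_
_⨾_ : ∀ {k} → SM k → SM k → SM k
p ⨾ q = bind p λ _ → q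

-- loop p repeats p as long as it exits with nothing.
module _ {k : ℕ} (p : SM k) where
  private
    module p = SM p
    again : p.Q ⊎ Sym → p.Q ⊎ Sym
    again (inj₁ q)        = inj₁ q
    again (inj₂ nothing)  = inj₁ p.start
    again (inj₂ (just b)) = inj₂ (just b)

  loop : SM k
  loop .SM.Q      = p.Q
  loop .SM.finite = p.finite
  loop .SM.start  = p.start
  loop .SM.body q = mapT again (p.body q)

  private
    iterate : ∀ n q {σ s σ₁ m e σ₂} → supersteps p n (inj₁ q , σ) ≡ (inj₂ s , σ₁) →
              supersteps loop m (again (inj₂ s) , σ₁) ≡ (inj₂ e , σ₂) →
              supersteps loop (n + m) (inj₁ q , σ) ≡ (inj₂ e , σ₂)
    iterate (suc n) q {σ} eq eq₂ rewrite exec-mapT again (p.body q) σ with exec (p.body q) σ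
    iterate (suc n) q eq eq₂ | inj₁ q′ , σ′ = iterate n q′ eq eq₂
    iterate (suc n) q {m = m} eq eq₂ | inj₂ s , σ′ with refl ← trans (sym (supersteps-exit p n)) eq =
      supersteps-mono loop _ (m≤n+m m n) eq₂

  loop-again : ∀ {n σ σ₁ m e σ₂} → Exits p n σ nothing σ₁ → Exits loop m σ₁ e σ₂ → Exits loop (n + m) σ e σ₂
  loop-again {n} (exits r) (exits r′) = exits (iterate n p.start r r′)

  loop-exit : ∀ {n σ b σ₁} → Exits p n σ (just b) σ₁ → Exits loop (n + 0) σ (just b) σ₁
  loop-exit {n} (exits r) = exits (iterate n p.start r refl)

straight : ∀ {k} → Tree k Sym → SM k
straight t .SM.Q      = ⊤
straight t .SM.finite = ⊤-finite
straight t .SM.start  = tt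
straight t .SM.body _ = mapT inj₂ t

straight-exits : ∀ {k} (t : Tree k Sym) {σ e σ′} → exec t σ ≡ (e , σ′) → Exits (straight t) 1 σ e σ′
straight-exits t {σ} eq = exits (trans (exec-mapT inj₂ t σ) (cong (λ (e , σ′) → inj₂ e , σ′) eq))

pushes : ∀ {k X} → List (Fin k × Bool) → Tree k X → Tree k X
pushes []             t = t
pushes ((i , b) ∷ ps) t = push i b (pushes ps t)

write : ∀ {k} → List (Fin k × Bool) → SM k
write ps = straight (pushes ps (ret nothing))

each : ∀ {k} → Fin k → (Bool → List (Fin k × Bool)) → SM k
each i f .SM.Q      = ⊤
each i f .SM.finite = ⊤-finite
each i f .SM.start  = tt
each i f .SM.body _ = pop i λ { nothing → ret (inj₂ nothing) ; (just b) → pushes (f b) (ret (inj₁ tt)) }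

-- `ctx` describes the stacks by the unread part of stack `i` and an accumulator, which makes the
-- transfer a left fold. With `moveTo` this fold is reversal, hence the pairs of transfers by which
-- words are moved unreversed.
each-exits : ∀ {k} (i : Fin k) f {A : Set} (ctx : Str → A → Env k) (g : A → Bool → A) →
             (∀ a → superstep (each i f) (inj₁ tt , ctx [] a) ≡ (inj₂ nothing , ctx [] a)) →
             (∀ b x a → superstep (each i f) (inj₁ tt , ctx (b ∷ x) a) ≡ (inj₁ tt , ctx x (g a b))) →
             ∀ x a → Exits (each i f) (suc (length x)) (ctx x a) nothing (ctx [] (foldl g a x))
each-exits i f ctx g e₀ e₁ []      a = exits (e₀ a)
each-exits i f ctx g e₀ e₁ (b ∷ x) a =
  exits (trans (cong (supersteps (each i f) (suc (length x))) (e₁ b x a))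
      (Exits.reaches (each-exits i f ctx g e₀ e₁ x (g a b))))

record PolyExits {k : ℕ} {I : Set} (sz : I → ℕ) (p : SM k) (σ : I → Env k) (e : I → Sym) (σ′ : I → Env k) : Set where
  constructor polyExits
  field
    time    : I → ℕ
    bounded : PolyBounded sz time
    runs    : ∀ i → Exits p (time i) (σ i) (e i) (σ′ i)

PolyExits-uniform : ∀ {k} {I : Set} {sz : I → ℕ} {p : SM k} {σ e σ′} → PolyExits sz p σ e σ′ →
                    ∃[ c ] (∀ i → Exits p ((sz i + c) ^ c) (σ i) (e i) (σ′ i))
PolyExits-uniform (polyExits t (c , t≤) r) = c , λ i → Exits-mono (t≤ i) (r i)

module _ {k : ℕ} {I : Set} {sz : I → ℕ} where

  straight-poly : ∀ (t : Tree k Sym) σ → PolyExits sz (straight t) σ (λ i → proj₁ (exec t (σ i)))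
      (λ i → proj₂ (exec t (σ i)))
  straight-poly t σ = polyExits (λ _ → 1) (PB-const 1) λ i → straight-exits t refl

  each-poly : ∀ (i : Fin k) f {A : Set} (ctx : I → Str → A → Env k) (g : A → Bool → A) →
              (∀ j a → superstep (each i f) (inj₁ tt , ctx j [] a) ≡ (inj₂ nothing , ctx j [] a)) →
              (∀ j b x a → superstep (each i f) (inj₁ tt , ctx j (b ∷ x) a) ≡ (inj₁ tt , ctx j x (g a b))) →
              ∀ (x : I → Str) (a : I → A) → PolyBounded sz (length ∘ x) →
              PolyExits sz (each i f) (λ j → ctx j (x j) (a j)) (λ _ → nothing) (λ j → ctx j [] (foldl g (a j) (x j)))
  each-poly i f ctx g e₀ e₁ x a px =
    polyExits _ (PB-suc px) λ j → each-exits i f (ctx j) g (e₀ j) (e₁ j) (x j) (a j)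

  -- Every continuation must be bounded on all instances, even those on which `p` exits with another
  -- symbol. The sum over the three symbols is then one bound for whichever continuation is taken.
  bind-poly : ∀ {p f σ s σ₁} {e : Sym → I → Sym} {σ₂ : Sym → I → Env k} → PolyExits sz p σ s σ₁ →
              (∀ s → PolyExits sz (f s) σ₁ (e s) (σ₂ s)) →
              PolyExits sz (bind p f) σ (λ i → e (s i) i) (λ i → σ₂ (s i) i)
  bind-poly {p} {f} {s = s} (polyExits t pt r) q =
      polyExits (λ i → t i + (u nothing i + (u (just true) i + u (just false) i)))
        (PB-+ pt (PB-+ (pu nothing) (PB-+ (pu (just true)) (pu (just false)))))
        λ i → bind-exits p f {n = t i} (r i) (Exits-mono (u≤ (s i) i) (PolyExits.runs (q (s i)) i))
    where
    u : Sym → I → ℕ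
    u s = PolyExits.time (q s)
    pu : ∀ s → PolyBounded sz (u s)
    pu s = PolyExits.bounded (q s)
    u≤ : ∀ s i → u s i ≤ u nothing i + (u (just true) i + u (just false) i)
    u≤ nothing      i = m≤m+n _ _
    u≤ (just true)  i = ≤-trans (m≤m+n _ _) (m≤n+m _ (u nothing i))
    u≤ (just false) i = ≤-trans (m≤n+m _ (u (just true) i)) (m≤n+m _ (u nothing i))

  infixr 5 _⨾-poly_
  _⨾-poly_ : ∀ {p q : SM k} {σ s σ₁ e σ₂} → PolyExits sz p σ s σ₁ → PolyExits sz q σ₁ e σ₂ → PolyExits sz (p ⨾ q) σ e
      σ₂
  _⨾-poly_ {e = e} {σ₂} r q = bind-poly {e = λ _ → e} {λ _ → σ₂} r λ _ → q

-- Simulation of a Turing machine, with input and output on S₀ and the tape on S₁ (right) and S₂ (left), a blank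
-- being coded by 0 and a bit b by 1b. The right half of the tape is the decoded S₁ followed by S₀,
-- so the input need not be recoded.

pattern S₀ = zero
pattern S₁ = suc zero
pattern S₂ = suc (suc zero)
pattern S₃ = suc (suc (suc zero))

pushSym : ∀ {k A} → Fin k → Sym → Tree k A → Tree k A
pushSym i nothing  t = push i false t
pushSym i (just b) t = push i b (push i true t)

popSym : ∀ {k A} → Fin k → (Maybe Sym → Tree k A) → Tree k A
popSym i f = pop i λ { nothing → f nothing ; (just false) → f (just nothing) ; (just true) → pop i λ s → f (just s) }

encSym : List Sym → Str
encSym []            = []
encSym (nothing ∷ l) = false ∷ encSym l
encSym (just b ∷ l)  = true ∷ b ∷ encSym l

encSym-length : ∀ l → length (encSym l) ≤ length l * 2
encSym-length []            = z≤n
encSym-length (nothing ∷ l) = m≤n⇒m≤1+n (s≤s (encSym-length l))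
encSym-length (just b ∷ l)  = s≤s (s≤s (encSym-length l))

readWord-just : ∀ x → readWord (map just x) ≡ x
readWord-just []      = refl
readWord-just (b ∷ x) = cong (b ∷_) (readWord-just x)

readWord-length : ∀ l → length (readWord l) ≤ length l
readWord-length []            = z≤n
readWord-length (nothing ∷ l) = z≤n
readWord-length (just b ∷ l)  = s≤s (readWord-length l)

module Call (M : TM) {j : ℕ} where
  open TM M

  private k = 4 + j

  -- The scanned cell is kept in the control state. After the halt, the output is collected in
  -- reverse on `S₃`, the remaining stacks are emptied and the output is put on `S₀`, which leaves
  -- everything ready for another call.
  data CallState : Set where
    load                             : CallState
    sim                              : Fin (suc nQ) → Sym → CallState
    decode clearR clearX unreverse clearL : CallState

  CallState-finite : Finite CallState
  CallState-finite = image-finite (⊎-finite (Σ-finite (Fin-finite (suc nQ)) λ _ → Sym-finite) (Fin-finite 6)) f onto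
    where
    f : (Fin (suc nQ) × Sym) ⊎ Fin 6 → CallState
    f (inj₁ (q , h)) = sim q h
    f (inj₂ zero) = load
    f (inj₂ (suc zero)) = decode
    f (inj₂ (suc (suc zero))) = clearR
    f (inj₂ (suc (suc (suc zero)))) = clearX
    f (inj₂ (suc (suc (suc (suc zero))))) = unreverse
    f (inj₂ (suc (suc (suc (suc (suc zero)))))) = clearL
    onto : ∀ b → ∃[ a ] f a ≡ b
    onto (sim q h) = inj₁ (q , h) , refl
    onto load      = inj₂ zero , refl
    onto decode    = inj₂ (suc zero) , refl
    onto clearR    = inj₂ (suc (suc zero)) , refl
    onto clearX    = inj₂ (suc (suc (suc zero))) , refl
    onto unreverse = inj₂ (suc (suc (suc (suc zero)))) , refl
    onto clearL    = inj₂ (suc (suc (suc (suc (suc zero))))) , refl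

  private
    goto : CallState → Tree k (CallState ⊎ Sym)
    goto q = ret (inj₁ q)

  simulate : Maybe (Fin (suc nQ) × Sym × Move) → Sym → Tree k (CallState ⊎ Sym)
  simulate nothing             nothing  = goto clearR
  simulate nothing             (just b) = push S₃ b (goto decode)
  simulate (just (q , w , mS)) h        = goto (sim q w)
  simulate (just (q , w , mL)) h        = pushSym S₁ w
      (popSym S₂ λ { nothing → goto (sim q nothing) ; (just s) → goto (sim q s) })
  simulate (just (q , w , mR)) h        = pushSym S₂ w
      (popSym S₁ λ { nothing → pop S₀ λ s → goto (sim q s) ; (just s) → goto (sim q s) })

  call : SM k
  call .SM.Q      = CallState
  call .SM.finite = CallState-finite
  call .SM.start  = load
  call .SM.body load      = pop S₀ λ s → goto (sim zero s)
  call .SM.body (sim q h) = simulate (δ q h) h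
  call .SM.body decode    = popSym S₁ λ { nothing → goto unreverse ; (just nothing) → goto clearR ; (just (just b)) →
      push S₃ b (goto decode) }
  call .SM.body clearR    = pop S₁ λ { nothing → goto clearX ; (just _) → goto clearR }
  call .SM.body clearX    = pop S₀ λ { nothing → goto unreverse ; (just _) → goto clearX }
  call .SM.body unreverse = pop S₃ λ { nothing → goto clearL ; (just b) → push S₀ b (goto unreverse) }
  call .SM.body clearL    = pop S₂ λ { nothing → ret (inj₂ nothing) ; (just _) → goto clearL }

  module _ (ρ : Env j) where

    private
      _▷[_]_ : (CallState ⊎ Sym) × Env k → ℕ → (CallState ⊎ Sym) × Env k → Set
      c ▷[ n ] c′ = supersteps call n c ≡ c′

      finished : Str → (CallState ⊎ Sym) × Env k
      finished y = inj₂ nothing , y ∷ [] ∷ [] ∷ [] ∷ ρ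

    clearL-run : ∀ l {y} → (inj₁ clearL , y ∷ [] ∷ l ∷ [] ∷ ρ) ▷[ suc (length l) ] finished y
    clearL-run []      = refl
    clearL-run (_ ∷ l) = clearL-run l

    unreverse-run : ∀ t {l y} → (inj₁ unreverse , y ∷ [] ∷ l ∷ t ∷ ρ) ▷[ suc (length t) + suc (length l) ] finished
        (t ʳ++ y)
    unreverse-run []      {l} = clearL-run l
    unreverse-run (_ ∷ t) = unreverse-run t

    clearX-run : ∀ x {n l t c} → (inj₁ unreverse , [] ∷ [] ∷ l ∷ t ∷ ρ) ▷[ n ] c → (inj₁ clearX , x ∷ [] ∷ l ∷ t ∷ ρ)
        ▷[ suc (length x) + n ] c
    clearX-run []      q = q
    clearX-run (_ ∷ x) q = clearX-run x q

    clearR-run : ∀ r {n x l t c} → (inj₁ clearX , x ∷ [] ∷ l ∷ t ∷ ρ) ▷[ n ] c → (inj₁ clearR , x ∷ r ∷ l ∷ t ∷ ρ) ▷[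
        suc (length r) + n ] c
    clearR-run []      q = q
    clearR-run (_ ∷ r) q = clearR-run r q

    private
      discard-run : ∀ r x l t → (inj₁ clearR , x ∷ r ∷ l ∷ t ∷ ρ) ▷[ length r + length x + length t + length l + 4 ]
          finished (t ʳ++ [])
      discard-run r x l t = subst (λ n → (inj₁ clearR , x ∷ r ∷ l ∷ t ∷ ρ) ▷[ n ] finished (t ʳ++ []))
          (lemma (length r) (length x) (length t) (length l)) (clearR-run r (clearX-run x (unreverse-run t)))
        where
        lemma : ∀ r x t l → suc r + (suc x + (suc t + suc l)) ≡ r + x + t + l + 4
        lemma = solve-∀

      fuel : List Sym → Str → Str → Str → ℕ
      fuel r x l t = length r * 3 + length x + length t + length l + 5

    decode-run : ∀ r x l t → (inj₁ decode , x ∷ encSym r ∷ l ∷ t ∷ ρ) ▷[ fuel r x l t ] finished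
        (t ʳ++ readWord (r ++ map just x))
    decode-run [] x l t = supersteps-mono call (inj₁ decode , x ∷ [] ∷ l ∷ t ∷ ρ) le
        (subst (λ y → (inj₁ decode , x ∷ [] ∷ l ∷ t ∷ ρ) ▷[ suc (suc (length t) + suc (length l)) ] finished
        (t ʳ++ y)) (sym (readWord-just x)) (unreverse-run t))
      where
      lemma : ∀ x t l → suc (suc t + suc l) + (x + 2) ≡ x + t + l + 5
      lemma = solve-∀
      le : suc (suc (length t) + suc (length l)) ≤ length x + length t + length l + 5
      le = ≤-trans (m≤m+n _ (length x + 2)) (≤-reflexive (lemma (length x) (length t) (length l)))
    decode-run (nothing ∷ r) x l t = supersteps-mono call (inj₁ decode , x ∷ encSym (nothing ∷ r) ∷ l ∷ t ∷ ρ) le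
        (discard-run (encSym r) x l t)
      where
      lemma : ∀ r x t l → suc (r * 2 + x + t + l + 4) + (r + 3) ≡ suc r * 3 + x + t + l + 5
      lemma = solve-∀
      le : suc (length (encSym r) + length x + length t + length l + 4) ≤ fuel (nothing ∷ r) x l t
      le = ≤-trans (s≤s (+-monoˡ-≤ 4
          (+-monoˡ-≤ (length l) (+-monoˡ-≤ (length t) (+-monoˡ-≤ (length x) (encSym-length r))))))
             (≤-trans (m≤m+n _ (length r + 3)) (≤-reflexive (lemma (length r) (length x) (length t) (length l))))
    decode-run (just b ∷ r) x l t = supersteps-mono call (inj₁ decode , x ∷ encSym (just b ∷ r) ∷ l ∷ t ∷ ρ) le
        (decode-run r x l (b ∷ t))
      where
      lemma : ∀ r x t l → suc (r * 3 + x + suc t + l + 5) + 1 ≡ suc r * 3 + x + t + l + 5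
      lemma = solve-∀
      le : suc (fuel r x l (b ∷ t)) ≤ fuel (just b ∷ r) x l t
      le = ≤-trans (m≤m+n _ 1) (≤-reflexive (lemma (length r) (length x) (length t) (length l)))

    step-run : ∀ {q h q′} w d l r x → δ q h ≡ just (q′ , w , d) →
               ∃[ l′ ] ∃[ h′ ] ∃[ r′ ] ∃[ x′ ] mv {M} q′ l w (r ++ map just x) d ≡ cfg q′ l′ h′ (r′ ++ map just x′) ×
               length l′ ≤ suc (length l) × length r′ + length x′ ≤ suc (length r + length x) ×
               (inj₁ (sim q h) , x ∷ encSym r ∷ encSym l ∷ [] ∷ ρ) ▷[ 1 ] (inj₁ (sim q′ h′) , x′ ∷ encSym r′ ∷ encSym
                   l′ ∷ [] ∷ ρ)
    step-run w        mS l             r             x       eq rewrite eq = l , w , r , x , refl , n≤1+n _ , n≤1+n _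
        , refl
    step-run nothing  mL []            r             x       eq rewrite eq = [] , nothing , nothing ∷ r , x , refl ,
        z≤n , ≤-refl , refl
    step-run nothing  mL (nothing ∷ l) r             x       eq rewrite eq = l , nothing , nothing ∷ r , x , refl ,
        m≤n+m _ 2 , ≤-refl , refl
    step-run nothing  mL (just b ∷ l)  r             x       eq rewrite eq = l , just b , nothing ∷ r , x , refl ,
        m≤n+m _ 2 , ≤-refl , refl
    step-run (just a) mL []            r             x       eq rewrite eq = [] , nothing , just a ∷ r , x , refl ,
        z≤n , ≤-refl , refl
    step-run (just a) mL (nothing ∷ l) r             x       eq rewrite eq = l , nothing , just a ∷ r , x , refl ,
        m≤n+m _ 2 , ≤-refl , refl
    step-run (just a) mL (just b ∷ l)  r             x       eq rewrite eq = l , just b , just a ∷ r , x , refl ,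
        m≤n+m _ 2 , ≤-refl , refl
    step-run nothing  mR l             []            []      eq rewrite eq = nothing ∷ l , nothing , [] , [] , refl ,
        ≤-refl , z≤n , refl
    step-run nothing  mR l             []            (b ∷ x) eq rewrite eq = nothing ∷ l , just b , [] , x , refl ,
        ≤-refl , m≤n+m _ 2 , refl
    step-run nothing  mR l             (nothing ∷ r) x       eq rewrite eq = nothing ∷ l , nothing , r , x , refl ,
        ≤-refl , m≤n+m _ 2 , refl
    step-run nothing  mR l             (just b ∷ r)  x       eq rewrite eq = nothing ∷ l , just b , r , x , refl ,
        ≤-refl , m≤n+m _ 2 , refl
    step-run (just a) mR l             []            []      eq rewrite eq = just a ∷ l , nothing , [] , [] , refl ,
        ≤-refl , z≤n , refl
    step-run (just a) mR l             []            (b ∷ x) eq rewrite eq = just a ∷ l , just b , [] , x , refl ,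
        ≤-refl , m≤n+m _ 2 , refl
    step-run (just a) mR l             (nothing ∷ r) x       eq rewrite eq = just a ∷ l , nothing , r , x , refl ,
        ≤-refl , m≤n+m _ 2 , refl
    step-run (just a) mR l             (just b ∷ r)  x       eq rewrite eq = just a ∷ l , just b , r , x , refl ,
        ≤-refl , m≤n+m _ 2 , refl

    record SimulatedRun (t : ℕ) (q : Fin (suc nQ)) (l : List Sym) (h : Sym) (r : List Sym) (x : Str) (c : Config M) :
        Set where
      constructor simulated
      open Config c
      field
        steps   : ℕ
        r′      : List Sym
        x′      : Str
        steps≤  : steps ≤ t
        right-≡ : right ≡ r′ ++ map just x′
        halted  : δ state head ≡ nothing
        left≤   : length left ≤ length l + t
        right≤  : length r′ + length x′ ≤ length r + length x + t
        reached : (inj₁ (sim q h) , x ∷ encSym r ∷ encSym l ∷ [] ∷ ρ)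
                    ▷[ steps ] (inj₁ (sim state head) , x′ ∷ encSym r′ ∷ encSym left ∷ [] ∷ ρ)

    sim-run : ∀ t {q l h r x c} → run M t (cfg q l h (r ++ map just x)) ≡ just c → SimulatedRun t q l h r x c
    sim-run t {q} {l} {h} {r} {x} {c} eq = go t (δ q h) refl eq
      where
      go : ∀ t v → δ q h ≡ v → run M t (cfg q l h (r ++ map just x)) ≡ just c → SimulatedRun t q l h r x c
      go t nothing eqδ eq with refl ← trans (sym (run-halt M q l h (r ++ map just x) t eqδ)) eq =
        simulated 0 r x z≤n refl eqδ (m≤m+n _ t) (m≤m+n _ t) refl
      go zero (just _) eqδ eq with () ← trans (sym (run-timeout M q l h (r ++ map just x) eqδ)) eq
      go (suc t) (just (q′ , w , d)) eqδ eq with step-run w d l r x eqδ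
      ... | l₁ , h₁ , r₁ , x₁ , eqm , l≤ , r≤ , eqs
        with sim-run t {q′} {l₁} {h₁} {r₁} {x₁} {c}
            (trans (cong (run M t) (sym eqm)) (trans (sym (run-step M q l h (r ++ map just x) t eqδ)) eq))
      ...   | simulated m r₂ x₂ m≤ eqr eqδ′ l≤′ r≤′ eqs′ = simulated (suc m) r₂ x₂ (s≤s m≤) eqr eqδ′
              (≤-trans l≤′ (≤-trans (+-monoˡ-≤ t l≤) (≤-reflexive (sym (+-suc _ t)))))
              (≤-trans r≤′ (≤-trans (+-monoˡ-≤ t r≤) (≤-reflexive (sym (+-suc _ t)))))
              (trans (cong (supersteps call m) eqs) eqs′)

    halted-run : ∀ {q h} r x l → δ q h ≡ nothing →
                 (inj₁ (sim q h) , x ∷ encSym r ∷ l ∷ [] ∷ ρ)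
                   ▷[ length r * 3 + length x + length l + 7 ] finished (readWord (h ∷ r ++ map just x))
    halted-run {q} {nothing} r x l eq = supersteps-mono call (inj₁ (sim q nothing) , x ∷ encSym r ∷ l ∷ [] ∷ ρ) le
        (trans (cong (supersteps call n) first) (discard-run (encSym r) x l []))
      where
      n = length (encSym r) + length x + 0 + length l + 4
      first : superstep call (inj₁ (sim q nothing) , x ∷ encSym r ∷ l ∷ [] ∷ ρ) ≡
          (inj₁ clearR , x ∷ encSym r ∷ l ∷ [] ∷ ρ)
      first rewrite eq = refl
      lemma : ∀ r x l → suc (r * 2 + x + 0 + l + 4) + (r + 2) ≡ r * 3 + x + l + 7
      lemma = solve-∀
      le : suc n ≤ length r * 3 + length x + length l + 7
      le = ≤-trans (s≤s (+-monoˡ-≤ 4 (+-monoˡ-≤ (length l) (+-monoˡ-≤ 0 (+-monoˡ-≤ (length x) (encSym-length r))))))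
             (≤-trans (m≤m+n _ (length r + 2)) (≤-reflexive (lemma (length r) (length x) (length l))))
    halted-run {q} {just b} r x l eq = supersteps-mono call (inj₁ (sim q (just b)) , x ∷ encSym r ∷ l ∷ [] ∷ ρ)
        (≤-reflexive (lemma (length r) (length x) (length l)))
        (trans (cong (supersteps call (fuel r x l (b ∷ []))) first) (decode-run r x l (b ∷ [])))
      where
      first : superstep call (inj₁ (sim q (just b)) , x ∷ encSym r ∷ l ∷ [] ∷ ρ) ≡
          (inj₁ decode , x ∷ encSym r ∷ l ∷ (b ∷ []) ∷ ρ)
      first rewrite eq = refl
      lemma : ∀ r x l → suc (r * 3 + x + 1 + l + 5) ≡ r * 3 + x + l + 7
      lemma = solve-∀

    -- Simulation, decoding and clearing are linear in `length x + t`, as no half-tape grows by more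
    -- than one cell per step. The same count bounds the output, which is what allows it to be
    -- processed further in polynomial time.
    call-exits : ∀ x t {y} → HaltsWith M x t y →
                 Exits call ((length x + t) * 6 + 8) (x ∷ [] ∷ [] ∷ [] ∷ ρ) nothing (y ∷ [] ∷ [] ∷ [] ∷ ρ) × length y
                     ≤ suc (length x + t)
    call-exits x t {y} (cfg q l h r , eq , out)
      with sim-run t {zero} {[]} {pop₁ x} {[]} {tl x} (trans (cong (run M t) (init x)) eq)
      where
      init : ∀ x → cfg zero [] (pop₁ x) (map just (tl x)) ≡ initConfig M x
      init []      = refl
      init (_ ∷ _) = refl
    ... | simulated m r′ x′ m≤ refl eqδ l≤ r≤ eqs =
        Exits-mono le (exits (trans (supersteps-+ call m)
            (trans (cong (supersteps call n) eqs) (trans (halted-run r′ x′ (encSym l) eqδ) (cong finished out))))) ,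
        (begin
          length y                                  ≡⟨ cong length out ⟨
          length (readWord (h ∷ r′ ++ map just x′)) ≤⟨ readWord-length (h ∷ r′ ++ map just x′) ⟩
          suc (length (r′ ++ map just x′))          ≡⟨ cong suc
              (trans (length-++ r′) (cong (length r′ +_) (length-map just x′))) ⟩
          suc (length r′ + length x′)               ≤⟨ s≤s rx≤ ⟩
          suc (length x + t)                        ∎)
      where
      open ≤-Reasoning
      n = length r′ * 3 + length x′ + length (encSym l) + 7
      rx≤ : length r′ + length x′ ≤ length x + t
      rx≤ = ≤-trans r≤ (+-monoˡ-≤ t (tl≤ x))
        where
        tl≤ : ∀ (x : Str) → length (tl x) ≤ length x
        tl≤ []      = z≤n
        tl≤ (_ ∷ x) = n≤1+n _
      lemma₁ : ∀ r x → (r * 3 + x) + x * 2 ≡ (r + x) * 3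
      lemma₁ = solve-∀
      lemma₂ : ∀ x t → suc (t + ((x + t) * 3 + t * 2 + 7)) + x * 3 ≡ (x + t) * 6 + 8
      lemma₂ = solve-∀
      le : suc (m + n) ≤ (length x + t) * 6 + 8
      le = begin
        suc (m + n)
          ≤⟨ s≤s (+-mono-≤ m≤ (+-monoˡ-≤ 7 (+-mono-≤ (≤-trans (m≤m+n _ (length x′ * 2))
               (≤-trans (≤-reflexive (lemma₁ (length r′) (length x′))) (*-monoˡ-≤ 3 rx≤)))
               (≤-trans (encSym-length l) (*-monoˡ-≤ 2 l≤))))) ⟩
        suc (t + ((length x + t) * 3 + t * 2 + 7))             ≤⟨ m≤m+n _ (length x * 3) ⟩
        suc (t + ((length x + t) * 3 + t * 2 + 7)) + length x * 3 ≡⟨ lemma₂ (length x) t ⟩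
        (length x + t) * 6 + 8                                 ∎

open Call using (call; call-exits)

module _ {I : Set} {sz : I → ℕ} (M : TM) (c : ℕ) (x y : I → Str)
         (halts : ∀ i → HaltsWith M (x i) ((length (x i) + c) ^ c) (y i)) (px : PolyBounded sz (length ∘ x)) where

  private
    pt : PolyBounded sz (λ i → length (x i) + (length (x i) + c) ^ c)
    pt = PB-+ px (PB-^ c (PB-+ px (PB-const c)))

  call-poly : ∀ {j} (ρ : I → Env j) → PolyExits sz (call M) (λ i → x i ∷ [] ∷ [] ∷ [] ∷ ρ i) (λ _ → nothing)
      (λ i → y i ∷ [] ∷ [] ∷ [] ∷ ρ i)
  call-poly ρ = polyExits _ (PB-+ (PB-* pt (PB-const 6)) (PB-const 8)) λ i → proj₁
      (call-exits M (ρ i) (x i) _ (halts i))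

  output-poly : PolyBounded sz (length ∘ y)
  output-poly = PB-≤ (λ i → proj₂ (call-exits M [] (x i) _ (halts i))) (PB-suc pt)

compiled-halts : ∀ {K} {I : Set} (p : SM (suc K)) (x y : I → Str) {e} (σ : I → Env K) →
                 PolyExits (length ∘ x) p (λ i → x i ∷ replicate K []) e (λ i → y i ∷ σ i) →
                 ∃[ c ] (∀ i → HaltsWith (Compile.tm p) (x i) ((length (x i) + c) ^ c) (y i))
compiled-halts {K} {I} p x y σ (polyExits t pt r) = proj₁ bound , λ i → halts (x i) (t i) (Exits.reaches (r i)) _
    (proj₂ bound i)
  where
  open Compile p
  bound : PolyBounded (length ∘ x) (λ i → time (length (x i)) (t i))
  bound = PB-* ptD (PB-+ (PB-* (PB-+ (PB-+ PB-size (PB-const (suc K))) ptD) (PB-const 4)) (PB-const 4))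
    where
    ptD : PolyBounded (length ∘ x) (λ i → t i * D)
    ptD = PB-* pt (PB-const D)

-- Counting strings of a given length

𝟙 : Bool → ℕ
𝟙 b = if b then 1 else 0

count-++ : ∀ P xs {ys} → count P (xs ++ ys) ≡ count P xs + count P ys
count-++ P []       = refl
count-++ P (x ∷ xs) = trans (cong (𝟙 (P x) +_) (count-++ P xs)) (sym (+-assoc (𝟙 (P x)) _ _))

count-cong : ∀ {P Q xs} → All (λ s → P s ≡ Q s) xs → count P xs ≡ count Q xs
count-cong []       = refl
count-cong (e ∷ es) = cong₂ _+_ (cong 𝟙 e) (count-cong es)

#_⟨_⟩ : (Str → Bool) → ℕ → ℕ
# P ⟨ n ⟩ = count P (strings n)

#-cong : ∀ {P Q} n → (∀ s → P s ≡ Q s) → # P ⟨ n ⟩ ≡ # Q ⟨ n ⟩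
#-cong n e = count-cong (All.universal e (strings n))

#-suc : ∀ P n → # P ⟨ suc n ⟩ ≡ # P ∘ (false ∷_) ⟨ n ⟩ + # P ∘ (true ∷_) ⟨ n ⟩
#-suc P n = go (strings n)
  where
  swap : ∀ a b c d → a + (b + (c + d)) ≡ (a + c) + (b + d)
  swap = solve-∀
  -- The enumeration alternates the first bit, so the two counts are interleaved and have to be
  -- regrouped.
  go : ∀ ss → count P (concatMap (λ s → (false ∷ s) ∷ (true ∷ s) ∷ []) ss) ≡ count (P ∘ (false ∷_)) ss + count
      (P ∘ (true ∷_)) ss
  go []       = refl
  go (s ∷ ss) = trans (cong (λ m → 𝟙 (P (false ∷ s)) + (𝟙 (P (true ∷ s)) + m)) (go ss))
      (swap (𝟙 (P (false ∷ s))) (𝟙 (P (true ∷ s))) _ _)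

#-false : ∀ n → # (λ _ → false) ⟨ n ⟩ ≡ 0
#-false zero    = refl
#-false (suc n) rewrite #-suc (λ _ → false) n | #-false n = refl

#-true : ∀ n → # (λ _ → true) ⟨ n ⟩ ≡ 2 ^ n
#-true zero    = refl
#-true (suc n) rewrite #-suc (λ _ → true) n | #-true n = cong (2 ^ n +_) (sym (+-identityʳ _))

#-complement : ∀ P n → # P ⟨ n ⟩ + # not ∘ P ⟨ n ⟩ ≡ 2 ^ n
#-complement P n = trans (go (strings n)) (#-true n)
  where
  swap : ∀ a b c d → (a + c) + (b + d) ≡ (a + b) + (c + d)
  swap = solve-∀
  one : ∀ b → 𝟙 b + 𝟙 (not b) ≡ 1
  one true  = refl
  one false = refl
  go : ∀ ss → count P ss + count (not ∘ P) ss ≡ count (λ _ → true) ss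
  go []       = refl
  go (s ∷ ss) = trans (swap (𝟙 (P s)) (𝟙 (not (P s))) (count P ss) _) (cong₂ _+_ (one (P s)) (go ss))

#-≤ : ∀ P n → # P ⟨ n ⟩ ≤ 2 ^ n
#-≤ P n = ≤-trans (m≤m+n _ _) (≤-reflexive (#-complement P n))

-- Ranks

lexRank : Lang → Str → ℕ
lexRank A x = # (λ y → lexLeq y x ∧ A y) ⟨ length x ⟩

below : Lang → ℕ → ℕ
below A n = count A (concat (map strings (upTo n)))

count-upTo : ∀ P n → count P (concat (map strings (upTo (suc n)))) ≡ count P (concat (map strings (upTo n))) + # P
    ⟨ n ⟩
count-upTo P n = begin
  count P (concat (map strings (upTo (suc n))))                            ≡⟨ cong (count P ∘ concat ∘ map strings)
      (upTo-∷ʳ n) ⟨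
  count P (concat (map strings (upTo n ∷ʳ n)))                             ≡⟨ cong (count P ∘ concat)
      (map-++ strings (upTo n) (n ∷ [])) ⟩
  count P (concat (map strings (upTo n) ++ strings n ∷ []))                ≡⟨ cong (count P)
      (concat-++ (map strings (upTo n)) (strings n ∷ [])) ⟨
  count P (concat (map strings (upTo n)) ++ strings n ++ [])               ≡⟨ cong
      (λ s → count P (concat (map strings (upTo n)) ++ s)) (++-identityʳ (strings n)) ⟩
  count P (concat (map strings (upTo n)) ++ strings n)                     ≡⟨ count-++ P
      (concat (map strings (upTo n))) ⟩
  count P (concat (map strings (upTo n))) + # P ⟨ n ⟩                      ∎
  where open ≡-Reasoning

strings-length : ∀ n → All (λ s → length s ≡ n) (strings n)
strings-length zero    = refl ∷ []
strings-length (suc n) = go (strings-length n)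
  where
  go : ∀ {ss} → All (λ s → length s ≡ n) ss → All (λ s → length s ≡ suc n)
      (concatMap (λ s → (false ∷ s) ∷ (true ∷ s) ∷ []) ss)
  go []       = []
  go (e ∷ es) = cong suc e ∷ cong suc e ∷ go es

<ᵇ-true : ∀ {m n} → m < n → (m <ᵇ n) ≡ true
<ᵇ-true {zero}  {suc n} _       = refl
<ᵇ-true {suc m} {suc n} (s≤s p) = <ᵇ-true p

<ᵇ-irrefl : ∀ n → (n <ᵇ n) ≡ false
<ᵇ-irrefl zero    = refl
<ᵇ-irrefl (suc n) = <ᵇ-irrefl n

≡ᵇ-refl : ∀ n → (n ≡ᵇ n) ≡ true
≡ᵇ-refl zero    = refl
≡ᵇ-refl (suc n) = ≡ᵇ-refl n

-- On shorter strings `stdLeq` holds by length alone, and on strings of length |x| it is `lexLeq`.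
rank-split : ∀ A x → rank A x ≡ below A (length x) + lexRank A x
rank-split A x = trans (count-upTo P n) (cong₂ _+_ (shorter n ≤-refl) (count-cong (All.map same (strings-length n))))
  where
  n = length x
  P = λ y → stdLeq y x ∧ A y
  same : ∀ {s} → length s ≡ n → P s ≡ (lexLeq s x ∧ A s)
  same e rewrite e | <ᵇ-irrefl n | ≡ᵇ-refl n = refl
  less : ∀ {m s} → m < n → length s ≡ m → P s ≡ A s
  less m<n refl rewrite <ᵇ-true m<n = refl
  shorter : ∀ m → m ≤ n → count P (concat (map strings (upTo m))) ≡ below A m
  shorter zero    _   = refl
  shorter (suc m) m<n = trans (count-upTo P m)
      (trans (cong₂ _+_ (shorter m (<⇒≤ m<n)) (count-cong (All.map (less m<n) (strings-length m))))
      (sym (count-upTo A m)))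

lexRank-false : ∀ A x → lexRank A (false ∷ x) ≡ lexRank (A ∘ (false ∷_)) x
lexRank-false A x rewrite #-suc (λ y → lexLeq y (false ∷ x) ∧ A y) (length x) | #-false (length x) = +-identityʳ _

lexRank-true : ∀ A x → lexRank A (true ∷ x) ≡ # A ∘ (false ∷_) ⟨ length x ⟩ + lexRank (A ∘ (true ∷_)) x
lexRank-true A x = #-suc (λ y → lexLeq y (true ∷ x) ∧ A y) (length x)

lexRank-ones : ∀ A m → lexRank A (List.replicate m true) ≡ # A ⟨ m ⟩
lexRank-ones A zero    = refl
lexRank-ones A (suc m) rewrite lexRank-true A (List.replicate m true) | lexRank-ones (A ∘ (true ∷_)) m |
    length-replicate m {true} = sym (#-suc A m)

++-length : ∀ (w u v : Str) → length u ≡ length v → length (w ++ u) ≡ length (w ++ v)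
++-length w u v e = trans (length-++ w) (trans (cong (length w +_) e) (sym (length-++ w)))

-- The strings that branch off before `w` on the smaller side precede both extensions of `w`; they
-- contribute the same to both ranks and leave the difference unchanged.
lexRank-prefix : ∀ A w u v {d} → length u ≡ length v → lexRank (A ∘ (w ++_)) u ≡ lexRank (A ∘ (w ++_)) v + d →
                 lexRank A (w ++ u) ≡ lexRank A (w ++ v) + d
lexRank-prefix A []          u v e r = r
lexRank-prefix A (false ∷ w) u v e r
  rewrite lexRank-false A (w ++ u) | lexRank-false A (w ++ v) = lexRank-prefix (A ∘ (false ∷_)) w u v e r
lexRank-prefix A (true ∷ w) u v {d} e r = begin
  lexRank A (true ∷ w ++ u)                                         ≡⟨ lexRank-true A (w ++ u) ⟩
  # A₀ ⟨ length (w ++ u) ⟩ + lexRank A₁ (w ++ u)                    ≡⟨ cong₂ _+_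
      (cong (λ n → # A₀ ⟨ n ⟩) (++-length w u v e)) (lexRank-prefix A₁ w u v e r) ⟩
  # A₀ ⟨ length (w ++ v) ⟩ + (lexRank A₁ (w ++ v) + d)              ≡⟨ +-assoc _ (lexRank A₁ (w ++ v)) d ⟨
  # A₀ ⟨ length (w ++ v) ⟩ + lexRank A₁ (w ++ v) + d                ≡⟨ cong (_+ d) (lexRank-true A (w ++ v)) ⟨
  lexRank A (true ∷ w ++ v) + d                                     ∎
  where
  open ≡-Reasoning
  A₀ = A ∘ (false ∷_)
  A₁ = A ∘ (true ∷_)

double : Str → Str
double = concatMap (λ b → b ∷ b ∷ [])

-- Among the strings of their length, upper x m is the last one with prefix (double x)010, and lower x m
-- is the last one before that block.
upper lower : Str → ℕ → Str
upper x m = double x ++ false ∷ true ∷ false ∷ List.replicate m true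
lower x m = double x ++ false ∷ false ∷ true ∷ List.replicate m true

rank-difference : ∀ A x m → rank A (upper x m) ≡ rank A (lower x m) + #
    (λ y → A (double x ++ false ∷ true ∷ false ∷ y)) ⟨ m ⟩
rank-difference A x m = begin
  rank A (upper x m)                                                    ≡⟨ rank-split A (upper x m) ⟩
  below A (length (upper x m)) + lexRank A (upper x m)                  ≡⟨ cong₂ _+_
      (cong (below A) (++-length (double x) u v refl)) (lexRank-prefix A (double x) u v refl tail-ranks) ⟩
  below A (length (lower x m)) + (lexRank A (lower x m) + d)            ≡⟨ +-assoc _ (lexRank A (lower x m)) d ⟨
  below A (length (lower x m)) + lexRank A (lower x m) + d              ≡⟨ cong (_+ d) (rank-split A (lower x m)) ⟨
  rank A (lower x m) + d                                                ∎
  where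
  open ≡-Reasoning
  ones = List.replicate m true
  u = false ∷ true ∷ false ∷ ones
  v = false ∷ false ∷ true ∷ ones
  d = # (λ y → A (double x ++ false ∷ true ∷ false ∷ y)) ⟨ m ⟩
  -- Both ranks count all strings that start with 00; only the first one also counts the block 010.
  tail-ranks : ∀ {A} → lexRank A (false ∷ true ∷ false ∷ ones) ≡ lexRank A (false ∷ false ∷ true ∷ ones) + #
      (λ y → A (false ∷ true ∷ false ∷ y)) ⟨ m ⟩
  tail-ranks {A}
    rewrite lexRank-false A (true ∷ false ∷ ones) | lexRank-true (A ∘ (false ∷_)) (false ∷ ones)
          | lexRank-false (λ s → A (false ∷ true ∷ s)) ones | lexRank-ones (λ s → A (false ∷ true ∷ false ∷ s)) m
          | lexRank-false A (false ∷ true ∷ ones) | lexRank-false (A ∘ (false ∷_)) (true ∷ ones)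
          | lexRank-true (λ s → A (false ∷ false ∷ s)) ones | lexRank-ones (λ s → A (false ∷ false ∷ true ∷ s)) m
          | length-replicate m {true} | #-suc (λ s → A (false ∷ false ∷ s)) m = refl

-- extract removes the bit following the first unequal pair of bits, or the last bit if there is none.
-- It is a bijection {0,1}ⁿ⁺¹ → {0,1} × {0,1}ⁿ, so balanced A has half of the strings of each positive length.

extract₁ : Bool → Str → Bool × Str
extract₁ a []            = a , []
extract₁ a (a′ ∷ [])     = a′ , a ∷ []
extract₁ a (a′ ∷ c ∷ z)  = if a xor a′ then (c , a ∷ a′ ∷ z) else
    (proj₁ (extract₁ c z) , a ∷ a′ ∷ proj₂ (extract₁ c z))

extract : Str → Bool × Str
extract []      = false , []
extract (a ∷ z) = extract₁ a z

balanced : Lang → Lang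
balanced A z = proj₁ (extract z) xor A (proj₂ (extract z))

-- Induction by two bits. After an equal pair the claim recurs for `A` with these bits fixed; after
-- an unequal pair the third bit is the extracted one, and its two values accept complementary sets
-- of continuations.
balanced-count : ∀ A n → # (λ z → balanced A (false ∷ z)) ⟨ n ⟩ + # (λ z → balanced A (true ∷ z)) ⟨ n ⟩ ≡ 2 ^ n
balanced-count A zero with A []
... | true  = refl
... | false = refl
balanced-count A (suc zero) with A (false ∷ []) | A (true ∷ [])
... | true  | true  = refl
... | true  | false = refl
... | false | true  = refl
... | false | false = refl
balanced-count A (suc (suc n)) = begin
  # f false ⟨ suc (suc n) ⟩ + # f true ⟨ suc (suc n) ⟩ ≡⟨ cong₂ _+_ (split false) (split true) ⟩
  (q false false + q false true) + (q true false + q true true)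
    ≡⟨ cong₂ _+_ (cong₂ _+_ (balanced-count (λ w → A (false ∷ false ∷ w)) n)
        (#-complement (λ z → A (false ∷ true ∷ z)) n))
                 (cong₂ _+_ (#-complement (λ z → A (true ∷ false ∷ z)) n) (balanced-count (λ w → A (true ∷ true ∷ w))
                     n)) ⟩
  (2 ^ n + 2 ^ n) + (2 ^ n + 2 ^ n) ≡⟨ four (2 ^ n) ⟩
  2 * (2 * 2 ^ n) ∎
  where
  open ≡-Reasoning
  f : Bool → Str → Bool
  f a z = balanced A (a ∷ z)
  q : Bool → Bool → ℕ
  q a a′ = # (λ z → f a (a′ ∷ false ∷ z)) ⟨ n ⟩ + # (λ z → f a (a′ ∷ true ∷ z)) ⟨ n ⟩
  split : ∀ a → # f a ⟨ suc (suc n) ⟩ ≡ q a false + q a true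
  split a = trans (#-suc (f a) (suc n)) (cong₂ _+_ (#-suc (f a ∘ (false ∷_)) n) (#-suc (f a ∘ (true ∷_)) n))
  four : ∀ m → (m + m) + (m + m) ≡ 2 * (2 * m)
  four = solve-∀

census-balanced : ∀ A n → census (balanced A) (suc n) ≡ 2 ^ n
census-balanced A n = trans (#-suc (balanced A) n) (balanced-count A n)

-- All pairs of `double x` are equal, so the separator 01 is the first unequal one and the 0 behind
-- it is the bit removed.
extract-double : ∀ x y → extract (double x ++ false ∷ true ∷ false ∷ y) ≡ (false , pair x y)
extract-double []               y = refl
extract-double (true ∷ [])      y = refl
extract-double (false ∷ [])     y = refl
extract-double (true ∷ b ∷ x)   y = cong (λ (c , w) → c , true ∷ true ∷ w) (extract-double (b ∷ x) y)
extract-double (false ∷ b ∷ x)  y = cong (λ (c , w) → c , false ∷ false ∷ w) (extract-double (b ∷ x) y)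

balanced-double : ∀ A x y → balanced A (double x ++ false ∷ true ∷ false ∷ y) ≡ A (pair x y)
balanced-double A x y rewrite extract-double x y = refl

-- Unpairing by machine, and the inclusion of P in PP

retarget : ∀ {k I sz} {p : SM k} {σ : I → Env k} {e σ′ σ″} → (∀ i → σ′ i ≡ σ″ i) → PolyExits sz p σ e σ′ → PolyExits
    sz p σ e σ″
retarget eq (polyExits t pt r) = polyExits t pt λ i → subst (Exits _ _ _ _) (eq i) (r i)

decides : ∀ {K} (p : SM (suc K)) A {e} (σ : Str → Env K) →
          PolyExits length p (λ x → x ∷ replicate K []) e (λ x → (A x ∷ []) ∷ σ x) → InP A
decides p A σ r = Compile.tm p , compiled-halts p id (λ x → A x ∷ []) σ r

pattern S₄ = suc (suc (suc (suc zero)))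
pattern S₅ = suc (suc (suc (suc (suc zero))))
pattern S₆ = suc (suc (suc (suc (suc (suc zero)))))
pattern S₇ = suc (suc (suc (suc (suc (suc (suc zero))))))
pattern S₈ = suc (suc (suc (suc (suc (suc (suc (suc zero)))))))
pattern S₉ = suc (suc (suc (suc (suc (suc (suc (suc (suc zero))))))))

moveTo : ∀ {k} → Fin k → Bool → List (Fin k × Bool)
moveTo j b = (j , b) ∷ []

reverse-twice : ∀ (z : Str) {y} → (z ʳ++ []) ʳ++ y ≡ z ++ y
reverse-twice z = ʳ++-ʳ++ z

unpair : Str → Str × Str
unpair []            = [] , []
unpair (a ∷ [])      = [] , []
unpair (a ∷ a′ ∷ z)  = if a xor a′ then ([] , z) else (a ∷ proj₁ (unpair z) , proj₂ (unpair z))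

unpair-pair : ∀ x y → unpair (pair x y) ≡ (x , y)
unpair-pair []          y = refl
unpair-pair (true ∷ x)  y rewrite unpair-pair x y = refl
unpair-pair (false ∷ x) y rewrite unpair-pair x y = refl

unpair-length : ∀ z → length (proj₁ (unpair z)) ≤ length z × length (proj₂ (unpair z)) ≤ length z
unpair-length []                     = z≤n , z≤n
unpair-length (a ∷ [])               = z≤n , z≤n
unpair-length (true ∷ false ∷ z)     = z≤n , m≤n+m _ 2
unpair-length (false ∷ true ∷ z)     = z≤n , m≤n+m _ 2
unpair-length (true ∷ true ∷ z)      = s≤s (m≤n⇒m≤1+n (proj₁ (unpair-length z))) , m≤n⇒m≤1+n
    (m≤n⇒m≤1+n (proj₂ (unpair-length z)))
unpair-length (false ∷ false ∷ z)    = s≤s (m≤n⇒m≤1+n (proj₁ (unpair-length z))) , m≤n⇒m≤1+n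
    (m≤n⇒m≤1+n (proj₂ (unpair-length z)))

-- The second component stays on stack i, the reverse of the first one goes to stack j.
unpairing : ∀ {k} → Fin k → Fin k → SM k
unpairing i j .SM.Q      = ⊤
unpairing i j .SM.finite = ⊤-finite
unpairing i j .SM.start  = tt
unpairing i j .SM.body _ = pop i λ
  { nothing  → ret (inj₂ nothing)
  ; (just a) → pop i λ
    { nothing   → ret (inj₂ nothing)
    ; (just a′) → if a xor a′ then ret (inj₂ nothing) else push j a (ret (inj₁ tt)) } }

module _ {k : ℕ} (i j : Fin k) (ctx : Str → Str → Env k)
         (e₀ : ∀ u → superstep (unpairing i j) (inj₁ tt , ctx [] u) ≡ (inj₂ nothing , ctx [] u))
         (e₁ : ∀ a u → superstep (unpairing i j) (inj₁ tt , ctx (a ∷ []) u) ≡ (inj₂ nothing , ctx [] u))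
         (e₂ : ∀ a a′ z u → superstep (unpairing i j) (inj₁ tt , ctx (a ∷ a′ ∷ z) u) ≡
                            (if a xor a′ then (inj₂ nothing , ctx z u) else (inj₁ tt , ctx z (a ∷ u)))) where

  unpairing-exits : ∀ z u → Exits (unpairing i j) (suc (length z)) (ctx z u) nothing
      (ctx (proj₂ (unpair z)) (proj₁ (unpair z) ʳ++ u))
  unpairing-exits []           u = exits (e₀ u)
  unpairing-exits (a ∷ [])     u = exits (cong (superstep (unpairing i j)) (e₁ a u))
  unpairing-exits (a ∷ a′ ∷ z) u = exits (trans (cong (supersteps (unpairing i j) (2 + length z)) (e₂ a a′ z u))
      (rest (a xor a′)))
    where
    rest : ∀ c → supersteps (unpairing i j) (2 + length z) (if c then (inj₂ nothing , ctx z u) else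
        (inj₁ tt , ctx z (a ∷ u))) ≡
           (let (v , w) = if c then ([] , z) else (a ∷ proj₁ (unpair z) , proj₂ (unpair z)) in inj₂ nothing , ctx w
               (v ʳ++ u))
    rest true  = supersteps-exit (unpairing i j) (length z)
    rest false = Exits.reaches (Exits-mono (n≤1+n (suc (length z))) (unpairing-exits z (a ∷ u)))

unpairFirst : TM → SM 5
unpairFirst M = unpairing S₀ S₄ ⨾ each S₀ (λ _ → []) ⨾ each S₄ (moveTo S₀) ⨾ call M

unpairFirst-poly : ∀ M c (L : Lang) → (∀ x → HaltsWith M x ((length x + c) ^ c) (L x ∷ [])) →
  PolyExits length (unpairFirst M) (λ z → z ∷ replicate 4 []) (λ _ → nothing)
      (λ z → (L (proj₁ (unpair z)) ∷ []) ∷ replicate 4 [])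
unpairFirst-poly M c L h =
  polyExits _ (PB-suc PB-size) (λ z → unpairing-exits S₀ S₄ (λ z u → z ∷ [] ∷ [] ∷ [] ∷ u ∷ [])
    (λ _ → refl) (λ _ _ → refl) (λ { true true z u → refl ; true false z u → refl ; false true z u → refl ; false
        false z u → refl }) z [])
  ⨾-poly each-poly S₀ (λ _ → []) (λ z x _ → x ∷ [] ∷ [] ∷ [] ∷ (proj₁ (unpair z) ʳ++ []) ∷ []) (λ a _ → a)
      (λ _ _ → refl) (λ _ _ _ _ → refl)
         (λ z → proj₂ (unpair z)) (λ _ → tt) (PB-≤ (proj₂ ∘ unpair-length) PB-size)
  ⨾-poly retarget (λ z → cong (λ w → w ∷ [] ∷ [] ∷ [] ∷ [] ∷ []) (trans (reverse-twice (proj₁ (unpair z)))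
      (++-identityʳ _)))
    (each-poly S₄ (moveTo S₀) (λ _ u x → x ∷ [] ∷ [] ∷ [] ∷ u ∷ []) (λ x b → b ∷ x) (λ _ _ → refl) (λ _ _ _ _ → refl)
         (λ z → proj₁ (unpair z) ʳ++ []) (λ _ → [])
         (PB-≤ (λ z → ≤-trans (≤-reflexive (trans (length-ʳ++ (proj₁ (unpair z))) (+-identityʳ _)))
             (proj₁ (unpair-length z))) PB-size))
  ⨾-poly call-poly M c (λ z → proj₁ (unpair z)) (λ z → L (proj₁ (unpair z)) ∷ []) (λ z → h (proj₁ (unpair z)))
         (PB-≤ (proj₁ ∘ unpair-length) PB-size) (λ _ → [] ∷ [])

InP⇒InPP : ∀ L → InP L → InPP L
-- The empty polynomial leaves the empty word as the only choice, and by truncated subtraction the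
-- threshold `2 ^ (0 ∸ 1)` is 1: this one choice has to accept.
InP⇒InPP L (M , c , h) = A , decides (unpairFirst M) A (λ _ → replicate 4 []) (unpairFirst-poly M c L h) , [] , λ x →
    to x , from x
  where
  A : Lang
  A z = L (proj₁ (unpair z))
  k : ∀ x → count (λ y → A (pair x y)) (strings 0) ≡ 𝟙 (L x) + 0
  k x rewrite unpair-pair x [] = refl
  to : ∀ x → L x ≡ true → 1 ≤ count (λ y → A (pair x y)) (strings 0)
  to x e rewrite k x | e = ≤-refl
  from : ∀ x → 1 ≤ count (λ y → A (pair x y)) (strings 0) → L x ≡ true
  from x le rewrite k x with L x
  ... | true = refl
  from x () | false

-- The balanced language is in P

extracting : ∀ {k} → SM (4 + k)
extracting .SM.Q      = Sym
extracting .SM.finite = Sym-finite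
extracting .SM.start  = nothing
extracting .SM.body nothing  = pop S₀ λ { nothing → ret (inj₂ (just false)) ; (just a) → ret (inj₁ (just a)) }
extracting .SM.body (just a) = pop S₀ λ
  { nothing   → ret (inj₂ (just a))
  ; (just a′) → pop S₀ λ
    { nothing  → push S₃ a (ret (inj₂ (just a′)))
    ; (just c) → push S₃ a (push S₃ a′ (ret (if a xor a′ then inj₂ (just c) else inj₁ (just c)))) } }

-- The machine stops at the bit to be removed, with `r` unread and `t` the reverse of what has been
-- read. Moving `t` back onto `r` yields the remaining word.
extracting₁-exits : ∀ a z u → ∃[ t ] ∃[ r ] t ʳ++ r ≡ u ʳ++ proj₂ (extract₁ a z) × length t ≤ length u + length z ×
  supersteps (extracting {0}) (suc (length z)) (inj₁ (just a) , z ∷ [] ∷ [] ∷ u ∷ []) ≡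
      (inj₂ (just (proj₁ (extract₁ a z))) , r ∷ [] ∷ [] ∷ t ∷ [])
extracting₁-exits a []                u = u , [] , refl , m≤m+n _ _ , refl
extracting₁-exits a (a′ ∷ [])         u = a ∷ u , [] , refl , ≤-reflexive (+-comm 1 _) , refl
extracting₁-exits a (a′ ∷ c ∷ z)      u with a xor a′
... | true  = a′ ∷ a ∷ u , z , refl , len , supersteps-exit (extracting {0}) (length z)
  where
  lemma : ∀ u z → suc (suc u) + z ≡ u + suc (suc z)
  lemma = solve-∀
  len : length (a′ ∷ a ∷ u) ≤ length u + length (a′ ∷ c ∷ z)
  len = ≤-trans (m≤m+n _ (length z)) (≤-reflexive (lemma (length u) (length z)))
... | false with extracting₁-exits c z (a′ ∷ a ∷ u)
...   | t , r , eq , t≤ , run = t , r , eq , ≤-trans t≤ (≤-reflexive (lemma (length u) (length z))) ,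
        supersteps-mono (extracting {0}) (inj₁ (just c) , z ∷ [] ∷ [] ∷ (a′ ∷ a ∷ u) ∷ []) (n≤1+n (suc (length z)))
            run
  where
  lemma : ∀ u z → suc (suc u) + z ≡ u + suc (suc z)
  lemma = solve-∀

extracting-exits : ∀ z → ∃[ t ] ∃[ r ] t ʳ++ r ≡ proj₂ (extract z) × length t ≤ length z ×
  Exits (extracting {0}) (suc (length z)) (z ∷ [] ∷ [] ∷ [] ∷ []) (just (proj₁ (extract z))) (r ∷ [] ∷ [] ∷ t ∷ [])
extracting-exits []      = [] , [] , refl , z≤n , exits refl
extracting-exits (a ∷ z) with extracting₁-exits a z []
... | t , r , eq , t≤ , run = t , r , eq , m≤n⇒m≤1+n t≤ , exits run

extract-length : ∀ z → length (proj₂ (extract z)) ≤ length z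
extract-length []      = z≤n
extract-length (a ∷ z) = m≤n⇒m≤1+n (go a z)
  where
  go : ∀ a z → length (proj₂ (extract₁ a z)) ≤ length z
  go a []            = z≤n
  go a (a′ ∷ [])     = ≤-refl
  go a (a′ ∷ c ∷ z) with a xor a′
  ... | true  = ≤-refl
  ... | false = s≤s (s≤s (go c z))

-- `extracting` always exits with a bit and `call` leaves a bit on `S₀`; the last clause merely
-- makes the tree total.
xorTop : Sym → Sym → Tree 4 Sym
xorTop (just b) (just v) = push S₀ (b xor v) (ret nothing)
xorTop _        _        = ret nothing

balancing : TM → SM 4
balancing M = bind extracting λ s → each S₃ (moveTo S₀) ⨾ call M ⨾ straight (pop S₀ (xorTop s))

balancing-poly : ∀ M c (A : Lang) → (∀ x → HaltsWith M x ((length x + c) ^ c) (A x ∷ [])) →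
  PolyExits length (balancing M) (λ z → z ∷ replicate 3 []) (λ _ → nothing) (λ z → (balanced A z ∷ []) ∷ replicate 3
      [])
balancing-poly M c A h =
  bind-poly {e = λ s z → proj₁ (final s z)} {λ s z → proj₂ (final s z)}
    (polyExits _ (PB-suc PB-size) λ z → proj₂ (proj₂ (proj₂ (proj₂ (extracting-exits z)))))
    λ s → retarget (λ z → cong (λ w → w ∷ [] ∷ [] ∷ [] ∷ []) (proj₁ (proj₂ (proj₂ (extracting-exits z)))))
            (each-poly S₃ (moveTo S₀) (λ _ t x → x ∷ [] ∷ [] ∷ t ∷ []) (λ x b → b ∷ x) (λ _ _ → refl)
                (λ _ _ _ _ → refl)
              (λ z → proj₁ (extracting-exits z)) (λ z → proj₁ (proj₂ (extracting-exits z)))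
                  (PB-≤ (λ z → proj₁ (proj₂ (proj₂ (proj₂ (extracting-exits z))))) PB-size))
          ⨾-poly call-poly M c (λ z → proj₂ (extract z)) (λ z → A (proj₂ (extract z)) ∷ [])
              (λ z → h (proj₂ (extract z))) (PB-≤ extract-length PB-size) (λ _ → [])
          ⨾-poly straight-poly (pop S₀ (xorTop s)) (λ z → (A (proj₂ (extract z)) ∷ []) ∷ [] ∷ [] ∷ [] ∷ [])
  where
  final : Sym → Str → Sym × Env 4
  final s z = exec (pop S₀ (xorTop s)) ((A (proj₂ (extract z)) ∷ []) ∷ [] ∷ [] ∷ [] ∷ [])

balanced-InP : ∀ A → InP A → InP (balanced A)
balanced-InP A (M , c , h) = decides (balancing M) (balanced A) (λ _ → replicate 3 []) (balancing-poly M c A h)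

-- The census of the balanced language

powerOfTwo : Bool → SM 4
powerOfTwo b = bind (straight (pop S₀ ret)) λ
  { nothing  → write ((S₀ , b) ∷ [])
  ; (just _) → each S₀ (λ _ → (S₃ , false) ∷ []) ⨾ each S₃ (λ _ → (S₀ , false) ∷ []) ⨾ write ((S₀ , true) ∷ []) }

fill : ∀ c (x a : Str) → foldl (λ a _ → c ∷ a) a x ≡ List.replicate (length x) c ++ a
fill c []      a = refl
fill c (_ ∷ x) a = trans (fill c x (c ∷ a)) (shift (length x))
  where
  shift : ∀ n → List.replicate n c ++ c ∷ a ≡ c ∷ List.replicate n c ++ a
  shift zero    = refl
  shift (suc n) = cong (c ∷_) (shift n)

binVal-zeros : ∀ n a → foldl (λ acc b → 2 * acc + 𝟙 b) a (List.replicate n false) ≡ a * 2 ^ n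
binVal-zeros zero    a = sym (*-identityʳ _)
binVal-zeros (suc n) a = trans (binVal-zeros n _) (lemma a (2 ^ n))
  where
  lemma : ∀ a p → (2 * a + 0) * p ≡ a * (2 * p)
  lemma = solve-∀

ones : ℕ → Str
ones n = List.replicate n true

-- The empty string has no bit to flip, so its membership is that in `A`; this single value is built
-- into the machine as `b`.
powerWord : Bool → ℕ → Str
powerWord b zero    = b ∷ []
powerWord b (suc n) = true ∷ List.replicate n false

powerOfTwo-poly : ∀ b → PolyExits (length ∘ ones) (powerOfTwo b) (λ n → ones n ∷ replicate 3 []) (λ _ → nothing)
    (λ n → powerWord b n ∷ replicate 3 [])
powerOfTwo-poly b = retarget eq (bind-poly {e = λ _ _ → nothing} {final}
    (straight-poly (pop S₀ ret) (λ n → ones n ∷ [] ∷ [] ∷ [] ∷ []))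
    λ { nothing  → straight-poly (pushes ((S₀ , b) ∷ []) (ret nothing)) _
      ; (just _) → retarget (λ n → cong (λ w → [] ∷ [] ∷ [] ∷ w ∷ [])
          (trans (fill false (tl (ones n)) []) (++-identityʳ _)))
            (each-poly S₀ (λ _ → (S₃ , false) ∷ []) (λ _ x t → x ∷ [] ∷ [] ∷ t ∷ []) (λ a _ → false ∷ a)
                (λ _ _ → refl) (λ _ _ _ _ → refl)
               (λ n → tl (ones n)) (λ _ → []) tl-poly)
          ⨾-poly retarget (λ n → cong (λ w → w ∷ [] ∷ [] ∷ [] ∷ [])
              (trans (fill false (zs n) [])
              (trans (++-identityʳ _) (cong (λ m → List.replicate m false) (length-replicate _)))))
            (each-poly S₃ (λ _ → (S₀ , false) ∷ []) (λ _ t x → x ∷ [] ∷ [] ∷ t ∷ []) (λ a _ → false ∷ a)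
                (λ _ _ → refl) (λ _ _ _ _ → refl)
               zs (λ _ → []) (PB-≤ (λ n → ≤-reflexive (length-replicate _)) tl-poly))
          ⨾-poly straight-poly (pushes ((S₀ , true) ∷ []) (ret nothing)) (λ n → zs n ∷ [] ∷ [] ∷ [] ∷ []) })
  where
  zs : ℕ → Str
  zs n = List.replicate (length (tl (ones n))) false
  final : Sym → ℕ → Env 4
  final nothing  n = (b ∷ tl (ones n)) ∷ [] ∷ [] ∷ [] ∷ []
  final (just _) n = (true ∷ zs n) ∷ [] ∷ [] ∷ [] ∷ []
  tl-poly : PolyBounded (length ∘ ones) (λ n → length (tl (ones n)))
  tl-poly = PB-≤ (λ { zero → z≤n ; (suc n) → n≤1+n _ }) PB-size
  eq : ∀ n → final (pop₁ (ones n)) n ≡ powerWord b n ∷ [] ∷ [] ∷ [] ∷ []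
  eq zero    = refl
  eq (suc n) = cong (λ m → (true ∷ List.replicate m false) ∷ [] ∷ [] ∷ [] ∷ []) (length-replicate n)

-- powerWord b n is the binary representation of 2ⁿ⁻¹ for n > 0, and of b for n = 0.
balanced-census : ∀ A → CensusPolyTime (balanced A)
balanced-census A = Compile.tm p , proj₁ halting , λ n → powerWord (A []) n , halts n , value n
  where
  p = powerOfTwo (A [])
  halting : ∃[ c ] (∀ n → HaltsWith (Compile.tm p) (ones n) ((length (ones n) + c) ^ c) (powerWord (A []) n))
  halting = compiled-halts p ones (powerWord (A [])) (λ _ → replicate 3 []) (powerOfTwo-poly (A []))
  halts : ∀ n → HaltsWith (Compile.tm p) (ones n) ((n + proj₁ halting) ^ proj₁ halting) (powerWord (A []) n)
  halts n = subst (λ m → HaltsWith (Compile.tm p) (ones n) ((m + proj₁ halting) ^ proj₁ halting) (powerWord (A []) n))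
      (length-replicate n) (proj₂ halting n)
  value : ∀ n → binVal (powerWord (A []) n) ≡ census (balanced A) n
  value zero    = sym (+-identityʳ _)
  value (suc n) = trans (binVal-zeros n 1) (trans (+-identityʳ _) (sym (census-balanced A n)))

-- Comparison of binary numbers, least significant bit first

revVal : Str → ℕ
revVal []      = 0
revVal (b ∷ x) = 2 * revVal x + 𝟙 b

revVal-reverse : ∀ x a → revVal (x ʳ++ a) ≡ foldl (λ acc b → 2 * acc + 𝟙 b) (revVal a) x
revVal-reverse []      a = refl
revVal-reverse (b ∷ x) a = revVal-reverse x (b ∷ a)

bitVal : Sym → ℕ
bitVal nothing  = 0
bitVal (just b) = 𝟙 b

bitVal≤1 : ∀ s → bitVal s ≤ 1
bitVal≤1 nothing      = z≤n
bitVal≤1 (just true)  = ≤-refl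
bitVal≤1 (just false) = z≤n

revVal-split : ∀ x → revVal x ≡ 2 * revVal (tl x) + bitVal (pop₁ x)
revVal-split []      = refl
revVal-split (b ∷ x) = refl

≤ᵇ-cong : ∀ {m n m′ n′} → (m ≤ n → m′ ≤ n′) → (m′ ≤ n′ → m ≤ n) → (m ≤ᵇ n) ≡ (m′ ≤ᵇ n′)
≤ᵇ-cong {m} {n} {m′} {n′} f g with m ≤ᵇ n in e | m′ ≤ᵇ n′ in e′
... | true  | true  = refl
... | false | false = refl
... | true  | false with () ← subst T e′ (≤⇒≤ᵇ (f (≤ᵇ⇒≤ m n (subst T (sym e) tt))))
... | false | true  with () ← subst T e (≤⇒≤ᵇ (g (≤ᵇ⇒≤ m′ n′ (subst T (sym e′) tt))))

-- Half, rounded up, for arguments up to 4: two bits and a carry of at most 2 are added, and the new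
-- carry is again at most 2.
halve : ℕ → Fin 3
halve 0 = zero
halve 1 = suc zero
halve 2 = suc zero
halve _ = suc (suc zero)

halve-bounds : ∀ {a s} → a ≤ 1 → s ≤ 4 → let c = toℕ (halve (s ∸ a)) in s ≤ 2 * c + a × 2 * c + a ≤ suc s
halve-bounds {0} {0} _ _ = z≤n , z≤n
halve-bounds {0} {1} _ _ = s≤s z≤n , ≤-refl
halve-bounds {0} {2} _ _ = ≤-refl , n≤1+n _
halve-bounds {0} {3} _ _ = n≤1+n _ , ≤-refl
halve-bounds {0} {4} _ _ = ≤-refl , n≤1+n _
halve-bounds {1} {0} _ _ = z≤n , ≤-refl
halve-bounds {1} {1} _ _ = ≤-refl , n≤1+n _
halve-bounds {1} {2} _ _ = n≤1+n _ , ≤-refl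
halve-bounds {1} {3} _ _ = ≤-refl , n≤1+n _
halve-bounds {1} {4} _ _ = n≤1+n _ , ≤-refl
halve-bounds {suc (suc _)} (s≤s ()) _
halve-bounds {_} {suc (suc (suc (suc (suc _))))} _ (s≤s (s≤s (s≤s (s≤s ()))))

-- The bounds on `c` say that it is (s - a)/2 rounded up, and an integer exceeds a half-integral
-- bound exactly when it reaches the ceiling of that bound or equals it.
halve-≤ᵇ : ∀ {u v w a s} c → s ≤ 2 * c + a → 2 * c + a ≤ suc s → (v + w + c ≤ᵇ u) ≡ (2 * (v + w) + s ≤ᵇ 2 * u + a)
halve-≤ᵇ {u} {v} {w} {a} {s} c s≤ ≤s = ≤ᵇ-cong to from
  where
  open ≤-Reasoning
  to : v + w + c ≤ u → 2 * (v + w) + s ≤ 2 * u + a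
  to le = begin
    2 * (v + w) + s           ≤⟨ +-monoʳ-≤ (2 * (v + w)) s≤ ⟩
    2 * (v + w) + (2 * c + a) ≡⟨ lemma (v + w) c a ⟩
    2 * (v + w + c) + a       ≤⟨ +-monoˡ-≤ a (*-monoʳ-≤ 2 le) ⟩
    2 * u + a                 ∎
    where
    lemma : ∀ x c a → 2 * x + (2 * c + a) ≡ 2 * (x + c) + a
    lemma = solve-∀
  from : 2 * (v + w) + s ≤ 2 * u + a → v + w + c ≤ u
  from le = ≮⇒≥ λ u< → <-irrefl refl (begin
    suc (suc (2 * u + a))         ≡⟨ lemma₁ u a ⟩
    2 * suc u + a                 ≤⟨ +-monoˡ-≤ a (*-monoʳ-≤ 2 u<) ⟩
    2 * (v + w + c) + a           ≡⟨ lemma₂ (v + w) c a ⟩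
    2 * (v + w) + (2 * c + a)     ≤⟨ +-monoʳ-≤ (2 * (v + w)) ≤s ⟩
    2 * (v + w) + suc s           ≡⟨ +-suc _ s ⟩
    suc (2 * (v + w) + s)         ≤⟨ s≤s le ⟩
    suc (2 * u + a)               ∎)
    where
    lemma₁ : ∀ u a → suc (suc (2 * u + a)) ≡ 2 * suc u + a
    lemma₁ = solve-∀
    lemma₂ : ∀ x c a → 2 * (x + c) + a ≡ 2 * x + (2 * c + a)
    lemma₂ = solve-∀

isZero : Fin 3 → Bool
isZero zero    = true
isZero (suc _) = false

-- The state c claims that the unread part u must be at least v + w + c.
next : Fin 3 → Sym → Sym → Sym → Fin 3 ⊎ Sym
next c nothing nothing nothing = inj₂ (just (isZero c))
next c a       b       w       = inj₁ (halve (bitVal b + bitVal w + toℕ c ∸ bitVal a))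

next-view : ∀ c a b w → (a ≡ nothing × b ≡ nothing × w ≡ nothing) ⊎ next c a b w ≡ inj₁
    (halve (bitVal b + bitVal w + toℕ c ∸ bitVal a))
next-view c (just _) b        w        = inj₂ refl
next-view c nothing  (just _) w        = inj₂ refl
next-view c nothing  nothing  (just _) = inj₂ refl
next-view c nothing  nothing  nothing  = inj₁ (refl , refl , refl)

comparing : SM 10
comparing .SM.Q      = Fin 3
comparing .SM.finite = Fin-finite 3
comparing .SM.start  = zero
comparing .SM.body c = pop S₉ λ a → pop S₈ λ b → pop S₇ λ w → ret (next c a b w)

operands : Str → Str → Str → Str → Env 10
operands rx u v w = [] ∷ [] ∷ [] ∷ [] ∷ rx ∷ [] ∷ [] ∷ w ∷ v ∷ u ∷ []

pop₁-nothing : ∀ x → pop₁ x ≡ nothing → x ≡ []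
pop₁-nothing [] _ = refl

tl-≤ : ∀ {n} (x : Str) → length x ≤ suc n → length (tl x) ≤ n
tl-≤ []      _       = z≤n
tl-≤ (_ ∷ x) (s≤s p) = p

toℕ≤2 : ∀ (c : Fin 3) → toℕ c ≤ 2
toℕ≤2 zero             = z≤n
toℕ≤2 (suc zero)       = s≤s z≤n
toℕ≤2 (suc (suc zero)) = ≤-refl

-- An exhausted stack counts as leading zeros. The exit comes once all three are empty, where the
-- remaining claim is that 0 is at least the carry.
comparing-run : ∀ n c rx u v w → length u ≤ n → length v ≤ n → length w ≤ n →
  supersteps comparing (suc n) (inj₁ c , operands rx u v w) ≡ (inj₂ (just (revVal v + revVal w + toℕ c ≤ᵇ revVal u)) ,
      operands rx [] [] [])
comparing-run n c rx u v w u≤ v≤ w≤ with next-view c (pop₁ u) (pop₁ v) (pop₁ w)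
... | inj₁ (eu , ev , ew) rewrite pop₁-nothing u eu | pop₁-nothing v ev | pop₁-nothing w ew =
  trans (supersteps-exit comparing n) (cong (λ r → inj₂ (just r) , operands rx [] [] []) (zero-case c))
  where
  zero-case : ∀ (c : Fin 3) → isZero c ≡ (toℕ c ≤ᵇ 0)
  zero-case zero    = refl
  zero-case (suc _) = refl
comparing-run zero c rx [] [] [] u≤ v≤ w≤ | inj₂ ()
comparing-run (suc n) c rx u v w u≤ v≤ w≤ | inj₂ e rewrite e =
  trans (comparing-run n c′ rx (tl u) (tl v) (tl w) (tl-≤ u u≤) (tl-≤ v v≤) (tl-≤ w w≤))
    (cong (λ r → inj₂ (just r) , operands rx [] [] []) eq)
  where
  s = bitVal (pop₁ v) + bitVal (pop₁ w) + toℕ c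
  c′ = halve (s ∸ bitVal (pop₁ u))
  bounds = halve-bounds (bitVal≤1 (pop₁ u)) (+-mono-≤ (+-mono-≤ (bitVal≤1 (pop₁ v)) (bitVal≤1 (pop₁ w))) (toℕ≤2 c))
  lemma : ∀ x y a b c → 2 * (x + y) + (a + b + c) ≡ (2 * x + a) + (2 * y + b) + c
  lemma = solve-∀
  eq : (revVal (tl v) + revVal (tl w) + toℕ c′ ≤ᵇ revVal (tl u)) ≡ (revVal v + revVal w + toℕ c ≤ᵇ revVal u)
  eq = trans (halve-≤ᵇ {revVal (tl u)} {revVal (tl v)} {revVal (tl w)} (toℕ c′) (proj₁ bounds) (proj₂ bounds))
         (cong₂ _≤ᵇ_ (trans (lemma (revVal (tl v)) (revVal (tl w)) (bitVal (pop₁ v)) (bitVal (pop₁ w)) (toℕ c))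
                            (cong (_+ toℕ c) (sym (cong₂ _+_ (revVal-split v) (revVal-split w)))))
                     (sym (revVal-split u)))

-- Evaluation of a polynomial in unary

unary : Str → Str → ℕ → ℕ → ℕ → Env 10
unary t s u v w = [] ∷ [] ∷ [] ∷ t ∷ s ∷ ones u ∷ ones v ∷ ones w ∷ [] ∷ [] ∷ []

-- One round of repeated addition: a bit of the word on `S₄` serves as a counter, and the unary
-- number on `S₅` is added to `S₇`, with `S₆` as the buffer from which it is restored.
multiplying₁ : SM 10
multiplying₁ = bind (straight (pop S₄ λ { nothing → ret (just true) ; (just b) → push S₃ b (ret nothing) })) λ
  { nothing  → each S₅ (λ _ → (S₆ , true) ∷ (S₇ , true) ∷ []) ⨾ each S₆ (λ _ → (S₅ , true) ∷ [])
  ; (just b) → straight (ret (just b)) }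

foldl-suc : ∀ u v → foldl (λ v _ → suc v) v (ones u) ≡ u + v
foldl-suc zero    v = refl
foldl-suc (suc u) v = trans (foldl-suc u (suc v)) (+-suc u v)

each-ones : ∀ {k} (i : Fin k) f (ctx : Str → ℕ → Env k) →
            (∀ v → superstep (each i f) (inj₁ tt , ctx [] v) ≡ (inj₂ nothing , ctx [] v)) →
            (∀ b x v → superstep (each i f) (inj₁ tt , ctx (b ∷ x) v) ≡ (inj₁ tt , ctx x (suc v))) →
            ∀ u v → Exits (each i f) (suc u) (ctx (ones u) v) nothing (ctx [] (u + v))
each-ones i f ctx e₀ e₁ u v =
  subst₂ (λ n w → Exits (each i f) (suc n) (ctx (ones u) v) nothing (ctx [] w)) (length-replicate u) (foldl-suc u v)
    (each-exits i f ctx (λ v _ → suc v) e₀ e₁ (ones u) v)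

multiplying₁-again : ∀ b t s u w → Exits multiplying₁ (1 + (suc u + suc (u + 0))) (unary t (b ∷ s) u 0 w) nothing
    (unary (b ∷ t) s u 0 (u + w))
multiplying₁-again b t s u w = bind-exits _ _ {n = 1} (exits refl) (bind-exits _ _ {n = suc u}
    (each-ones S₅ _ (λ x v → [] ∷ [] ∷ [] ∷ (b ∷ t) ∷ s ∷ x ∷ ones v ∷ ones (v + w) ∷ [] ∷ [] ∷ []) (λ _ → refl)
        (λ _ _ _ → refl) u 0)
    (Exits-cong last
      (each-ones S₆ _ (λ x v → [] ∷ [] ∷ [] ∷ (b ∷ t) ∷ s ∷ ones v ∷ x ∷ ones (u + 0 + w) ∷ [] ∷ [] ∷ []) (λ _ → refl)
          (λ _ _ _ → refl) (u + 0) 0)))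
  where
  unary⁻ : ℕ → ℕ → ℕ → Env 10
  unary⁻ = unary (b ∷ t) s
  last : unary⁻ (u + 0 + 0) 0 (u + 0 + w) ≡ unary⁻ u 0 (u + w)
  last rewrite +-identityʳ u | +-identityʳ u = refl

multiplying-exits : ∀ s t u w → Exits (loop multiplying₁) (length s * (u * 2 + 3) + 2) (unary t s u 0 w) (just true)
    (unary (s ʳ++ t) [] u 0 (length s * u + w))
multiplying-exits []      t u w = loop-exit multiplying₁ (bind-exits _ _ {n = 1} (exits refl) (exits {n = 1} refl))
multiplying-exits (b ∷ s) t u w = subst₂ (λ n w′ → Exits (loop multiplying₁) n (unary t (b ∷ s) u 0 w) (just true)
    (unary (s ʳ++ (b ∷ t)) [] u 0 w′))
    (time u (length s)) (total (length s) u w)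
    (loop-again multiplying₁ (multiplying₁-again b t s u w) (multiplying-exits s (b ∷ t) u (u + w)))
  where
  time : ∀ u n → 1 + (suc u + suc (u + 0)) + (n * (u * 2 + 3) + 2) ≡ suc n * (u * 2 + 3) + 2
  time = solve-∀
  total : ∀ n u w → n * u + (u + w) ≡ suc n * u + w
  total = solve-∀

polynomialEnv : Str → ℕ → Env 10
polynomialEnv x u = unary [] (x ʳ++ []) u 0 0

-- The step u ↦ a + |x|·u in unary. The word x is itself the counter; it passes to `S₃` during the
-- loop and returns to `S₄` afterwards.
horner : ℕ → SM 10
horner a = loop multiplying₁ ⨾ each S₅ (λ _ → []) ⨾ each S₇ (λ _ → (S₅ , true) ∷ []) ⨾ each S₃ (moveTo S₄) ⨾ write
    (List.replicate a (S₅ , true))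

each-ones-poly : ∀ {k I sz} (i : Fin k) f (ctx : I → Str → ℕ → Env k) →
            (∀ j v → superstep (each i f) (inj₁ tt , ctx j [] v) ≡ (inj₂ nothing , ctx j [] v)) →
            (∀ j b x v → superstep (each i f) (inj₁ tt , ctx j (b ∷ x) v) ≡ (inj₁ tt , ctx j x (suc v))) →
            ∀ (u : I → ℕ) → PolyBounded sz u → PolyExits sz (each i f) (λ j → ctx j (ones (u j)) 0) (λ _ → nothing)
                (λ j → ctx j [] (u j))
each-ones-poly i f ctx e₀ e₁ u pu = polyExits _ (PB-suc pu) λ j →
  subst (λ n → Exits (each i f) (suc (u j)) (ctx j (ones (u j)) 0) nothing (ctx j [] n)) (+-identityʳ (u j))
      (each-ones i f (ctx j) (e₀ j) (e₁ j) (u j) 0)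

reverse-length : ∀ (x : Str) → length (x ʳ++ []) ≡ length x
reverse-length x = trans (length-ʳ++ x) (+-identityʳ _)

ones-poly : ∀ {I : Set} {sz u : I → ℕ} → PolyBounded sz u → PolyBounded sz (λ i → length (ones (u i)))
ones-poly pu = PB-≤ (λ i → ≤-reflexive (length-replicate _)) pu

horner-poly : ∀ a (u : Str → ℕ) → PolyBounded length u →
              PolyExits length (horner a) (λ x → polynomialEnv x (u x)) (λ _ → nothing)
                  (λ x → polynomialEnv x (a + length x * u x))
horner-poly a u pu =
  polyExits (λ x → length x * (u x * 2 + 3) + 2) (PB-+ (PB-* PB-size (PB-+ (PB-* pu (PB-const 2)) (PB-const 3)))
      (PB-const 2)) multiplied
  ⨾-poly each-poly S₅ (λ _ → []) (λ x s (_ : ⊤) → [] ∷ [] ∷ [] ∷ x ∷ [] ∷ s ∷ [] ∷ ones (length x * u x) ∷ [] ∷ [] ∷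
      []) (λ a _ → a) (λ _ _ → refl) (λ _ _ _ _ → refl)
         (λ x → ones (u x)) (λ _ → tt) (ones-poly pu)
  ⨾-poly each-ones-poly S₇ _ (λ x s v → [] ∷ [] ∷ [] ∷ x ∷ [] ∷ ones v ∷ [] ∷ s ∷ [] ∷ [] ∷ []) (λ _ _ → refl)
      (λ _ _ _ _ → refl)
         (λ x → length x * u x) (PB-* PB-size pu)
  ⨾-poly each-poly S₃ (moveTo S₄) (λ x t s → [] ∷ [] ∷ [] ∷ t ∷ s ∷ ones (length x * u x) ∷ [] ∷ [] ∷ [] ∷ [] ∷ [])
      (λ s b → b ∷ s) (λ _ _ → refl) (λ _ _ _ _ → refl)
         id (λ _ → []) PB-size
  ⨾-poly polyExits (λ _ → 1) (PB-const 1) (λ x → straight-exits _ (added a x (length x * u x)))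
  where
  multiplied : ∀ x → Exits (loop multiplying₁) (length x * (u x * 2 + 3) + 2) (polynomialEnv x (u x)) (just true)
      (unary x [] (u x) 0 (length x * u x))
  multiplied x = subst (λ n → Exits (loop multiplying₁) (n * (u x * 2 + 3) + 2) (polynomialEnv x (u x)) (just true)
      (unary x [] (u x) 0 (n * u x))) (reverse-length x)
    (Exits-cong (cong₂ (λ t n → unary t [] (u x) 0 n) (trans (reverse-twice x) (++-identityʳ x)) (+-identityʳ _))
      (multiplying-exits (x ʳ++ []) [] (u x) 0))
  added : ∀ a x u → exec {X = Sym} (pushes (List.replicate a (S₅ , true)) (ret nothing)) (polynomialEnv x u) ≡
      (nothing , polynomialEnv x (a + u))
  added zero    x u = refl
  added (suc a) x u = trans (added a x (suc u)) (cong (λ n → nothing , polynomialEnv x n) (+-suc a u))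

evaluating : Poly → SM 10
evaluating []       = straight (ret nothing)
evaluating (a ∷ cs) = evaluating cs ⨾ horner a

evalPoly-bounded : ∀ {I : Set} {sz : I → ℕ} p {f : I → ℕ} → PolyBounded sz f → PolyBounded sz (λ i → evalPoly p (f i))
evalPoly-bounded []       pf = PB-const 0
evalPoly-bounded (a ∷ cs) pf = PB-+ (PB-const a) (PB-* pf (evalPoly-bounded cs pf))

evaluating-poly : ∀ p → PolyExits length (evaluating p) (λ x → polynomialEnv x 0) (λ _ → nothing)
    (λ x → polynomialEnv x (evalPoly p (length x)))
evaluating-poly []       = straight-poly (ret nothing) (λ x → polynomialEnv x 0)
evaluating-poly (a ∷ cs) = evaluating-poly cs ⨾-poly horner-poly a (λ x → evalPoly cs (length x))
    (evalPoly-bounded cs PB-size)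

-- Deciding a PP language by two ranks

answer : ∀ {k} → Sym → SM (suc k)
answer nothing  = straight (ret nothing)
answer (just b) = write ((S₀ , b) ∷ [])

-- `upper` is built on `S₀` and `lower` on `S₈`. Their ranks end up on `S₉` and `S₈`, least
-- significant bit first as `comparing` needs them, because a single transfer reverses. The power of
-- two on `S₇` is made from the copy of the unary length kept on `S₆`.
thresholding : TM → Poly → SM 10
thresholding M p =
    each S₀ (moveTo S₄)
  ⨾ evaluating p
  ⨾ each S₅ (λ _ → (S₀ , true) ∷ (S₈ , true) ∷ (S₆ , true) ∷ [])
  ⨾ write ((S₀ , false) ∷ (S₀ , true) ∷ (S₀ , false) ∷ (S₈ , true) ∷ (S₈ , false) ∷ (S₈ , false) ∷ [])
  ⨾ each S₄ (λ b → (S₀ , b) ∷ (S₀ , b) ∷ (S₈ , b) ∷ (S₈ , b) ∷ [])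
  ⨾ call M
  ⨾ each S₀ (moveTo S₉)
  ⨾ each S₈ (moveTo S₃)
  ⨾ each S₃ (moveTo S₀)
  ⨾ call M
  ⨾ each S₀ (moveTo S₈)
  -- One unit is dropped before the rest becomes zeros, so there are `m ∸ 1` of them, also for m =
  -- 0.
  ⨾ straight (pop S₆ λ _ → push S₇ true (ret nothing))
  ⨾ each S₆ (λ _ → (S₇ , false) ∷ [])
  ⨾ bind comparing answer

foldl-double : ∀ x {d y} → foldl (λ d b → b ∷ b ∷ d) d (x ʳ++ y) ≡ foldl (λ d b → b ∷ b ∷ d) (double x ++ d) y
foldl-double []      = refl
foldl-double (a ∷ x) = foldl-double x

double-length : ∀ x → length (double x) ≡ length x * 2
double-length []      = refl
double-length (_ ∷ x) = cong (2 +_) (double-length x)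

revVal-power : ∀ n → revVal (List.replicate n false ++ true ∷ []) ≡ 2 ^ n
revVal-power zero    = refl
revVal-power (suc n) = trans (+-identityʳ _) (cong (2 *_) (revVal-power n))

reverse-revVal : ∀ x → revVal (x ʳ++ []) ≡ binVal x
reverse-revVal x = revVal-reverse x []

pred-length : ∀ m → length (tl (ones m)) ≡ m ∸ 1
pred-length zero    = refl
pred-length (suc m) = length-replicate m

module _ (M : TM) (c : ℕ) (p : Poly) (y : Str → Str) (h : ∀ z → HaltsWith M z ((length z + c) ^ c) (y z)) where

  private
    m : Str → ℕ
    m x = evalPoly p (length x)
    y₁ y₀ : Str → Str
    y₁ x = y (upper x (m x))
    y₀ x = y (lower x (m x))
    half : Str → Str
    half x = List.replicate (m x ∸ 1) false ++ true ∷ []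

    m-poly : PolyBounded length m
    m-poly = evalPoly-bounded p PB-size

    length-poly : ∀ (w : ℕ → Str) → (∀ n → length (w n) ≡ 3 + n) → PolyBounded length
        (λ x → length (double x ++ w (m x)))
    length-poly w e = PB-≤ (λ x → ≤-reflexive (trans (length-++ (double x)) (cong₂ _+_ (double-length x) (e (m x)))))
      (PB-+ (PB-* PB-size (PB-const 2)) (PB-+ (PB-const 3) m-poly))

    upper-poly : PolyBounded length (λ x → length (upper x (m x)))
    upper-poly = length-poly (λ n → false ∷ true ∷ false ∷ ones n) λ n → cong (3 +_) (length-replicate n)
    lower-poly : PolyBounded length (λ x → length (lower x (m x)))
    lower-poly = length-poly (λ n → false ∷ false ∷ true ∷ ones n) λ n → cong (3 +_) (length-replicate n)

    y₁-poly : PolyBounded length (length ∘ y₁)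
    y₁-poly = output-poly M c (λ x → upper x (m x)) y₁ (λ x → h (upper x (m x))) upper-poly
    y₀-poly : PolyBounded length (length ∘ y₀)
    y₀-poly = output-poly M c (λ x → lower x (m x)) y₀ (λ x → h (lower x (m x))) lower-poly

    reverse-poly : ∀ (w : Str → Str) → PolyBounded length (length ∘ w) → PolyBounded length
        (λ x → length (w x ʳ++ []))
    reverse-poly w = PB-≤ λ x → ≤-reflexive (reverse-length (w x))

    compared : Str → ℕ
    compared x = length (y₁ x) + (length (y₀ x) + suc (m x))

  -- The summand 0 is the initial carry of `comparing`.
  thresholding-poly : PolyExits length (thresholding M p) (λ x → x ∷ replicate 9 []) (λ _ → nothing)
    (λ x → ((binVal (y₀ x) + 2 ^ (m x ∸ 1) + 0 ≤ᵇ binVal (y₁ x)) ∷ []) ∷ replicate 9 [])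
  thresholding-poly =
           each-poly S₀ (moveTo S₄) (λ _ s v → s ∷ [] ∷ [] ∷ [] ∷ v ∷ [] ∷ [] ∷ [] ∷ [] ∷ [] ∷ []) (λ v b → b ∷ v)
               (λ _ _ → refl) (λ _ _ _ _ → refl)
             id (λ _ → []) PB-size
    ⨾-poly evaluating-poly p
    ⨾-poly each-ones-poly S₅ _ (λ x s v → ones v ∷ [] ∷ [] ∷ [] ∷ (x ʳ++ []) ∷ s ∷ ones v ∷ [] ∷ ones v ∷ [] ∷ [])
        (λ _ _ → refl) (λ _ _ _ _ → refl)
             m m-poly
    ⨾-poly straight-poly _ (λ x → ones (m x) ∷ [] ∷ [] ∷ [] ∷ (x ʳ++ []) ∷ [] ∷ ones (m x) ∷ [] ∷ ones (m x) ∷ [] ∷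
        [])
    ⨾-poly retarget doubled (each-poly S₄ _ (λ x s d → env₁ x s (d ++ false ∷ true ∷ false ∷ ones (m x))
        (d ++ false ∷ false ∷ true ∷ ones (m x)))
             (λ d b → b ∷ b ∷ d) (λ _ _ → refl) (λ _ _ _ _ → refl) (λ x → x ʳ++ []) (λ _ → [])
                 (reverse-poly id PB-size))
    ⨾-poly call-poly M c (λ x → upper x (m x)) y₁ (λ x → h (upper x (m x))) upper-poly
        (λ x → [] ∷ [] ∷ ones (m x) ∷ [] ∷ lower x (m x) ∷ [] ∷ [])
    ⨾-poly each-poly S₀ (moveTo S₉) (λ x s v → s ∷ [] ∷ [] ∷ [] ∷ [] ∷ [] ∷ ones (m x) ∷ [] ∷ lower x (m x) ∷ v ∷ [])
        (λ v b → b ∷ v) (λ _ _ → refl) (λ _ _ _ _ → refl)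
             y₁ (λ _ → []) y₁-poly
    ⨾-poly each-poly S₈ (moveTo S₃) (λ x s v → [] ∷ [] ∷ [] ∷ v ∷ [] ∷ [] ∷ ones (m x) ∷ [] ∷ s ∷ (y₁ x ʳ++ []) ∷ [])
        (λ v b → b ∷ v) (λ _ _ → refl) (λ _ _ _ _ → refl)
             (λ x → lower x (m x)) (λ _ → []) lower-poly
    ⨾-poly retarget (λ x → cong (λ w → w ∷ [] ∷ [] ∷ [] ∷ [] ∷ [] ∷ ones (m x) ∷ [] ∷ [] ∷ (y₁ x ʳ++ []) ∷ [])
        (trans (reverse-twice (lower x (m x))) (++-identityʳ _)))
           (each-poly S₃ (moveTo S₀) (λ x s v → v ∷ [] ∷ [] ∷ s ∷ [] ∷ [] ∷ ones (m x) ∷ [] ∷ [] ∷ (y₁ x ʳ++ []) ∷ [])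
               (λ v b → b ∷ v) (λ _ _ → refl) (λ _ _ _ _ → refl)
             (λ x → lower x (m x) ʳ++ []) (λ _ → []) (reverse-poly (λ x → lower x (m x)) lower-poly))
    ⨾-poly call-poly M c (λ x → lower x (m x)) y₀ (λ x → h (lower x (m x))) lower-poly
        (λ x → [] ∷ [] ∷ ones (m x) ∷ [] ∷ [] ∷ (y₁ x ʳ++ []) ∷ [])
    ⨾-poly each-poly S₀ (moveTo S₈) (λ x s v → s ∷ [] ∷ [] ∷ [] ∷ [] ∷ [] ∷ ones (m x) ∷ [] ∷ v ∷ (y₁ x ʳ++ []) ∷ [])
        (λ v b → b ∷ v) (λ _ _ → refl) (λ _ _ _ _ → refl)
             y₀ (λ _ → []) y₀-poly
    ⨾-poly straight-poly _ (λ x → [] ∷ [] ∷ [] ∷ [] ∷ [] ∷ [] ∷ ones (m x) ∷ [] ∷ (y₀ x ʳ++ []) ∷ (y₁ x ʳ++ []) ∷ [])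
    ⨾-poly retarget halved (each-poly S₆ _ (λ x s v → [] ∷ [] ∷ [] ∷ [] ∷ [] ∷ [] ∷ s ∷ v ∷ (y₀ x ʳ++ []) ∷
        (y₁ x ʳ++ []) ∷ []) (λ v _ → false ∷ v) (λ _ _ → refl) (λ _ _ _ _ → refl)
             (λ x → tl (ones (m x))) (λ _ → true ∷ [])
                 (PB-≤ (λ x → ≤-trans (≤-reflexive (pred-length (m x))) (m∸n≤m (m x) 1)) m-poly))
    ⨾-poly retarget valued (bind-poly {e = λ _ _ → nothing} {λ s _ → answered s}
             (polyExits (λ x → suc (compared x)) (PB-suc (PB-+ y₁-poly (PB-+ y₀-poly (PB-suc m-poly))))
               λ x → exits (comparing-run (compared x) zero [] (y₁ x ʳ++ []) (y₀ x ʳ++ []) (half x)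
                 (≤-trans (≤-reflexive (reverse-length (y₁ x))) (m≤m+n _ _))
                 (≤-trans (≤-reflexive (reverse-length (y₀ x))) (≤-trans (m≤m+n _ _) (m≤n+m _ (length (y₁ x)))))
                 (≤-trans (half-length x) (≤-trans (m≤n+m _ (length (y₀ x))) (m≤n+m _ (length (y₁ x)))))))
             (λ { nothing  → straight-poly (ret nothing) _
                ; (just b) → straight-poly (push S₀ b (ret nothing)) _ }))
    where
    env₁ : Str → Str → Str → Str → Env 10
    env₁ x s u v = u ∷ [] ∷ [] ∷ [] ∷ s ∷ [] ∷ ones (m x) ∷ [] ∷ v ∷ [] ∷ []
    doubled : ∀ x → let d = foldl (λ d b → b ∷ b ∷ d) [] (x ʳ++ []) in
              env₁ x [] (d ++ false ∷ true ∷ false ∷ ones (m x)) (d ++ false ∷ false ∷ true ∷ ones (m x)) ≡ env₁ x []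
                  (upper x (m x)) (lower x (m x))
    doubled x = cong (λ d → env₁ x [] (d ++ false ∷ true ∷ false ∷ ones (m x))
        (d ++ false ∷ false ∷ true ∷ ones (m x)))
      (trans (foldl-double x) (++-identityʳ (double x)))
    halved : ∀ x → _ ≡ operands [] (y₁ x ʳ++ []) (y₀ x ʳ++ []) (half x)
    halved x = cong (operands [] (y₁ x ʳ++ []) (y₀ x ʳ++ []))
      (trans (fill false (tl (ones (m x))) (true ∷ [])) (cong (λ n → List.replicate n false ++ true ∷ [])
          (pred-length (m x))))
    half-length : ∀ x → length (half x) ≤ suc (m x)
    half-length x = ≤-trans (≤-reflexive (trans (length-++ (List.replicate (m x ∸ 1) false))
        (trans (cong (_+ 1) (length-replicate (m x ∸ 1))) (+-comm _ 1)))) (s≤s (m∸n≤m (m x) 1))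
    answered : Sym → Env 10
    answered nothing  = operands [] [] [] []
    answered (just b) = (b ∷ []) ∷ replicate 9 []
    valued : ∀ x → answered (just (revVal (y₀ x ʳ++ []) + revVal (half x) + 0 ≤ᵇ revVal (y₁ x ʳ++ []))) ≡
                   ((binVal (y₀ x) + 2 ^ (m x ∸ 1) + 0 ≤ᵇ binVal (y₁ x)) ∷ []) ∷ replicate 9 []
    valued x rewrite reverse-revVal (y₁ x) | reverse-revVal (y₀ x) | revVal-power (m x ∸ 1) = refl

-- The number of witnesses is never computed: as the difference of the ranks of `upper` and `lower`,
-- it reaches the threshold exactly when the rank of `lower` plus the threshold is at most the rank
-- of `upper`.
balanced-rankable⇒InP : ∀ L A (p : Poly) →
  (∀ x → let m = evalPoly p (length x) ; k = count (λ y → A (pair x y)) (strings m) in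
         (L x ≡ true → 2 ^ (m ∸ 1) ≤ k) × (2 ^ (m ∸ 1) ≤ k → L x ≡ true)) →
  Rankable (balanced A) → InP L
balanced-rankable⇒InP L A p spec (M , c , h) = decides (thresholding M p) L (λ _ → replicate 9 [])
    (retarget (λ x → cong (λ b → (b ∷ []) ∷ replicate 9 []) (correct x))
      (thresholding-poly M c p (λ z → proj₁ (h z)) (λ z → proj₁ (proj₂ (h z)))))
  where
  module _ (x : Str) where
    m = evalPoly p (length x)
    k = count (λ y → A (pair x y)) (strings m)
    r₀ = rank (balanced A) (lower x m)
    difference : rank (balanced A) (upper x m) ≡ r₀ + k
    difference = trans (rank-difference (balanced A) x m) (cong (r₀ +_) (#-cong m (balanced-double A x)))
    L≡ : (2 ^ (m ∸ 1) ≤ᵇ k) ≡ L x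
    L≡ with 2 ^ (m ∸ 1) ≤ᵇ k in e | L x in e′
    ... | true  | true  = refl
    ... | false | false = refl
    ... | true  | false = trans (sym (proj₂ (spec x) (≤ᵇ⇒≤ _ k (subst T (sym e) tt)))) e′
    ... | false | true  with () ← subst T e (≤⇒≤ᵇ (proj₁ (spec x) e′))
    correct : (binVal (proj₁ (h (lower x m))) + 2 ^ (m ∸ 1) + 0 ≤ᵇ binVal (proj₁ (h (upper x m)))) ≡ L x
    correct rewrite proj₂ (proj₂ (h (lower x m))) | proj₂ (proj₂ (h (upper x m))) | difference | +-identityʳ
        (r₀ + 2 ^ (m ∸ 1)) =
      trans (≤ᵇ-cong (+-cancelˡ-≤ r₀ _ _) (+-monoʳ-≤ r₀)) L≡

rankable⇒InPP⊆InP : (∀ A → InP A → CensusPolyTime A → Rankable A) → ∀ L → InPP L → InP L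
rankable⇒InPP⊆InP hyp L (A , A∈P , p , spec) =
  balanced-rankable⇒InP L A p spec (hyp (balanced A) (balanced-InP A A∈P) (balanced-census A))

-- Counting the strings up to x by nondeterministic choices

-- A register holds nothing while the strings read so far agree, just true (just false) once the
-- first one is known to be smaller (larger).
refine : Sym → Bool → Bool → Sym
refine nothing  a b = if a xor b then just b else nothing
refine (just r) a b = just r

takeLike : Sym → Str → Str → Sym × Str
takeLike r []      w       = r , []
takeLike r (b ∷ x) []      = r , []
takeLike r (b ∷ x) (a ∷ w) = let (r′ , z) = takeLike (refine r a b) x w in r′ , a ∷ z

acceptable : Sym → Sym
acceptable (just false) = just false
acceptable _            = nothing

settle : Sym × Str → Sym × Str
settle (r , z) = acceptable r , z

-- Each zero shortens the string to be tested by one bit. It is then shorter than x and hence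
-- smaller, so the register starts as `just true`.
skipping : Str → Str → Sym × Str
skipping []      w           = just false , []
skipping (_ ∷ x) []          = just false , []
skipping (_ ∷ x) (false ∷ w) = skipping x w
skipping (_ ∷ x) (true ∷ w)  = settle (takeLike (just true) x w)

-- A nondeterministic choice 1y is accepted if prefix ≤ y; a choice 00ʲ1z…, where z has length |x| − j,
-- is accepted if z ≤ x and z ∈ A. The outcome nothing means that membership of z in A decides.
scan : Str → Str → Str → Sym × Str
scan x prefix []                  = just false , []
scan x prefix (true ∷ y)          = just (lexLeq prefix y) , []
scan x prefix (false ∷ [])        = just false , []
scan x prefix (false ∷ false ∷ w) = skipping x w
scan x prefix (false ∷ true ∷ w)  = settle (takeLike nothing x w)

verdict : Lang → Sym × Str → Bool
verdict A (nothing , z) = A z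
verdict A (just b  , z) = b

verify : Lang → Lang
verify A z = let (u , y) = unpair z ; (x , prefix) = unpair u in verdict A (scan x prefix y)

#-const : ∀ b n → # (λ _ → b) ⟨ n ⟩ ≡ 𝟙 b * 2 ^ n
#-const true  n = trans (#-true n) (sym (+-identityʳ _))
#-const false n = #-false n

takeCount : Lang → Sym → Str → ℕ
takeCount A nothing      x = lexRank A x
takeCount A (just true)  x = # A ⟨ length x ⟩
takeCount A (just false) x = 0

takeCount-∷ : ∀ A r b x → takeCount A r (b ∷ x) ≡ takeCount (A ∘ (false ∷_)) (refine r false b) x + takeCount
    (A ∘ (true ∷_)) (refine r true b) x
takeCount-∷ A nothing      false x = trans (lexRank-false A x) (sym (+-identityʳ _))
takeCount-∷ A nothing      true  x = lexRank-true A x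
takeCount-∷ A (just true)  b     x = #-suc A (length x)
takeCount-∷ A (just false) b     x = refl

-- The first |x| bits are the string to be tested and the other `d` are free, so each accepted
-- string is counted 2ᵈ times.
take-count : ∀ A r x d → # (λ w → verdict A (settle (takeLike r x w))) ⟨ length x + d ⟩ ≡ takeCount A r x * 2 ^ d
take-count A nothing      [] d = trans (#-const (A []) d) (cong (_* 2 ^ d) (sym (+-identityʳ (𝟙 (A [])))))
take-count A (just true)  [] d = trans (#-const (A []) d) (cong (_* 2 ^ d) (sym (+-identityʳ (𝟙 (A [])))))
take-count A (just false) [] d = #-const false d
take-count A r (b ∷ x) d = begin
  # f ⟨ suc (length x + d) ⟩                                                        ≡⟨ #-suc f (length x + d) ⟩
  # f ∘ (false ∷_) ⟨ length x + d ⟩ + # f ∘ (true ∷_) ⟨ length x + d ⟩              ≡⟨ cong₂ _+_ (half false)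
      (half true) ⟩
  t false * 2 ^ d + t true * 2 ^ d                                                  ≡⟨ *-distribʳ-+ (2 ^ d) (t false)
      (t true) ⟨
  (t false + t true) * 2 ^ d                                                        ≡⟨ cong (_* 2 ^ d)
      (takeCount-∷ A r b x) ⟨
  takeCount A r (b ∷ x) * 2 ^ d                                                     ∎
  where
  open ≡-Reasoning
  f = λ w → verdict A (settle (takeLike r (b ∷ x) w))
  t : Bool → ℕ
  t a = takeCount (A ∘ (a ∷_)) (refine r a b) x
  verdict-∷ : ∀ a r z → verdict A (settle (r , a ∷ z)) ≡ verdict (A ∘ (a ∷_)) (settle (r , z))
  verdict-∷ a nothing      z = refl
  verdict-∷ a (just true)  z = refl
  verdict-∷ a (just false) z = refl
  half : ∀ a → # f ∘ (a ∷_) ⟨ length x + d ⟩ ≡ t a * 2 ^ d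
  half a = trans (#-cong (length x + d) λ w → verdict-∷ a (proj₁ (takeLike (refine r a b) x w))
      (proj₂ (takeLike (refine r a b) x w))) (take-count (A ∘ (a ∷_)) (refine r a b) x d)

-- A string that is j + 1 bits shorter than x is preceded by 0ʲ1, so its code always takes |x| bits
-- and the padding is the same for all lengths.
skip-count : ∀ A x d → # (λ w → verdict A (skipping x w)) ⟨ length x + d ⟩ ≡ below A (length x) * 2 ^ d
skip-count A []      d = #-false d
skip-count A (b ∷ x) d = begin
  # f ⟨ suc (length x + d) ⟩                                             ≡⟨ #-suc f (length x + d) ⟩
  # f ∘ (false ∷_) ⟨ length x + d ⟩ + # f ∘ (true ∷_) ⟨ length x + d ⟩   ≡⟨ cong₂ _+_ (skip-count A x d)
      (take-count A (just true) x d) ⟩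
  below A (length x) * 2 ^ d + # A ⟨ length x ⟩ * 2 ^ d                  ≡⟨ *-distribʳ-+ (2 ^ d) (below A (length x))
      _ ⟨
  (below A (length x) + # A ⟨ length x ⟩) * 2 ^ d                        ≡⟨ cong (_* 2 ^ d) (count-upTo A (length x))
      ⟨
  below A (suc (length x)) * 2 ^ d                                       ∎
  where
  open ≡-Reasoning
  f = λ w → verdict A (skipping (b ∷ x) w)

rank-count : ∀ A x prefix d → # (λ y → verdict A (scan x prefix (false ∷ y))) ⟨ suc (length x + d) ⟩ ≡ rank A x * 2 ^
    d
rank-count A x prefix d = begin
  # f ⟨ suc (length x + d) ⟩                                             ≡⟨ #-suc f (length x + d) ⟩
  # f ∘ (false ∷_) ⟨ length x + d ⟩ + # f ∘ (true ∷_) ⟨ length x + d ⟩   ≡⟨ cong₂ _+_ (skip-count A x d)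
      (take-count A nothing x d) ⟩
  below A (length x) * 2 ^ d + lexRank A x * 2 ^ d                       ≡⟨ *-distribʳ-+ (2 ^ d) (below A (length x))
      _ ⟨
  (below A (length x) + lexRank A x) * 2 ^ d                             ≡⟨ cong (_* 2 ^ d) (rank-split A x) ⟨
  rank A x * 2 ^ d                                                       ∎
  where
  open ≡-Reasoning
  f = λ y → verdict A (scan x prefix (false ∷ y))

-- The binary value by recursion on the leading bit, the form that matches the induction in
-- `lex-count`.
val : Str → ℕ
val []      = 0
val (b ∷ x) = 𝟙 b * 2 ^ length x + val x

val-reverse : ∀ r x → val (r ʳ++ x) ≡ revVal r * 2 ^ length x + val x
val-reverse []      x = refl
val-reverse (b ∷ r) x = trans (val-reverse r (b ∷ x)) (lemma (revVal r) (𝟙 b) (2 ^ length x) (val x))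
  where
  lemma : ∀ r b p v → r * (2 * p) + (b * p + v) ≡ (2 * r + b) * p + v
  lemma = solve-∀

-- The strings that fail are those whose first |x| bits form a number below `val x`, followed by `d`
-- free bits. The sum avoids a subtraction.
lex-count : ∀ x d → # lexLeq x ⟨ length x + d ⟩ + val x * 2 ^ d ≡ 2 ^ (length x + d)
lex-count []          d = trans (+-identityʳ _) (#-true d)
lex-count (false ∷ x) d = begin
  # lexLeq (false ∷ x) ⟨ suc (length x + d) ⟩ + val x * 2 ^ d  ≡⟨ cong (_+ val x * 2 ^ d)
      (trans (#-suc (lexLeq (false ∷ x)) (length x + d)) (cong (c +_) (#-true (length x + d)))) ⟩
  c + p + val x * 2 ^ d    ≡⟨ lemma c p (val x * 2 ^ d) ⟩
  (c + val x * 2 ^ d) + p  ≡⟨ cong (_+ p) (lex-count x d) ⟩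
  p + p                    ≡⟨ cong (p +_) (+-identityʳ p) ⟨
  2 * p                    ∎
  where
  open ≡-Reasoning
  c = # lexLeq x ⟨ length x + d ⟩
  p = 2 ^ (length x + d)
  lemma : ∀ c p v → c + p + v ≡ (c + v) + p
  lemma = solve-∀
lex-count (true ∷ x) d = begin
  # lexLeq (true ∷ x) ⟨ suc (length x + d) ⟩ + (1 * q + val x) * 2 ^ d  ≡⟨ cong (_+ (1 * q + val x) * 2 ^ d)
      (trans (#-suc (lexLeq (true ∷ x)) (length x + d)) (cong (_+ c) (#-false (length x + d)))) ⟩
  c + (1 * q + val x) * 2 ^ d     ≡⟨ lemma c q (val x) (2 ^ d) ⟩
  (c + val x * 2 ^ d) + q * 2 ^ d ≡⟨ cong₂ _+_ (lex-count x d) (sym (^-distribˡ-+-* 2 (length x) d)) ⟩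
  p + p                           ≡⟨ cong (p +_) (+-identityʳ p) ⟨
  2 * p                           ∎
  where
  open ≡-Reasoning
  c = # lexLeq x ⟨ length x + d ⟩
  p = 2 ^ (length x + d)
  q = 2 ^ length x
  lemma : ∀ c q v e → c + (1 * q + v) * e ≡ (c + v * e) + q * e
  lemma = solve-∀

-- With n = |x| and j prefix bits a question has length 2n + j + 2. Choices of this length hold the
-- n + 2 bits that select a string and leave n + j bits of padding.
identity : Poly
identity = 0 ∷ 1 ∷ []

evalPoly-identity : ∀ n → evalPoly identity n ≡ n
evalPoly-identity n = trans (cong (λ z → n * suc z) (*-zeroʳ n)) (*-identityʳ n)

accepting : Lang → Str → ℕ
accepting A u = # (λ y → verify A (pair u y)) ⟨ evalPoly identity (length u) ⟩

-- Defined by the acceptance count itself, so that it is a PP language on all inputs, including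
-- those that code no question; `atLeast-rank` gives its meaning on questions.
atLeast : Lang → Lang
atLeast A u = 2 ^ (evalPoly identity (length u) ∸ 1) ≤ᵇ accepting A u

pair-length : ∀ x y → length (pair x y) ≡ suc (suc (length x * 2 + length y))
pair-length x y = trans (length-++ (double x)) (trans (cong (_+ suc (suc (length y))) (double-length x))
    (lemma (length x * 2) (length y)))
  where
  lemma : ∀ a b → a + suc (suc b) ≡ suc (suc (a + b))
  lemma = solve-∀

-- With n = |x|, j = |r| and n + 1 = j + i, the accepting choices number rank(x)·2ⁿ⁺ʲ + 2ʰ − val(r)·2ⁿ⁺ʲ⁺ⁱ out of 2ʰ⁺¹.
atLeast-rank : ∀ A x r i → length r + i ≡ suc (length x) → atLeast A (pair x (r ʳ++ [])) ≡
    (revVal r * 2 ^ i ≤ᵇ rank A x)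
atLeast-rank A x r i eq
  rewrite evalPoly-identity (length (pair x (r ʳ++ []))) | pair-length x (r ʳ++ []) | reverse-length r =
  trans (cong (2 ^ suc (n * 2 + j) ≤ᵇ_) total) (≤ᵇ-cong to from)
  where
  open ≡-Reasoning
  n = length x
  j = length r
  pre = r ʳ++ []
  v = revVal r
  c = # lexLeq pre ⟨ j + (n + j + i) ⟩
  h = suc (n * 2 + j)
  -- The `h` bits after the first one are split in two ways: n + 1 bits of code and n + j of padding
  -- if a string is tested, j bits for the comparison and n + j + i free ones if the prefix is.
  h≡ : h ≡ suc (n + (n + j))
  h≡ = cong suc (trans (cong (_+ j) (*-comm n 2)) (trans (cong (λ m → n + m + j) (+-identityʳ n)) (+-assoc n n j)))
  h≡′ : h ≡ j + (n + j + i)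
  h≡′ = trans h≡ (trans (sym (+-comm (n + j) (suc n))) (trans (cong (n + j +_) (sym eq)) (swap (n + j) j i)))
    where
    swap : ∀ m j i → m + (j + i) ≡ j + (m + i)
    swap = solve-∀
  verify-pair : ∀ y → verify A (pair (pair x pre) y) ≡ verdict A (scan x pre y)
  verify-pair y rewrite unpair-pair (pair x pre) y | unpair-pair x pre = refl
  total : # (λ y → verify A (pair (pair x pre) y)) ⟨ suc h ⟩ ≡ rank A x * 2 ^ (n + j) + c
  total = begin
    # (λ y → verify A (pair (pair x pre) y)) ⟨ suc h ⟩ ≡⟨ #-cong (suc h) verify-pair ⟩
    # (λ y → verdict A (scan x pre y)) ⟨ suc h ⟩       ≡⟨ #-suc (λ y → verdict A (scan x pre y)) h ⟩
    # (λ y → verdict A (scan x pre (false ∷ y))) ⟨ h ⟩ + # lexLeq pre ⟨ h ⟩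
      ≡⟨ cong₂ _+_ (trans (cong (λ h → # (λ y → verdict A (scan x pre (false ∷ y))) ⟨ h ⟩) h≡)
          (rank-count A x pre (n + j)))
                   (cong (λ h → # lexLeq pre ⟨ h ⟩) h≡′) ⟩
    rank A x * 2 ^ (n + j) + c                         ∎
  complement : 2 ^ h ≡ v * 2 ^ i * 2 ^ (n + j) + c
  complement = begin
    2 ^ h                                     ≡⟨ cong (2 ^_) h≡′ ⟩
    2 ^ (j + (n + j + i))                     ≡⟨ cong (λ l → 2 ^ (l + (n + j + i))) (reverse-length r) ⟨
    2 ^ (length pre + (n + j + i))            ≡⟨ lex-count pre (n + j + i) ⟨
    # lexLeq pre ⟨ length pre + (n + j + i) ⟩ + val pre * 2 ^ (n + j + i)
      ≡⟨ cong₂ (λ l w → # lexLeq pre ⟨ l + (n + j + i) ⟩ + w * 2 ^ (n + j + i)) (reverse-length r)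
               (trans (val-reverse r []) (trans (+-identityʳ _) (*-identityʳ v))) ⟩
    c + v * 2 ^ (n + j + i)                   ≡⟨ cong (λ q → c + v * q) (^-distribˡ-+-* 2 (n + j) i) ⟩
    c + v * (2 ^ (n + j) * 2 ^ i)             ≡⟨ lemma c v (2 ^ (n + j)) (2 ^ i) ⟩
    v * 2 ^ i * 2 ^ (n + j) + c               ∎
    where
    lemma : ∀ c v p q → c + v * (p * q) ≡ v * q * p + c
    lemma = solve-∀
  nz : NonZero (2 ^ (n + j))
  nz = m^n≢0 2 (n + j)
  to : 2 ^ h ≤ rank A x * 2 ^ (n + j) + c → v * 2 ^ i ≤ rank A x
  to le = *-cancelʳ-≤ _ _ (2 ^ (n + j)) ⦃ nz ⦄
      (+-cancelʳ-≤ c _ _ (subst (_≤ rank A x * 2 ^ (n + j) + c) complement le))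
  from : v * 2 ^ i ≤ rank A x → 2 ^ h ≤ rank A x * 2 ^ (n + j) + c
  from le = subst (_≤ rank A x * 2 ^ (n + j) + c) (sym complement) (+-monoˡ-≤ c (*-monoˡ-≤ (2 ^ (n + j)) le))

below-< : ∀ A n → below A n < 2 ^ n
below-< A zero    = s≤s z≤n
below-< A (suc n) rewrite count-upTo A n | +-identityʳ (2 ^ n) = +-mono-<-≤ (below-< A n) (#-≤ A n)

-- Only 2ⁿ⁺¹ - 1 strings have length at most n, so the rank fits into n + 1 bits, one for each round
-- of the search.
rank-< : ∀ A x → rank A x < 2 ^ suc (length x)
rank-< A x rewrite rank-split A x | +-identityʳ (2 ^ length x) = +-mono-<-≤ (below-< A (length x)) (#-≤ _ (length x))

-- The verifier runs in polynomial time

data ScanState : Set where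
  choose compare place skip : ScanState
  take                      : Sym → ScanState

ScanState-finite : Finite ScanState
ScanState-finite = image-finite (⊎-finite (Fin-finite 4) Sym-finite) f onto
  where
  f : Fin 4 ⊎ Sym → ScanState
  f (inj₁ zero)                   = choose
  f (inj₁ (suc zero))             = compare
  f (inj₁ (suc (suc zero)))       = place
  f (inj₁ (suc (suc (suc zero)))) = skip
  f (inj₂ r)                      = take r
  onto : ∀ b → ∃[ a ] f a ≡ b
  onto choose   = inj₁ zero , refl
  onto compare  = inj₁ (suc zero) , refl
  onto place    = inj₁ (suc (suc zero)) , refl
  onto skip     = inj₁ (suc (suc (suc zero))) , refl
  onto (take r) = inj₂ r , refl

private
  goto : ScanState → Tree 7 (ScanState ⊎ Sym)
  goto q = ret (inj₁ q)
  exit : Sym → Tree 7 (ScanState ⊎ Sym)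
  exit s = ret (inj₂ s)

-- The choice is on S₀, the prefix on S₅, x on S₆; the string to be tested goes to S₃.
scanning : SM 7
scanning .SM.Q      = ScanState
scanning .SM.finite = ScanState-finite
scanning .SM.start  = choose
scanning .SM.body choose   = pop S₀ λ { nothing → exit (just false) ; (just true) → goto compare ; (just false) → goto
    place }
scanning .SM.body compare  = pop S₅ λ
  { nothing  → exit (just true)
  ; (just p) → pop S₀ λ { nothing → exit (just false) ; (just a) → if p xor a then exit (just (not p)) else goto
      compare } }
scanning .SM.body place    = pop S₀ λ { nothing → exit (just false) ; (just true) → goto (take nothing) ; (just false)
    → goto skip }
scanning .SM.body skip     = pop S₆ λ
  { nothing  → exit (just false)
  ; (just _) → pop S₀ λ { nothing → exit (just false) ; (just true) → goto (take (just true)) ; (just false) → goto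
      skip } }
scanning .SM.body (take r) = pop S₆ λ
  { nothing  → exit (acceptable r)
  ; (just b) → pop S₀ λ { nothing → exit (acceptable r) ; (just a) → push S₃ a (goto (take (refine r a b))) } }

scanEnv : Str → Str → Str → Str → Env 7
scanEnv y t prefix x = y ∷ [] ∷ [] ∷ t ∷ [] ∷ prefix ∷ x ∷ []

-- A scan may stop early, so what it leaves behind is existential. `y′` will be cleared and `t′`
-- moved, hence their length bounds; `prefix′` and `x′` just stay where they are.
record Scanned (n : ℕ) (q : ScanState) (σ : Env 7) (t : Str) (o : Sym × Str) : Set where
  constructor scanned
  field
    y′ t′ prefix′ x′ : Str
    y′≤     : length y′ ≤ n
    t′≤     : length t′ ≤ length t + n
    t′-≡    : t′ ʳ++ [] ≡ t ʳ++ proj₂ o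
    reaches : supersteps scanning (suc n) (inj₁ q , σ) ≡ (inj₂ (proj₁ o) , scanEnv y′ t′ prefix′ x′)

exited : ∀ n {e σ} → supersteps scanning n (inj₂ e , σ) ≡ (inj₂ e , σ)
exited n = supersteps-exit scanning n

later : ∀ {n q σ o} q₀ σ₀ → superstep scanning (inj₁ q₀ , σ₀) ≡ (inj₁ q , σ) → Scanned n q σ [] o → Scanned (suc n) q₀
    σ₀ [] o
later {n} q₀ σ₀ eq₀ (scanned y′ t′ p′ x′ y′≤ t′≤ eq run) =
  scanned y′ t′ p′ x′ (m≤n⇒m≤1+n y′≤) (m≤n⇒m≤1+n t′≤) eq (trans (cong (supersteps scanning (suc n)) eq₀) run)

compare-run : ∀ x prefix y → Scanned (length y) compare (scanEnv y [] prefix x) [] (just (lexLeq prefix y) , [])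
compare-run x []           y       = scanned y [] [] x ≤-refl z≤n refl (exited (length y))
compare-run x (p ∷ prefix) []      = scanned [] [] prefix x z≤n z≤n refl refl
compare-run x (true ∷ prefix)  (true ∷ y)  = later _ _ refl (compare-run x prefix y)
compare-run x (false ∷ prefix) (false ∷ y) = later _ _ refl (compare-run x prefix y)
compare-run x (true ∷ prefix)  (false ∷ y) = scanned y [] prefix x (n≤1+n _) z≤n refl (exited (suc (length y)))
compare-run x (false ∷ prefix) (true ∷ y)  = scanned y [] prefix x (n≤1+n _) z≤n refl (exited (suc (length y)))

take-run : ∀ r x t prefix y → Scanned (length y) (take r) (scanEnv y t prefix x) t (settle (takeLike r x y))
take-run r []      t prefix y       = scanned y t prefix [] ≤-refl (m≤m+n _ _) refl (exited (length y))
take-run r (b ∷ x) t prefix []      = scanned [] t prefix x z≤n (m≤m+n _ _) refl refl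
take-run r (b ∷ x) t prefix (a ∷ y) with take-run (refine r a b) x (a ∷ t) prefix y
... | scanned y′ t′ p′ x′ y′≤ t′≤ eq run =
  scanned y′ t′ p′ x′ (m≤n⇒m≤1+n y′≤) (≤-trans t′≤ (≤-reflexive (sym (+-suc (length t) (length y))))) eq run

skip-run : ∀ x prefix y → Scanned (length y) skip (scanEnv y [] prefix x) [] (skipping x y)
skip-run []      prefix y           = scanned y [] prefix [] ≤-refl z≤n refl (exited (length y))
skip-run (_ ∷ x) prefix []          = scanned [] [] prefix x z≤n z≤n refl refl
skip-run (_ ∷ x) prefix (true ∷ y)  with take-run (just true) x [] prefix y
... | scanned y′ t′ p′ x′ y′≤ t′≤ eq run = scanned y′ t′ p′ x′ (m≤n⇒m≤1+n y′≤) (m≤n⇒m≤1+n t′≤) eq run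
skip-run (_ ∷ x) prefix (false ∷ y) with skip-run x prefix y
... | scanned y′ t′ p′ x′ y′≤ t′≤ eq run = scanned y′ t′ p′ x′ (m≤n⇒m≤1+n y′≤) (m≤n⇒m≤1+n t′≤) eq run

scan-run : ∀ x prefix y → Scanned (length y) choose (scanEnv y [] prefix x) [] (scan x prefix y)
scan-run x prefix []                  = scanned [] [] prefix x z≤n z≤n refl refl
scan-run x prefix (true ∷ y)          = later _ _ refl (compare-run x prefix y)
scan-run x prefix (false ∷ [])        = scanned [] [] prefix x z≤n z≤n refl refl
scan-run x prefix (false ∷ false ∷ y) = later _ _ refl (later _ _ refl (skip-run x prefix y))
scan-run x prefix (false ∷ true ∷ y)  = later _ _ refl (later _ _ refl (take-run nothing x [] prefix y))

finishing : TM → Sym → SM 7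
finishing M nothing  = each S₃ (moveTo S₀) ⨾ call M
finishing M (just b) = write ((S₀ , b) ∷ [])

verifying : TM → SM 7
verifying M = unpairing S₀ S₄ ⨾ each S₄ (moveTo S₅) ⨾ unpairing S₅ S₄ ⨾ each S₄ (moveTo S₆)
            ⨾ bind scanning λ s → each S₀ (λ _ → []) ⨾ finishing M s

module _ (A : Lang) (M : TM) (c : ℕ) (h : ∀ x → HaltsWith M x ((length x + c) ^ c) (A x ∷ [])) where

  private
    u y x prefix z t p′ x′ : Str → Str
    u w = proj₁ (unpair w)
    y w = proj₂ (unpair w)
    x w = proj₁ (unpair (u w))
    prefix w = proj₂ (unpair (u w))
    z w = proj₂ (scan (x w) (prefix w) (y w))

    scanned-choice : ∀ w → Scanned (length (y w)) choose (scanEnv (y w) [] (prefix w) (x w)) []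
        (scan (x w) (prefix w) (y w))
    scanned-choice w = scan-run (x w) (prefix w) (y w)

    t w  = Scanned.t′ (scanned-choice w)
    p′ w = Scanned.prefix′ (scanned-choice w)
    x′ w = Scanned.x′ (scanned-choice w)

    u-poly : PolyBounded length (length ∘ u)
    u-poly = PB-≤ (proj₁ ∘ unpair-length) PB-size
    y-poly : PolyBounded length (length ∘ y)
    y-poly = PB-≤ (proj₂ ∘ unpair-length) PB-size
    x-poly : PolyBounded length (length ∘ x)
    x-poly = PB-≤ (proj₁ ∘ unpair-length ∘ u) u-poly
    t-poly : PolyBounded length (length ∘ t)
    t-poly = PB-≤ (λ w → Scanned.t′≤ (scanned-choice w)) y-poly
    z-poly : PolyBounded length (length ∘ z)
    z-poly = PB-≤ (λ w → ≤-reflexive (trans (cong length (sym (Scanned.t′-≡ (scanned-choice w))))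
        (reverse-length (t w)))) t-poly

    -- Both clauses are defined for every `w`, as `bind-poly` requires; `outcome` selects the one
    -- that is run.
    final : Sym → Str → Env 7
    final nothing  w = (A (z w) ∷ []) ∷ [] ∷ [] ∷ [] ∷ [] ∷ p′ w ∷ x′ w ∷ []
    final (just b) w = (b ∷ []) ∷ [] ∷ [] ∷ t w ∷ [] ∷ p′ w ∷ x′ w ∷ []

    outcome : Str → Sym
    outcome w = proj₁ (scan (x w) (prefix w) (y w))

    finishing-poly : ∀ s → PolyExits length (finishing M s) (λ w → scanEnv [] (t w) (p′ w) (x′ w)) (λ _ → nothing)
        (final s)
    finishing-poly nothing =
      retarget (λ w → cong (λ v → v ∷ [] ∷ [] ∷ [] ∷ [] ∷ p′ w ∷ x′ w ∷ []) (Scanned.t′-≡ (scanned-choice w)))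
        (each-poly S₃ (moveTo S₀) (λ w s v → v ∷ [] ∷ [] ∷ s ∷ [] ∷ p′ w ∷ x′ w ∷ []) (λ v b → b ∷ v) (λ _ _ → refl)
            (λ _ _ _ _ → refl)
          t (λ _ → []) t-poly)
      ⨾-poly call-poly M c z (λ w → A (z w) ∷ []) (λ w → h (z w)) z-poly (λ w → [] ∷ p′ w ∷ x′ w ∷ [])
    finishing-poly (just b) = straight-poly (push S₀ b (ret nothing)) (λ w → scanEnv [] (t w) (p′ w) (x′ w))

  verifying-poly : PolyExits length (verifying M) (λ w → w ∷ replicate 6 []) (λ _ → nothing)
      (λ w → (verify A w ∷ []) ∷ tail (final (outcome w) w))
  verifying-poly =
           polyExits (λ w → suc (length w)) (PB-suc PB-size)
               (λ w → unpairing-exits S₀ S₄ (λ s v → s ∷ [] ∷ [] ∷ [] ∷ v ∷ [] ∷ [] ∷ [])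
             (λ _ → refl) (λ _ _ → refl) (λ { true true z u → refl ; true false z u → refl ; false true z u → refl ;
                 false false z u → refl }) w [])
    ⨾-poly retarget (λ w → cong (λ v → y w ∷ [] ∷ [] ∷ [] ∷ [] ∷ v ∷ [] ∷ [])
        (trans (reverse-twice (u w)) (++-identityʳ (u w))))
           (each-poly S₄ (moveTo S₅) (λ w s v → y w ∷ [] ∷ [] ∷ [] ∷ s ∷ v ∷ [] ∷ []) (λ v b → b ∷ v) (λ _ _ → refl)
               (λ _ _ _ _ → refl)
             (λ w → u w ʳ++ []) (λ _ → []) (PB-≤ (λ w → ≤-reflexive (reverse-length (u w))) u-poly))
    ⨾-poly polyExits (λ w → suc (length (u w))) (PB-suc u-poly)
        (λ w → unpairing-exits S₅ S₄ (λ s v → y w ∷ [] ∷ [] ∷ [] ∷ v ∷ s ∷ [] ∷ [])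
             (λ _ → refl) (λ _ _ → refl) (λ { true true z u → refl ; true false z u → refl ; false true z u → refl ;
                 false false z u → refl }) (u w) [])
    ⨾-poly retarget (λ w → cong (λ v → y w ∷ [] ∷ [] ∷ [] ∷ [] ∷ prefix w ∷ v ∷ [])
        (trans (reverse-twice (x w)) (++-identityʳ (x w))))
           (each-poly S₄ (moveTo S₆) (λ w s v → y w ∷ [] ∷ [] ∷ [] ∷ s ∷ prefix w ∷ v ∷ []) (λ v b → b ∷ v)
               (λ _ _ → refl) (λ _ _ _ _ → refl)
             (λ w → x w ʳ++ []) (λ _ → []) (PB-≤ (λ w → ≤-reflexive (reverse-length (x w))) x-poly))
    ⨾-poly retarget (λ w → decided (outcome w) w) (bind-poly {e = λ _ _ → nothing} {final}
             (polyExits (λ w → suc (length (y w))) (PB-suc y-poly) λ w → exits (Scanned.reaches (scanned-choice w)))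
             λ s → each-poly S₀ (λ _ → []) (λ w s (_ : ⊤) → scanEnv s (t w) (p′ w) (x′ w)) (λ v _ → v) (λ _ _ → refl)
                 (λ _ _ _ _ → refl)
                     (λ w → Scanned.y′ (scanned-choice w)) (λ _ → tt) (PB-≤ (λ w → Scanned.y′≤ (scanned-choice w))
                         y-poly)
                   ⨾-poly finishing-poly s)
    where
    decided : ∀ s w → final s w ≡ (verdict A (s , z w) ∷ []) ∷ tail (final s w)
    decided nothing  w = refl
    decided (just b) w = refl

verify-InP : ∀ A → InP A → InP (verify A)
verify-InP A (M , c , h) = decides (verifying M) (verify A) _ (verifying-poly A M c h)

atLeast-InPP : ∀ A → InP A → InPP (atLeast A)
atLeast-InPP A A∈P = verify A , verify-InP A A∈P , identity , λ u → to u , from u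
  where
  to : ∀ u → atLeast A u ≡ true → 2 ^ (evalPoly identity (length u) ∸ 1) ≤ accepting A u
  to u e = ≤ᵇ⇒≤ _ _ (subst T (sym e) tt)
  from : ∀ u → 2 ^ (evalPoly identity (length u) ∸ 1) ≤ accepting A u → atLeast A u ≡ true
  from u le with atLeast A u in e
  ... | true  = refl
  ... | false with () ← subst T e (≤⇒≤ᵇ le)

-- Binary search for a number whose leading bits are known, last bit first, on S₅. The reverse of x is
-- on S₄, and S₆ counts the remaining bits but one.

search : Lang → Str → Str → Str → Str
search L x r []            = L (pair x ((true ∷ r) ʳ++ [])) ∷ r
search L x r (_ ∷ counter) = search L x (L (pair x ((true ∷ r) ʳ++ [])) ∷ r) counter

search-length : ∀ L x r counter → length (search L x r counter) ≡ suc (length r + length counter)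
search-length L x r []            = cong suc (sym (+-identityʳ _))
search-length L x r (_ ∷ counter) = trans (search-length L x _ counter) (cong suc (sym (+-suc _ _)))

-- The instances of a single round. Measured by |x| alone, they give one time bound for all rounds
-- of a search, which is where `r≤` enters.
record Query : Set where
  constructor query
  field
    x r counter : Str
    r≤          : length r ≤ length x

-- The counter is tested after the bit has been recorded, so a counter of length |x| yields the |x|
-- + 1 bits of a rank.
recordBit : Tree 7 Sym
recordBit = pop S₀ λ
  { nothing  → ret nothing
  ; (just a) → push S₅ a (pop S₆ λ { nothing → ret (just true) ; (just _) → ret nothing }) }

-- The question is written from its end: the trial bit 1, the known bits, the separator, the doubled
-- x. `S₃` buffers what has to be restored.
searching₁ : TM → SM 7
searching₁ M =
    write ((S₀ , true) ∷ [])
  ⨾ each S₅ (λ b → (S₀ , b) ∷ (S₃ , b) ∷ [])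
  ⨾ each S₃ (moveTo S₅)
  ⨾ write ((S₀ , true) ∷ (S₀ , false) ∷ [])
  ⨾ each S₄ (λ b → (S₀ , b) ∷ (S₀ , b) ∷ (S₃ , b) ∷ [])
  ⨾ each S₃ (moveTo S₄)
  ⨾ call M
  ⨾ straight recordBit

searchEnv : Str → Str → Str → Env 7
searchEnv x r counter = [] ∷ [] ∷ [] ∷ [] ∷ (x ʳ++ []) ∷ r ∷ counter ∷ []

module _ (L : Lang) (M : TM) (c : ℕ) (h : ∀ x → HaltsWith M x ((length x + c) ^ c) (L x ∷ [])) where

  private
    open Query

    sz : Query → ℕ
    sz q = length (x q)

    asked : Query → Str
    asked q = pair (x q) ((true ∷ r q) ʳ++ [])

    asked-poly : PolyBounded sz (length ∘ asked)
    asked-poly = PB-≤ (λ q → ≤-trans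
        (≤-reflexive (trans (pair-length (x q) _) (cong (λ n → suc (suc (length (x q) * 2 + n)))
        (reverse-length (true ∷ r q)))))
                                     (s≤s (s≤s (+-monoʳ-≤ (length (x q) * 2) (s≤s (r≤ q))))))
                   (PB-suc (PB-suc (PB-+ (PB-* PB-size (PB-const 2)) (PB-suc PB-size))))

    r-poly : PolyBounded sz (length ∘ r)
    r-poly = PB-≤ r≤ PB-size

    exitOf : Str → Sym
    exitOf []      = just true
    exitOf (_ ∷ _) = nothing

    searching₁-poly : PolyExits sz (searching₁ M) (λ q → searchEnv (x q) (r q) (counter q)) (λ q → exitOf (counter q))
                                   (λ q → searchEnv (x q) (L (asked q) ∷ r q) (tl (counter q)))
    searching₁-poly =
             straight-poly _ (λ q → searchEnv (x q) (r q) (counter q))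
      ⨾-poly each-poly S₅ _ (λ q s v → (v ++ true ∷ []) ∷ [] ∷ [] ∷ v ∷ (x q ʳ++ []) ∷ s ∷ counter q ∷ [])
          (λ v b → b ∷ v) (λ _ _ → refl) (λ _ _ _ _ → refl)
               r (λ _ → []) r-poly
      ⨾-poly retarget (λ q → cong₂ (λ v w → v ∷ [] ∷ [] ∷ [] ∷ (x q ʳ++ []) ∷ w ∷ counter q ∷ [])
          (sym (ʳ++-defn (r q))) (trans (reverse-twice (r q)) (++-identityʳ (r q))))
             (each-poly S₃ (moveTo S₅) (λ q s v → ((r q ʳ++ []) ++ true ∷ []) ∷ [] ∷ [] ∷ s ∷ (x q ʳ++ []) ∷ v ∷
                 counter q ∷ []) (λ v b → b ∷ v) (λ _ _ → refl) (λ _ _ _ _ → refl)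
               (λ q → r q ʳ++ []) (λ _ → []) (PB-≤ (λ q → ≤-reflexive (reverse-length (r q))) r-poly))
      ⨾-poly straight-poly _ (λ q → (r q ʳ++ true ∷ []) ∷ [] ∷ [] ∷ [] ∷ (x q ʳ++ []) ∷ r q ∷ counter q ∷ [])
      ⨾-poly retarget (λ q → cong (λ v → (double v ++ false ∷ true ∷ (r q ʳ++ true ∷ [])) ∷ [] ∷ [] ∷ v ∷ [] ∷ r q ∷
          counter q ∷ []) (trans (reverse-twice (x q)) (++-identityʳ (x q))))
             (each-poly S₄ _ (λ q s v → (double v ++ false ∷ true ∷ (r q ʳ++ true ∷ [])) ∷ [] ∷ [] ∷ v ∷ s ∷ r q ∷
                 counter q ∷ []) (λ v b → b ∷ v) (λ _ _ → refl) (λ _ _ _ _ → refl)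
               (λ q → x q ʳ++ []) (λ _ → []) (PB-≤ (λ q → ≤-reflexive (reverse-length (x q))) PB-size))
      ⨾-poly each-poly S₃ (moveTo S₄) (λ q s v → asked q ∷ [] ∷ [] ∷ s ∷ v ∷ r q ∷ counter q ∷ []) (λ v b → b ∷ v)
          (λ _ _ → refl) (λ _ _ _ _ → refl)
               x (λ _ → []) PB-size
      ⨾-poly call-poly M c asked (λ q → L (asked q) ∷ []) (λ q → h (asked q)) asked-poly
          (λ q → (x q ʳ++ []) ∷ r q ∷ counter q ∷ [])
      ⨾-poly polyExits (λ _ → 1) (PB-const 1)
          (λ q → straight-exits recordBit (recorded (x q) (r q) (counter q) (L (asked q))))
      where
      recorded : ∀ x r counter b → exec recordBit ((b ∷ []) ∷ [] ∷ [] ∷ [] ∷ (x ʳ++ []) ∷ r ∷ counter ∷ []) ≡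
          (exitOf counter , searchEnv x (b ∷ r) (tl counter))
      recorded x r []      b = refl
      recorded x r (_ ∷ _) b = refl

  private
    Step : ℕ → Query → Set
    Step n q = Exits (searching₁ M) n (searchEnv (x q) (r q) (counter q)) (exitOf (counter q))
        (searchEnv (x q) (L (asked q) ∷ r q) (tl (counter q)))
      where open Query

  searching-exits : ∀ x {n} → (∀ r counter r≤ → Step n (query x r counter r≤)) → ∀ r counter → length r + length
      counter ≡ length x →
                    Exits (loop (searching₁ M)) (suc (length counter) * n) (searchEnv x r counter) (just true)
                        (searchEnv x (search L x r counter) [])
  searching-exits x step r []            eq = loop-exit (searching₁ M)
      (step r [] (≤-trans (m≤m+n _ _) (≤-reflexive eq)))
  searching-exits x step r (b ∷ counter) eq =
    loop-again (searching₁ M) (step r (b ∷ counter) (≤-trans (m≤m+n _ _) (≤-reflexive eq)))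
      (searching-exits x step _ counter (trans (sym (+-suc (length r) (length counter))) eq))

  searching : SM 7
  searching = each S₀ (λ b → (S₄ , b) ∷ (S₆ , b) ∷ []) ⨾ loop (searching₁ M) ⨾ each S₅ (moveTo S₀)

  private
    found : Str → Str
    found x = search L x [] (x ʳ++ [])

    searching-poly′ : ∃[ d ] (∀ q → Step ((sz q + d) ^ d) q) →
      PolyExits length searching (λ x → x ∷ replicate 6 []) (λ _ → nothing) (λ x → (found x ʳ++ []) ∷ [] ∷ [] ∷ [] ∷
          (x ʳ++ []) ∷ [] ∷ [] ∷ [])
    searching-poly′ (d , step) =
             each-poly S₀ _ (λ _ s v → s ∷ [] ∷ [] ∷ [] ∷ v ∷ [] ∷ v ∷ []) (λ v b → b ∷ v) (λ _ _ → refl)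
                 (λ _ _ _ _ → refl)
               id (λ _ → []) PB-size
      ⨾-poly polyExits (λ x → suc (length (x ʳ++ [])) * (length x + d) ^ d)
               (PB-* (PB-suc (PB-≤ (λ x → ≤-reflexive (reverse-length x)) PB-size))
                   (PB-^ d (PB-+ PB-size (PB-const d))))
               (λ x → searching-exits x (λ r counter r≤ → step (query x r counter r≤)) [] (x ʳ++ [])
                   (reverse-length x))
      ⨾-poly each-poly S₅ (moveTo S₀) (λ x s v → v ∷ [] ∷ [] ∷ [] ∷ (x ʳ++ []) ∷ s ∷ [] ∷ []) (λ v b → b ∷ v)
          (λ _ _ → refl) (λ _ _ _ _ → refl)
               found (λ _ → []) (PB-≤ (λ x → ≤-reflexive (trans (search-length L x [] (x ʳ++ []))
                   (cong suc (reverse-length x)))) (PB-suc PB-size))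

  searching-poly : PolyExits length searching (λ x → x ∷ replicate 6 []) (λ _ → nothing)
      (λ x → (search L x [] (x ʳ++ []) ʳ++ []) ∷ [] ∷ [] ∷ [] ∷ (x ʳ++ []) ∷ [] ∷ [] ∷ [])
  searching-poly = searching-poly′ (PolyExits-uniform searching₁-poly)

-- The interval from v·2p to (v + 1)·2p is cut at its midpoint (2v + 1)·p, and the answer keeps the
-- half that contains `R`.
next-bit : ∀ R v p b → b ≡ ((2 * v + 1) * p ≤ᵇ R) → v * (2 * p) ≤ R → R < suc v * (2 * p) →
           (2 * v + 𝟙 b) * p ≤ R × R < suc (2 * v + 𝟙 b) * p
next-bit R v p b eq lo hi with (2 * v + 1) * p ≤ᵇ R in e
next-bit R v p .true refl lo hi | true = ≤ᵇ⇒≤ _ R (subst T (sym e) tt) , ≤-trans hi (≤-reflexive (lemma v p))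
  where
  lemma : ∀ v p → suc v * (2 * p) ≡ suc (2 * v + 1) * p
  lemma = solve-∀
next-bit R v p .false refl lo hi | false =
  ≤-trans (≤-reflexive (lemma v p)) lo ,
  ≤-trans (≰⇒> λ le → subst T e (≤⇒≤ᵇ le)) (≤-reflexive (lemma′ v p))
  where
  lemma : ∀ v p → (2 * v + 0) * p ≡ v * (2 * p)
  lemma = solve-∀
  lemma′ : ∀ v p → (2 * v + 1) * p ≡ suc (2 * v + 0) * p
  lemma′ = solve-∀

-- Invariant: with i bits missing, revVal r · 2ⁱ ≤ rank < (revVal r + 1) · 2ⁱ.
search-correct : ∀ A x r counter → length r + length counter ≡ length x →
  revVal r * 2 ^ suc (length counter) ≤ rank A x → rank A x < suc (revVal r) * 2 ^ suc (length counter) →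
  revVal (search (atLeast A) x r counter) ≡ rank A x
search-correct A x r counter eq lo hi with next-bit (rank A x) (revVal r) (2 ^ length counter) _
    (atLeast-rank A x (true ∷ r) (length counter) (cong suc eq)) lo hi
search-correct A x r [] eq lo hi | lo′ , hi′ =
  -- No bit is missing any more: the interval contains a single number.
  ≤-antisym (subst (_≤ rank A x) (*-identityʳ _) lo′) (≤-pred (subst (rank A x <_) (*-identityʳ _) hi′))
search-correct A x r (b ∷ counter) eq lo hi | lo′ , hi′ =
  search-correct A x _ counter (trans (sym (+-suc (length r) (length counter))) eq) lo′ hi′

atLeast-InP⇒rankable : ∀ A → InP (atLeast A) → Rankable A
atLeast-InP⇒rankable A (M , c , h) = Compile.tm p , proj₁ halting , λ x → y x , proj₂ halting x , value x
  where
  p = searching (atLeast A) M c h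
  y : Str → Str
  y x = search (atLeast A) x [] (x ʳ++ []) ʳ++ []
  halting : ∃[ d ] (∀ x → HaltsWith (Compile.tm p) x ((length x + d) ^ d) (y x))
  halting = compiled-halts p id y _ (searching-poly (atLeast A) M c h)
  value : ∀ x → binVal (y x) ≡ rank A x
  value x = begin
    binVal (y x)                              ≡⟨ reverse-revVal (y x) ⟨
    revVal (y x ʳ++ [])                       ≡⟨ cong revVal (trans (reverse-twice r) (++-identityʳ r)) ⟩
    -- With no bit known, the interval reaches from 0 to 2ⁿ⁺¹. The reverse of x serves as the
    -- counter, through its length only.
    revVal r                                  ≡⟨ search-correct A x [] (x ʳ++ []) (reverse-length x) z≤n
                                                   (subst (λ n → rank A x < 1 * 2 ^ suc n) (sym (reverse-length x))
                                                       (subst (rank A x <_) (sym (*-identityˡ _)) (rank-< A x))) ⟩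
    rank A x                                  ∎
    where
    open ≡-Reasoning
    r = search (atLeast A) x [] (x ʳ++ [])

theorem3p2 : ((∀ A → InP A → CensusPolyTime A → Rankable A) → PeqPP)
    × (PeqPP → (∀ A → InP A → CensusPolyTime A → Rankable A))
theorem3p2 = (λ rankable L → InP⇒InPP L , rankable⇒InPP⊆InP rankable L)
           , λ P≡PP A A∈P _ → atLeast-InP⇒rankable A (proj₂ (P≡PP (atLeast A)) (atLeast-InPP A A∈P))
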